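{- Let $G$ be a red-blue colouring of $K_n$, let $u \in V(G)$, and let $H = G \setminus \{u\}$. If $H \in \mathcal{C}$, then either $\mathrm{pack}(G) > n(n-1)/4$ or $G \in \mathcal{C}$.
   Context: A red-blue colouring $G$ of $K_n$ assigns red or blue to each edge of the complete graph on the $n$-vertex set $V(G)$; $G_R, G_B$ are the spanning subgraphs of red and blue edges, and $G\setminus\{u\}$ is the colouring induced on $V(G)\setminus\{u\}$. For a graph $F$, a fractional triangle packing is a function $\omega$ from the triangles of $F$ to $[0,1]$ with $\sum_{T \ni e}\omega(T) \le 1$ for every edge $e$; $\nu^*(F)$ is the maximum of $\sum_T\omega(T)$; $\mathrm{pack}(G) = 3(\nu^*(G_R)+\nu^*(G_B))$. $G$ is a pentagon blow-up with blobs $A_1,\dots,A_5$ if $\{A_1,\dots,A_5\}$ is a partition of $V(G)$ into non-empty sets such that all edges between $A_i$ and $A_{i+1}$ are red and all edges between $A_i$ and $A_{i+2}$ are blue for $i \in [5]$ (indices modulo 5; edges inside a blob are coloured arbitrarily); its blob sizes are $|A_1|,\dots,|A_5|$. $G$ is one edge-flip away from a pentagon blow-up with given blob sizes if changing the colour of a single edge of $G$ yields a pentagon blow-up with those blob sizes. Let $\mathcal{B}_1 = \{(3,3,3,4,4), (2,3,4,4,4), (3,3,3,3,5), (3,3,4,4,4), (2,4,4,4,4), (3,3,3,4,5), (3,4,4,4,4), (3,3,4,4,5), (4,4,4,4,4), (3,4,4,4,5), (4,4,4,4,5), (3,4,4,5,5), (4,4,4,5,5), (4,4,5,5,5), (4,5,5,5,5),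 (5,5,5,5,5)\}$ and $\mathcal{B}_2 = \{(3,3,3,4,4), (3,3,4,4,4), (3,4,4,4,4), (4,4,4,4,4), (4,4,4,4,5)\}$. Let $\mathcal{C}_1$ be the family of pentagon blow-ups whose blob sizes, in some order, form a tuple in $\mathcal{B}_1$; let $\mathcal{C}_2$ be the family of red-blue colourings of complete graphs that are one edge-flip away from a pentagon blow-up whose blob sizes, in some order, form a tuple in $\mathcal{B}_2$; and $\mathcal{C} = \mathcal{C}_1 \cup \mathcal{C}_2$. -}

module Defs where

open import Data.Nat.Base as ℕ using (ℕ; zero; suc)
open import Data.Nat.DivMod using (_mod_)
open import Data.Fin.Base as Fin using (Fin; toℕ; punchIn; combine; remQuot)
open import Data.Fin.Properties using (remQuot-combine; _≟_; _<?_)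
open import Data.Integer.Base using (+_)
open import Data.Rational.Base using (ℚ; 0ℚ; 1ℚ; _+_; _*_; _-_; -_; _≤_; _<_; _>_; _/_; 1/_; _⊓_; _⊔_; ≢-nonZero; positive; nonNegative)
open import Data.Rational.Properties as ℚ using ()
open import Data.Rational.Solver using (module +-*-Solver)
open import Data.List.Base as List using (List; []; _∷_; _++_; map; foldr; filter; length; allFin; cartesianProduct; cartesianProductWith)
open import Data.List.Membership.Propositional using (_∈_)
open import Data.List.Membership.DecPropositional using () renaming (_∈?_ to mem?)
open import Data.List.Membership.Propositional.Properties using (∈-allFin; ∈-cartesianProduct⁺; ∈-filter⁺; ∈-filter⁻)
open import Data.List.Relation.Unary.All as All using (All; []; _∷_)
import Data.List.Relation.Unary.All.Properties as All
open import Data.List.Relation.Unary.Any using (here; there)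
open import Data.List.Relation.Binary.Permutation.Propositional using (_↭_)
open import Data.Vec.Base as Vec using (Vec; []; _∷_)
import Data.Vec.Properties as Vec
open import Data.Product.Base using (∃; ∃-syntax; _×_; _,_; proj₁; proj₂; map₂)
open import Data.Sum.Base using (_⊎_; inj₁; inj₂)
open import Data.Bool.Base using (if_then_else_)
open import Data.Empty using (⊥-elim)
open import Function.Base using (_∘_)
open import Relation.Nullary using (¬_)
open import Relation.Nullary.Decidable using (Dec; yes; no; does; _×-dec_; _⊎-dec_; ¬?)
open import Relation.Binary.Definitions using (DecidableEquality; tri<; tri≈; tri>)
open import Relation.Binary.PropositionalEquality using (_≡_; _≢_; refl; sym; trans; cong; cong₂; subst; module ≡-Reasoning)

record Graph (n : ℕ) : Set₁ where
  field
    Adj     : Fin n → Fin n → Set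
    adj?    : ∀ x y → Dec (Adj x y)
    adj-sym : ∀ {x y} → Adj x y → Adj y x
    irrefl  : ∀ {x} → ¬ Adj x x

open Graph public

Triple : ℕ → Set
Triple n = Fin n × Fin n × Fin n

-- Each triangle is listed once, with its vertices in increasing order.
IsTriangle : ∀ {n} → Graph n → Triple n → Set
IsTriangle F (i , j , k) =
  i Fin.< j × j Fin.< k × Adj F i j × Adj F j k × Adj F i k

isTriangle? : ∀ {n} (F : Graph n) (T : Triple n) → Dec (IsTriangle F T)
isTriangle? F (i , j , k) =
  (i <? j) ×-dec (j <? k) ×-dec adj? F i j ×-dec adj? F j k ×-dec adj? F i k

allTriples : ∀ n → List (Triple n)
allTriples n = cartesianProduct (allFin n) (cartesianProduct (allFin n) (allFin n))

triangles : ∀ {n} → Graph n → List (Triple n)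
triangles {n} F = filter (isTriangle? F) (allTriples n)

vertices : ∀ {n} → Triple n → List (Fin n)
vertices (i , j , k) = i ∷ j ∷ k ∷ []

-- For adjacent (hence distinct) x and y: the edge xy lies in the triangle T.
Contains : ∀ {n} → Fin n → Fin n → Triple n → Set
Contains x y T = x ∈ vertices T × y ∈ vertices T

contains? : ∀ {n} (x y : Fin n) (T : Triple n) → Dec (Contains x y T)
contains? x y T = mem? _≟_ x (vertices T) ×-dec mem? _≟_ y (vertices T)

∑ : ∀ {A : Set} → List A → (A → ℚ) → ℚ
∑ L f = foldr _+_ 0ℚ (map f L)

-- The values of ω on triples that are not triangles of F are never used.
record IsPacking {n} (F : Graph n) (ω : Triple n → ℚ) : Set where
  field
    ≥0   : ∀ T → IsTriangle F T → 0ℚ ≤ ω T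
    ≤1   : ∀ T → IsTriangle F T → ω T ≤ 1ℚ
    edge : ∀ x y → Adj F x y → ∑ (filter (contains? x y) (triangles F)) ω ≤ 1ℚ

weight : ∀ {n} → Graph n → (Triple n → ℚ) → ℚ
weight F ω = ∑ (triangles F) ω

record IsMaxWeight {n} (F : Graph n) (v : ℚ) : Set where
  field
    attained : ∃[ ω ] IsPacking F ω × weight F ω ≡ v
    bound    : ∀ ω → IsPacking F ω → weight F ω ≤ v

-- Existence of the maximum: a bounded, feasible rational linear programme
-- attains its maximum, by Fourier–Motzkin elimination.

private

  module LP where

    open +-*-Solver

    -- (w , c) stands for the constraint 0 ≤ w · x + c.
    Con : ℕ → Set
    Con m = Vec ℚ m × ℚ

    dot : ∀ {m} → Vec ℚ m → Vec ℚ m → ℚ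
    dot []      []      = 0ℚ
    dot (a ∷ w) (y ∷ x) = a * y + dot w x

    eval : ∀ {m} → Con m → Vec ℚ m → ℚ
    eval (w , c) x = dot w x + c

    Sat : ∀ {m} → List (Con m) → Vec ℚ m → Set
    Sat S x = All (λ f → 0ℚ ≤ eval f x) S

    ≤⇒0≤ : ∀ {p q} → p ≤ q → 0ℚ ≤ q - p
    ≤⇒0≤ {p} {q} le = subst (_≤ q - p) (ℚ.+-inverseʳ p) (ℚ.+-monoˡ-≤ (- p) le)

    0≤⇒≤ : ∀ {p q} → 0ℚ ≤ q - p → p ≤ q
    0≤⇒≤ {p} {q} le = subst (_≤ q) (ℚ.+-identityˡ p)
      (subst (0ℚ + p ≤_) (solve 2 (λ q p → (q :- p) :+ p := q) refl q p)
        (ℚ.+-monoˡ-≤ p le))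

    0≤a*⇒0≤ : ∀ a z → a > 0ℚ → 0ℚ ≤ a * z → 0ℚ ≤ z
    0≤a*⇒0≤ a z a>0 le =
      ℚ.*-cancelˡ-≤-pos a {{positive a>0}} (subst (_≤ a * z) (sym (ℚ.*-zeroʳ a)) le)

    0≤⇒0≤a* : ∀ a z → a > 0ℚ → 0ℚ ≤ z → 0ℚ ≤ a * z
    0≤⇒0≤a* a z a>0 le = subst (_≤ a * z) (ℚ.*-zeroʳ a)
      (ℚ.*-monoˡ-≤-nonNeg a {{nonNegative (ℚ.<⇒≤ a>0)}} le)

    scale : ∀ {m} → ℚ → Con m → Con m
    scale k (w , c) = Vec.map (k *_) w , k * c

    _⊖_ : ∀ {m} → Con m → Con m → Con m
    (w , c) ⊖ (w′ , c′) = Vec.zipWith _-_ w w′ , c - c′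

    dot-scale : ∀ {m} k (w x : Vec ℚ m) → dot (Vec.map (k *_) w) x ≡ k * dot w x
    dot-scale k []      []      = sym (ℚ.*-zeroʳ k)
    dot-scale k (a ∷ w) (y ∷ x) rewrite dot-scale k w x =
      solve 4 (λ k a y d → k :* a :* y :+ k :* d := k :* (a :* y :+ d)) refl k a y (dot w x)

    eval-scale : ∀ {m} k (f : Con m) x → eval (scale k f) x ≡ k * eval f x
    eval-scale k (w , c) x rewrite dot-scale k w x = sym (ℚ.*-distribˡ-+ k (dot w x) c)

    dot-sub : ∀ {m} (v w x : Vec ℚ m) → dot (Vec.zipWith _-_ v w) x ≡ dot v x - dot w x
    dot-sub []      []      []      = refl
    dot-sub (a ∷ v) (b ∷ w) (y ∷ x) rewrite dot-sub v w x =
      solve 5 (λ a b y d e → (a :- b) :* y :+ (d :- e) := (a :* y :+ d) :- (b :* y :+ e))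
        refl a b y (dot v x) (dot w x)

    eval-sub : ∀ {m} (f g : Con m) x → eval (f ⊖ g) x ≡ eval f x - eval g x
    eval-sub (v , c) (w , d) x rewrite dot-sub v w x =
      solve 4 (λ a b c d → (a :- b) :+ (c :- d) := (a :+ c) :- (b :+ d))
        refl (dot v x) (dot w x) c d

    dot-add : ∀ {m} (v w x : Vec ℚ m) → dot (Vec.zipWith _+_ v w) x ≡ dot v x + dot w x
    dot-add []      []      []      = refl
    dot-add (a ∷ v) (b ∷ w) (y ∷ x) rewrite dot-add v w x =
      solve 5 (λ a b y d e → (a :+ b) :* y :+ (d :+ e) := (a :* y :+ d) :+ (b :* y :+ e))
        refl a b y (dot v x) (dot w x)

    dot-zero : ∀ {m} (x : Vec ℚ m) → dot (Vec.replicate m 0ℚ) x ≡ 0ℚ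
    dot-zero []      = refl
    dot-zero (y ∷ x) rewrite dot-zero x = solve 1 (λ y → con 0ℚ :* y :+ con 0ℚ := con 0ℚ) refl y

    unit : ∀ {m} → Fin m → Vec ℚ m
    unit Fin.zero    = 1ℚ ∷ Vec.replicate _ 0ℚ
    unit (Fin.suc i) = 0ℚ ∷ unit i

    dot-unit : ∀ {m} (i : Fin m) x → dot (unit i) x ≡ Vec.lookup x i
    dot-unit Fin.zero    (y ∷ x) rewrite dot-zero x =
      solve 1 (λ y → con 1ℚ :* y :+ con 0ℚ := y) refl y
    dot-unit (Fin.suc i) (y ∷ x) rewrite dot-unit i x =
      solve 2 (λ y d → con 0ℚ :* y :+ d := d) refl y (Vec.lookup x i)

    record Bounds (m : ℕ) : Set where
      constructor bounds
      field lower upper other : List (Con m)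

    open Bounds

    record Sat′ {m} (B : Bounds m) (y : ℚ) (x : Vec ℚ m) : Set where
      constructor sat′
      field
        ≥lower : All (λ f → eval f x ≤ y) (lower B)
        ≤upper : All (λ f → y ≤ eval f x) (upper B)
        others : Sat (other B) x

    split : ∀ {m} → List (Con (suc m)) → Bounds m
    split [] = bounds [] [] []
    split ((a ∷ w , c) ∷ S) with ℚ.<-cmp a 0ℚ | split S
    ... | tri> _ a≢0 _ | bounds l u o = bounds (scale (- (1/ a) {{≢-nonZero a≢0}}) (w , c) ∷ l) u o
    ... | tri< _ a≢0 _ | bounds l u o = bounds l (scale (- (1/ a) {{≢-nonZero a≢0}}) (w , c) ∷ u) o
    ... | tri≈ _ _ _   | bounds l u o = bounds l u ((w , c) ∷ o)

    identity> : ∀ a i y d c → a * i ≡ 1ℚ →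
                (a * y + d) + c ≡ a * (y - (- i) * (d + c))
    identity> a i y d c ai≡1 = begin
      (a * y + d) + c                ≡⟨ solve 4 (λ a y d c → (a :* y :+ d) :+ c := a :* y :+ con 1ℚ :* (d :+ c)) refl a y d c ⟩
      a * y + 1ℚ * (d + c)           ≡⟨ cong (λ z → a * y + z * (d + c)) (sym ai≡1) ⟩
      a * y + (a * i) * (d + c)      ≡⟨ solve 5 (λ a i y d c → a :* y :+ (a :* i) :* (d :+ c) := a :* (y :- (:- i) :* (d :+ c))) refl a i y d c ⟩
      a * (y - (- i) * (d + c))      ∎
      where open ≡-Reasoning

    identity< : ∀ a i y d c → a * i ≡ 1ℚ →
                (a * y + d) + c ≡ (- a) * ((- i) * (d + c) - y)
    identity< a i y d c ai≡1 = trans (identity> a i y d c ai≡1)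
      (solve 3 (λ a y e → a :* (y :- e) := (:- a) :* (e :- y)) refl a y ((- i) * (d + c)))

    split-sound : ∀ {m} (S : List (Con (suc m))) {y x} → Sat S (y ∷ x) → Sat′ (split S) y x
    split-sound [] [] = sat′ [] [] []
    split-sound ((a ∷ w , c) ∷ S) {y} {x} (s ∷ ss)
      with ℚ.<-cmp a 0ℚ | split S | split-sound S {y} {x} ss
    ... | tri> _ a≢0 a>0 | bounds l u o | sat′ p q r = sat′ (new ∷ p) q r
      where
        i = (1/ a) {{≢-nonZero a≢0}}
        new : eval (scale (- i) (w , c)) x ≤ y
        new = subst (_≤ y) (sym (eval-scale (- i) (w , c) x))
          (0≤⇒≤ (0≤a*⇒0≤ a _ a>0
            (subst (0ℚ ≤_) (identity> a i y (dot w x) c (ℚ.*-inverseʳ a {{≢-nonZero a≢0}})) s)))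
    ... | tri< a<0 a≢0 _ | bounds l u o | sat′ p q r = sat′ p (new ∷ q) r
      where
        i = (1/ a) {{≢-nonZero a≢0}}
        new : y ≤ eval (scale (- i) (w , c)) x
        new = subst (y ≤_) (sym (eval-scale (- i) (w , c) x))
          (0≤⇒≤ (0≤a*⇒0≤ (- a) _ (ℚ.neg-antimono-< a<0)
            (subst (0ℚ ≤_) (identity< a i y (dot w x) c (ℚ.*-inverseʳ a {{≢-nonZero a≢0}})) s)))
    ... | tri≈ _ refl _ | bounds l u o | sat′ p q r = sat′ p q (new ∷ r)
      where
        new : 0ℚ ≤ eval (w , c) x
        new = subst (0ℚ ≤_)
          (solve 3 (λ y d c → (con 0ℚ :* y :+ d) :+ c := d :+ c) refl y (dot w x) c) s

    split-complete : ∀ {m} (S : List (Con (suc m))) {y x} → Sat′ (split S) y x → Sat S (y ∷ x)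
    split-complete [] _ = []
    split-complete ((a ∷ w , c) ∷ S) {y} {x} s
      with ℚ.<-cmp a 0ℚ | split S | split-complete S {y} {x}
    split-complete ((a ∷ w , c) ∷ S) {y} {x} (sat′ (new ∷ p) q r)
      | tri> _ a≢0 a>0 | bounds l u o | rec = old ∷ rec (sat′ p q r)
      where
        i = (1/ a) {{≢-nonZero a≢0}}
        old : 0ℚ ≤ eval (a ∷ w , c) (y ∷ x)
        old = subst (0ℚ ≤_) (sym (identity> a i y (dot w x) c (ℚ.*-inverseʳ a {{≢-nonZero a≢0}})))
          (0≤⇒0≤a* a _ a>0 (≤⇒0≤ (subst (_≤ y) (eval-scale (- i) (w , c) x) new)))
    split-complete ((a ∷ w , c) ∷ S) {y} {x} (sat′ p (new ∷ q) r)
      | tri< a<0 a≢0 _ | bounds l u o | rec = old ∷ rec (sat′ p q r)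
      where
        i = (1/ a) {{≢-nonZero a≢0}}
        old : 0ℚ ≤ eval (a ∷ w , c) (y ∷ x)
        old = subst (0ℚ ≤_) (sym (identity< a i y (dot w x) c (ℚ.*-inverseʳ a {{≢-nonZero a≢0}})))
          (0≤⇒0≤a* (- a) _ (ℚ.neg-antimono-< a<0) (≤⇒0≤ (subst (y ≤_) (eval-scale (- i) (w , c) x) new)))
    split-complete ((a ∷ w , c) ∷ S) {y} {x} (sat′ p q (new ∷ r))
      | tri≈ _ refl _ | bounds l u o | rec = old ∷ rec (sat′ p q r)
      where
        old : 0ℚ ≤ eval (0ℚ ∷ w , c) (y ∷ x)
        old = subst (0ℚ ≤_)
          (sym (solve 3 (λ y d c → (con 0ℚ :* y :+ d) :+ c := d :+ c) refl y (dot w x) c)) new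

    least : ℚ → List ℚ → ℚ
    least z us = foldr _⊓_ z us

    least≤ : ∀ z us → All (least z us ≤_) us
    least≤ z []       = []
    least≤ z (u ∷ us) = ℚ.p⊓q≤p u (least z us) ∷
      All.map (ℚ.≤-trans (ℚ.p⊓q≤q u (least z us))) (least≤ z us)

    least≤z : ∀ z us → least z us ≤ z
    least≤z z []       = ℚ.≤-refl
    least≤z z (u ∷ us) = ℚ.≤-trans (ℚ.p⊓q≤q u (least z us)) (least≤z z us)

    ≤least : ∀ {p} z us → p ≤ z → All (p ≤_) us → p ≤ least z us
    ≤least z []       p≤z []       = p≤z
    ≤least z (u ∷ us) p≤z (h ∷ hs) = ℚ.⊓-glb h (≤least z us p≤z hs)

    greatest : ℚ → List ℚ → ℚ
    greatest z ls = foldr _⊔_ z ls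

    ≤greatest : ∀ z ls → All (_≤ greatest z ls) ls
    ≤greatest z []       = []
    ≤greatest z (l ∷ ls) = ℚ.p≤p⊔q l (greatest z ls) ∷
      All.map (λ h → ℚ.≤-trans h (ℚ.p≤q⊔p l (greatest z ls))) (≤greatest z ls)

    greatest≤ : ∀ {p} z ls → z ≤ p → All (_≤ p) ls → greatest z ls ≤ p
    greatest≤ z []       z≤p []       = z≤p
    greatest≤ z (l ∷ ls) z≤p (h ∷ hs) = ℚ.⊔-lub h (greatest≤ z ls z≤p hs)

    z≤greatest : ∀ z ls → z ≤ greatest z ls
    z≤greatest z []       = ℚ.≤-refl
    z≤greatest z (l ∷ ls) = ℚ.≤-trans (z≤greatest z ls) (ℚ.p≤q⊔p l (greatest z ls))

    between : ∀ ls us → All (λ u → All (_≤ u) ls) us → ∃[ y ] All (_≤ y) ls × All (y ≤_) us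
    between []       us h = least 0ℚ us , [] , least≤ 0ℚ us
    between (l ∷ ls) us h =
      greatest l ls , z≤greatest l ls ∷ ≤greatest l ls ,
      All.map (λ { (p ∷ ps) → greatest≤ l ls p ps }) h

    elim : ∀ {m} → List (Con (suc m)) → List (Con m)
    elim S = other (split S) ++ cartesianProductWith _⊖_ (upper (split S)) (lower (split S))

    pairs⁻ : ∀ {A B C : Set} {P : C → Set} (f : A → B → C) xs ys →
             All P (cartesianProductWith f xs ys) → All (λ x → All (λ y → P (f x y)) ys) xs
    pairs⁻ f []       ys h = []
    pairs⁻ f (x ∷ xs) ys h =
      All.map⁻ (All.++⁻ˡ (map (f x) ys) h) ∷ pairs⁻ f xs ys (All.++⁻ʳ (map (f x) ys) h)

    pairs⁺ : ∀ {A B C : Set} {P : C → Set} (f : A → B → C) xs ys →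
             All (λ x → All (λ y → P (f x y)) ys) xs → All P (cartesianProductWith f xs ys)
    pairs⁺ f []       ys []      = []
    pairs⁺ f (x ∷ xs) ys (h ∷ t) = All.++⁺ (All.map⁺ h) (pairs⁺ f xs ys t)

    elim-sound : ∀ {m} (S : List (Con (suc m))) {y x} → Sat S (y ∷ x) → Sat (elim S) x
    elim-sound S {y} {x} s with split S | split-sound S {y} {x} s
    ... | bounds l u o | sat′ p q r = All.++⁺ r (pairs⁺ _⊖_ u l
      (All.map (λ {f} y≤f → All.map (λ {g} g≤y →
        subst (0ℚ ≤_) (sym (eval-sub f g x)) (≤⇒0≤ (ℚ.≤-trans g≤y y≤f))) p) q))

    elim-complete : ∀ {m} (S : List (Con (suc m))) {x} → Sat (elim S) x → ∃[ y ] Sat S (y ∷ x)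
    elim-complete S {x} s with split S | (λ y → split-complete S {y} {x})
    ... | bounds l u o | complete =
      let r = All.++⁻ˡ o s
          h = pairs⁻ _⊖_ u l (All.++⁻ʳ o s)
          (y , p , q) = between (map (λ f → eval f x) l) (map (λ f → eval f x) u)
            (All.map⁺ (All.map (λ {f} k → All.map⁺ (All.map (λ {g} 0≤ →
              0≤⇒≤ (subst (0ℚ ≤_) (eval-sub f g x) 0≤)) k)) h))
      in y , complete y (sat′ (All.map⁻ p) (All.map⁻ q) r)

    -- The objective value t is kept as the last variable.

    elims : ∀ m → List (Con (m ℕ.+ 1)) → List (Con 1)
    elims zero    S = S
    elims (suc m) S = elims m (elim S)

    elims-sound : ∀ m S (x : Vec ℚ m) t → Sat S (x Vec.++ t ∷ []) → Sat (elims m S) (t ∷ [])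
    elims-sound zero    S []      t s = s
    elims-sound (suc m) S (y ∷ x) t s = elims-sound m (elim S) x t (elim-sound S s)

    elims-complete : ∀ m S t → Sat (elims m S) (t ∷ []) → ∃[ x ] Sat S (x Vec.++ t ∷ [])
    elims-complete zero    S t s = [] , s
    elims-complete (suc m) S t s =
      let (x , h) = elims-complete m (elim S) t s
          (y , k) = elim-complete S h
      in y ∷ x , k

    max₁ : (S : List (Con 1)) (t₀ B : ℚ) → Sat S (t₀ ∷ []) → (∀ t → Sat S (t ∷ []) → t ≤ B) →
           ∃[ t ] Sat S (t ∷ []) × (∀ t′ → Sat S (t′ ∷ []) → t′ ≤ t)
    max₁ S t₀ B s₀ bnd
      with split S | (λ t → split-sound S {t} {[]}) | (λ t → split-complete S {t} {[]})
    ... | bounds l [] o | sound | complete with sound t₀ s₀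
    ... | sat′ p _ r = ⊥-elim (ℚ.<-irrefl refl (ℚ.<-≤-trans B<B+1 (ℚ.≤-trans (ℚ.p≤q⊔p t₀ (B + 1ℚ)) too-big)))
      where
        too-big : t₀ ⊔ (B + 1ℚ) ≤ B
        too-big = bnd _ (complete _ (sat′ (All.map (λ h → ℚ.≤-trans h (ℚ.p≤p⊔q t₀ (B + 1ℚ))) p) [] r))
        B<B+1 : B < B + 1ℚ
        B<B+1 = subst (_< B + 1ℚ) (ℚ.+-identityʳ B) (ℚ.+-monoʳ-< B (ℚ.positive⁻¹ 1ℚ))
    max₁ S t₀ B s₀ bnd | bounds l (u ∷ us) o | sound | complete with sound t₀ s₀
    ... | sat′ p (q ∷ qs) r = t , complete t (sat′ p′ q′ r) , best
      where
        val : Con 0 → ℚ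
        val f = eval f []
        t = least (val u) (map val us)
        t₀≤t : t₀ ≤ t
        t₀≤t = ≤least (val u) (map val us) q (All.map⁺ qs)
        p′ : All (λ f → val f ≤ t) l
        p′ = All.map (λ h → ℚ.≤-trans h t₀≤t) p
        q′ : All (λ f → t ≤ val f) (u ∷ us)
        q′ = least≤z (val u) (map val us) ∷ All.map⁻ (least≤ (val u) (map val us))
        best : ∀ t′ → Sat S (t′ ∷ []) → t′ ≤ t
        best t′ s′ with sound t′ s′
        ... | sat′ _ (h ∷ hs) _ = ≤least (val u) (map val us) h (All.map⁺ hs)

    dot-snoc : ∀ {m} (w x : Vec ℚ m) d t →
               dot (w Vec.++ d ∷ []) (x Vec.++ t ∷ []) ≡ dot w x + d * t
    dot-snoc []      []      d t = solve 2 (λ d t → d :* t :+ con 0ℚ := con 0ℚ :+ d :* t) refl d t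
    dot-snoc (a ∷ w) (y ∷ x) d t rewrite dot-snoc w x d t =
      sym (ℚ.+-assoc (a * y) (dot w x) (d * t))

    snoc : ∀ {m} → ℚ → Con m → Con (m ℕ.+ 1)
    snoc d (w , c) = w Vec.++ d ∷ [] , c

    eval-snoc : ∀ {m} d (f : Con m) x t → eval (snoc d f) (x Vec.++ t ∷ []) ≡ eval f x + d * t
    eval-snoc d (w , c) x t rewrite dot-snoc w x d t =
      solve 3 (λ a b c → (a :+ b) :+ c := (a :+ c) :+ b) refl (dot w x) (d * t) c

    eval-snoc₀ : ∀ {m} (f : Con m) x t → eval (snoc 0ℚ f) (x Vec.++ t ∷ []) ≡ eval f x
    eval-snoc₀ f x t = trans (eval-snoc 0ℚ f x t)
      (solve 2 (λ e t → e :+ con 0ℚ :* t := e) refl (eval f x) t)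

    eval-snoc₋₁ : ∀ {m} (f : Con m) x t → eval (snoc (- 1ℚ) f) (x Vec.++ t ∷ []) ≡ eval f x - t
    eval-snoc₋₁ f x t = trans (eval-snoc (- 1ℚ) f x t)
      (solve 2 (λ e t → e :+ (:- con 1ℚ) :* t := e :- t) refl (eval f x) t)

    lp-max : ∀ {m} (S : List (Con m)) (f : Con m) (B : ℚ) →
             ∃[ x ] Sat S x → (∀ x → Sat S x → eval f x ≤ B) →
             ∃[ x ] Sat S x × (∀ x′ → Sat S x′ → eval f x′ ≤ eval f x)
    lp-max {m} S f B (x₀ , s₀) bnd = x* , s* , λ x s → ℚ.≤-trans (best _ (elims-sound m S⁺ x _ (up x s))) t*≤
      where
        S⁺ : List (Con (m ℕ.+ 1))
        S⁺ = snoc (- 1ℚ) f ∷ map (snoc 0ℚ) S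
        up : ∀ x → Sat S x → Sat S⁺ (x Vec.++ eval f x ∷ [])
        up x s = subst (0ℚ ≤_) (sym (eval-snoc₋₁ f x (eval f x))) (≤⇒0≤ {eval f x} {eval f x} ℚ.≤-refl)
               ∷ All.map⁺ (All.map (λ {g} h → subst (0ℚ ≤_) (sym (eval-snoc₀ g x (eval f x))) h) s)
        down : ∀ x t → Sat S⁺ (x Vec.++ t ∷ []) → Sat S x × t ≤ eval f x
        down x t (h ∷ hs) =
          All.map (λ {g} → subst (0ℚ ≤_) (eval-snoc₀ g x t)) (All.map⁻ hs) ,
          0≤⇒≤ (subst (0ℚ ≤_) (eval-snoc₋₁ f x t) h)
        bnd₁ : ∀ t → Sat (elims m S⁺) (t ∷ []) → t ≤ B
        bnd₁ t s = let (x , h) = elims-complete m S⁺ t s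
                       (h₁ , h₂) = down x t h
                   in ℚ.≤-trans h₂ (bnd x h₁)
        opt = max₁ (elims m S⁺) (eval f x₀) B (elims-sound m S⁺ x₀ _ (up x₀ s₀)) bnd₁
        t* = proj₁ opt
        best = proj₂ (proj₂ opt)
        sol = elims-complete m S⁺ t* (proj₁ (proj₂ opt))
        x* = proj₁ sol
        s* = proj₁ (down x* t* (proj₂ sol))
        t*≤ = proj₂ (down x* t* (proj₂ sol))

  open LP

  module Existence {n : ℕ} (F : Graph n) where

    dim : ℕ
    dim = n ℕ.* (n ℕ.* n)

    encode : Triple n → Fin dim
    encode (i , j , k) = combine i (combine j k)

    decode : Fin dim → Triple n
    decode p = map₂ (remQuot {n} n) (remQuot {n} (n ℕ.* n) p)

    decode-encode : ∀ T → decode (encode T) ≡ T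
    decode-encode (i , j , k) = trans
      (cong (map₂ (remQuot {n} n)) (remQuot-combine {n} {n ℕ.* n} i (combine j k)))
      (cong (i ,_) (remQuot-combine {n} {n} j k))

    toVec : (Triple n → ℚ) → Vec ℚ dim
    toVec ω = Vec.tabulate (ω ∘ decode)

    fromVec : Vec ℚ dim → Triple n → ℚ
    fromVec x T = Vec.lookup x (encode T)

    fromVec-toVec : ∀ ω T → fromVec (toVec ω) T ≡ ω T
    fromVec-toVec ω T = trans (Vec.lookup∘tabulate (ω ∘ decode) (encode T)) (cong ω (decode-encode T))

    ∑-cong : ∀ {f g : Triple n → ℚ} L → (∀ T → f T ≡ g T) → ∑ L f ≡ ∑ L g
    ∑-cong []      h = refl
    ∑-cong (T ∷ L) h = cong₂ _+_ (h T) (∑-cong L h)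

    sumVec : List (Triple n) → Vec ℚ dim
    sumVec []      = Vec.replicate _ 0ℚ
    sumVec (T ∷ L) = Vec.zipWith _+_ (unit (encode T)) (sumVec L)

    dot-sumVec : ∀ L x → dot (sumVec L) x ≡ ∑ L (fromVec x)
    dot-sumVec []      x = dot-zero x
    dot-sumVec (T ∷ L) x = trans (dot-add (unit (encode T)) (sumVec L) x)
      (cong₂ _+_ (dot-unit (encode T) x) (dot-sumVec L x))

    atLeast0 atMost1 : List (Triple n) → Con dim
    atLeast0 L = sumVec L , 0ℚ
    atMost1  L = Vec.map (- 1ℚ *_) (sumVec L) , 1ℚ

    eval-atLeast0 : ∀ L x → eval (atLeast0 L) x ≡ ∑ L (fromVec x)
    eval-atLeast0 L x = trans (ℚ.+-identityʳ _) (dot-sumVec L x)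

    eval-atMost1 : ∀ L x → eval (atMost1 L) x ≡ 1ℚ - ∑ L (fromVec x)
    eval-atMost1 L x rewrite dot-scale (- 1ℚ) (sumVec L) x | dot-sumVec L x =
      solve 1 (λ s → (:- con 1ℚ) :* s :+ con 1ℚ := con 1ℚ :- s) refl (∑ L (fromVec x))
      where open +-*-Solver

    through : Fin n → Fin n → List (Triple n)
    through x y = filter (contains? x y) (triangles F)

    edges : List (Fin n × Fin n)
    edges = filter (λ (x , y) → adj? F x y) (cartesianProduct (allFin n) (allFin n))

    system : List (Con dim)
    system = map (λ T → atLeast0 (T ∷ [])) (triangles F)
          ++ map (λ T → atMost1 (T ∷ [])) (triangles F)
          ++ map (λ (x , y) → atMost1 (through x y)) edges

    ∈triangles : ∀ {T} → IsTriangle F T → T ∈ triangles F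
    ∈triangles {i , j , k} h = ∈-filter⁺ (isTriangle? F)
      (∈-cartesianProduct⁺ (∈-allFin i) (∈-cartesianProduct⁺ (∈-allFin j) (∈-allFin k))) h

    triangles∈ : ∀ {T} → T ∈ triangles F → IsTriangle F T
    triangles∈ h = proj₂ (∈-filter⁻ (isTriangle? F) {xs = allTriples n} h)

    ∈edges : ∀ {x y} → Adj F x y → (x , y) ∈ edges
    ∈edges {x} {y} h = ∈-filter⁺ (λ (x , y) → adj? F x y) (∈-cartesianProduct⁺ (∈-allFin x) (∈-allFin y)) h

    edges∈ : ∀ {x y} → (x , y) ∈ edges → Adj F x y
    edges∈ h = proj₂ (∈-filter⁻ (λ (x , y) → adj? F x y) {xs = cartesianProduct (allFin n) (allFin n)} h)

    sat⇒packing : ∀ x → Sat system x → IsPacking F (fromVec x)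
    sat⇒packing x s = record
      { ≥0   = λ T h → subst (0ℚ ≤_) (trans (eval-atLeast0 (T ∷ []) x) (ℚ.+-identityʳ _)) (All.lookup s₁ (∈triangles h))
      ; ≤1   = λ T h → subst (_≤ 1ℚ) (ℚ.+-identityʳ _)
                 (0≤⇒≤ (subst (0ℚ ≤_) (eval-atMost1 (T ∷ []) x) (All.lookup s₂ (∈triangles h))))
      ; edge = λ y z h → 0≤⇒≤ (subst (0ℚ ≤_) (eval-atMost1 (through y z) x) (All.lookup s₃ (∈edges h)))
      }
      where
        r₁ = map (λ T → atLeast0 (T ∷ [])) (triangles F)
        r₂ = map (λ T → atMost1 (T ∷ [])) (triangles F)
        s₁ = All.map⁻ (All.++⁻ˡ r₁ s)
        s₂ = All.map⁻ (All.++⁻ˡ r₂ (All.++⁻ʳ r₁ s))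
        s₃ = All.map⁻ (All.++⁻ʳ r₂ (All.++⁻ʳ r₁ s))

    packing⇒sat : ∀ ω → IsPacking F ω → Sat system (toVec ω)
    packing⇒sat ω P = All.++⁺
      (All.map⁺ (All.tabulate λ {T} h → subst (0ℚ ≤_)
        (sym (trans (eval-atLeast0 (T ∷ []) x) (trans (ℚ.+-identityʳ _) (fromVec-toVec ω T)))) (≥0 T (triangles∈ h))))
      (All.++⁺
      (All.map⁺ (All.tabulate λ {T} h → subst (0ℚ ≤_) (sym (eval-atMost1 (T ∷ []) x))
        (≤⇒0≤ (subst (_≤ 1ℚ) (sym (trans (ℚ.+-identityʳ _) (fromVec-toVec ω T))) (≤1 T (triangles∈ h))))))
      (All.map⁺ (All.tabulate λ {(y , z)} h → subst (0ℚ ≤_) (sym (eval-atMost1 (through y z) x))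
        (≤⇒0≤ (subst (_≤ 1ℚ) (sym (∑-cong (through y z) (fromVec-toVec ω))) (edge y z (edges∈ h)))))))
      where
        open IsPacking P
        x = toVec ω

    ∑0 : ∀ (L : List (Triple n)) → ∑ L (λ _ → 0ℚ) ≡ 0ℚ
    ∑0 []      = refl
    ∑0 (_ ∷ L) = trans (ℚ.+-identityˡ _) (∑0 L)

    zero-packing : IsPacking F (λ _ → 0ℚ)
    zero-packing = record
      { ≥0   = λ _ _ → ℚ.≤-refl
      ; ≤1   = λ _ _ → ℚ.nonNegative⁻¹ 1ℚ
      ; edge = λ x y _ → subst (_≤ 1ℚ) (sym (∑0 (through x y))) (ℚ.nonNegative⁻¹ 1ℚ)
      }

    ∑-mono : ∀ {f g : Triple n → ℚ} L → (∀ {T} → T ∈ L → f T ≤ g T) → ∑ L f ≤ ∑ L g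
    ∑-mono []      h = ℚ.≤-refl
    ∑-mono (T ∷ L) h = ℚ.+-mono-≤ (h (here refl)) (∑-mono L (h ∘ there))

    goal : Con dim
    goal = atLeast0 (triangles F)

    optimum = lp-max system goal (∑ (triangles F) (λ _ → 1ℚ))
      (toVec (λ _ → 0ℚ) , packing⇒sat _ zero-packing)
      (λ x s → subst (_≤ _) (sym (eval-atLeast0 (triangles F) x))
        (∑-mono (triangles F) (λ {T} h → IsPacking.≤1 (sat⇒packing x s) T (triangles∈ h))))

    maximum : ∃ (IsMaxWeight F)
    maximum = weight F (fromVec x*) , record
      { attained = fromVec x* , sat⇒packing x* (proj₁ (proj₂ optimum)) , refl
      ; bound    = λ ω P → subst (_≤ weight F (fromVec x*))
          (trans (eval-atLeast0 (triangles F) (toVec ω)) (∑-cong (triangles F) (fromVec-toVec ω)))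
          (subst (eval goal (toVec ω) ≤_) (eval-atLeast0 (triangles F) x*)
            (proj₂ (proj₂ optimum) (toVec ω) (packing⇒sat ω P)))
      }
      where x* = proj₁ optimum

-- Weights are rational: the programme defining ν* has integer data, so its
-- maximum over real weights is attained at rational ones.
abstract

  ν* : ∀ {n} → Graph n → ℚ
  ν* F = proj₁ (Existence.maximum F)

  ν*-isMaxWeight : ∀ {n} (F : Graph n) → IsMaxWeight F (ν* F)
  ν*-isMaxWeight F = proj₂ (Existence.maximum F)

data Colour : Set where
  red blue : Colour

_≟ᶜ_ : DecidableEquality Colour
red  ≟ᶜ red  = yes refl
red  ≟ᶜ blue = no λ ()
blue ≟ᶜ red  = no λ ()
blue ≟ᶜ blue = yes refl

opposite : Colour → Colour
opposite red  = blue
opposite blue = red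

-- The diagonal values `colour x x` carry no meaning and are never used.
record Colouring (n : ℕ) : Set where
  field
    colour     : Fin n → Fin n → Colour
    colour-sym : ∀ x y → colour x y ≡ colour y x

open Colouring public

colourClass : ∀ {n} → Colour → Colouring n → Graph n
colourClass c G = record
  { Adj     = λ x y → x ≢ y × colour G x y ≡ c
  ; adj?    = λ x y → ¬? (x ≟ y) ×-dec (colour G x y ≟ᶜ c)
  ; adj-sym = λ (x≢y , h) → x≢y ∘ sym , trans (colour-sym G _ _) h
  ; irrefl  = λ (x≢x , _) → x≢x refl
  }

pack : ∀ {n} → Colouring n → ℚ
pack G = + 3 / 1 * (ν* (colourClass red G) + ν* (colourClass blue G))

-- The vertices other than u are relabelled in order by `punchIn u`.
_∖_ : ∀ {m} → Colouring (suc m) → Fin (suc m) → Colouring m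
G ∖ u = record
  { colour     = λ x y → colour G (punchIn u x) (punchIn u y)
  ; colour-sym = λ x y → colour-sym G (punchIn u x) (punchIn u y)
  }

SamePair : ∀ {n} → Fin n → Fin n → Fin n → Fin n → Set
SamePair a b x y = (x ≡ a × y ≡ b) ⊎ (x ≡ b × y ≡ a)

samePair? : ∀ {n} (a b x y : Fin n) → Dec (SamePair a b x y)
samePair? a b x y = ((x ≟ a) ×-dec (y ≟ b)) ⊎-dec ((x ≟ b) ×-dec (y ≟ a))

flipColour : ∀ {n} → Colouring n → Fin n → Fin n → Fin n → Fin n → Colour
flipColour G a b x y =
  if does (samePair? a b x y) then opposite (colour G x y) else colour G x y

flipColour-sym : ∀ {n} (G : Colouring n) (a b x y : Fin n) →
                 flipColour G a b x y ≡ flipColour G a b y x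
flipColour-sym G a b x y rewrite colour-sym G x y
  with x ≟ a | y ≟ b | x ≟ b | y ≟ a
... | yes _ | yes _ | yes _ | yes _ = refl
... | yes _ | yes _ | yes _ | no  _ = refl
... | yes _ | yes _ | no  _ | yes _ = refl
... | yes _ | yes _ | no  _ | no  _ = refl
... | yes _ | no  _ | yes _ | yes _ = refl
... | yes _ | no  _ | yes _ | no  _ = refl
... | yes _ | no  _ | no  _ | yes _ = refl
... | yes _ | no  _ | no  _ | no  _ = refl
... | no  _ | yes _ | yes _ | yes _ = refl
... | no  _ | yes _ | yes _ | no  _ = refl
... | no  _ | yes _ | no  _ | yes _ = refl
... | no  _ | yes _ | no  _ | no  _ = refl
... | no  _ | no  _ | yes _ | yes _ = refl
... | no  _ | no  _ | yes _ | no  _ = refl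
... | no  _ | no  _ | no  _ | yes _ = refl
... | no  _ | no  _ | no  _ | no  _ = refl

flip : ∀ {n} → Colouring n → Fin n → Fin n → Colouring n
flip G a b = record
  { colour     = flipColour G a b
  ; colour-sym = flipColour-sym G a b
  }

_⊕_ : Fin 5 → ℕ → Fin 5
i ⊕ k = (toℕ i ℕ.+ k) mod 5

-- The partition A₁, …, A₅ is encoded by the map sending a vertex to the
-- index of its blob.
record IsPentagonBlowUp {n} (G : Colouring n) (blob : Fin n → Fin 5) : Set where
  field
    nonempty   : ∀ i → ∃[ x ] blob x ≡ i
    red-edges  : ∀ i x y → blob x ≡ i → blob y ≡ i ⊕ 1 → colour G x y ≡ red
    blue-edges : ∀ i x y → blob x ≡ i → blob y ≡ i ⊕ 2 → colour G x y ≡ blue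

blobSizes : ∀ {n} → (Fin n → Fin 5) → List ℕ
blobSizes {n} blob =
  List.tabulate λ i → length (filter (λ x → blob x ≟ i) (allFin n))

BlowUpWithSizesIn : ∀ {n} → List (List ℕ) → Colouring n → Set
BlowUpWithSizesIn ℬ G =
  ∃[ blob ] IsPentagonBlowUp G blob × ∃[ b ] b ∈ ℬ × blobSizes blob ↭ b

tuple : (a₁ a₂ a₃ a₄ a₅ : ℕ) → List ℕ
tuple a₁ a₂ a₃ a₄ a₅ = a₁ ∷ a₂ ∷ a₃ ∷ a₄ ∷ a₅ ∷ []

ℬ₁ ℬ₂ : List (List ℕ)
ℬ₁ = tuple 3 3 3 4 4
   ∷ tuple 2 3 4 4 4
   ∷ tuple 3 3 3 3 5
   ∷ tuple 3 3 4 4 4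
   ∷ tuple 2 4 4 4 4
   ∷ tuple 3 3 3 4 5
   ∷ tuple 3 4 4 4 4
   ∷ tuple 3 3 4 4 5
   ∷ tuple 4 4 4 4 4
   ∷ tuple 3 4 4 4 5
   ∷ tuple 4 4 4 4 5
   ∷ tuple 3 4 4 5 5
   ∷ tuple 4 4 4 5 5
   ∷ tuple 4 4 5 5 5
   ∷ tuple 4 5 5 5 5
   ∷ tuple 5 5 5 5 5
   ∷ []
ℬ₂ = tuple 3 3 3 4 4
   ∷ tuple 3 3 4 4 4
   ∷ tuple 3 4 4 4 4
   ∷ tuple 4 4 4 4 4
   ∷ tuple 4 4 4 4 5
   ∷ []

𝒞₁ 𝒞₂ 𝒞 : ∀ {n} → Colouring n → Set
𝒞₁ = BlowUpWithSizesIn ℬ₁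
𝒞₂ G = ∃[ a ] ∃[ b ] a ≢ b × BlowUpWithSizesIn ℬ₂ (flip G a b)
𝒞 G = 𝒞₁ G ⊎ 𝒞₂ G

module Submission where

open import Data.Nat.Base using (ℕ; zero; suc; _+_; _*_; _∸_; _≡ᵇ_; _<ᵇ_; _≤ᵇ_; _≤_; _<_; z≤n; s≤s) renaming (_/_ to _quot_)
import Data.Nat.Properties as ℕ
open import Data.Fin.Base as Fin using (Fin; zero; suc; punchIn; punchOut)
open import Data.Fin.Patterns using (0F; 1F; 2F; 3F; 4F)
open import Data.Integer.Base as ℤ using (+_)
open import Data.Rational.Base as ℚ using (_>_; _/_; ℚ; 1ℚ)
open import Data.Bool.Base using (Bool; true; false; _∧_; _∨_; if_then_else_; not; T; _xor_)
open import Data.Bool.ListAction using (any; all)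
import Data.List.Properties as List
open import Data.List.Membership.DecPropositional using () renaming (_∈?_ to mem?)
open import Data.List.Sort.InsertionSort.Base ℕ.≤-decTotalOrder using (sort)
open import Relation.Nullary.Decidable using (does; Dec; yes; no; _×-dec_; dec-true; dec-false; from-yes; _⊎-dec_; _→-dec_)
open import Data.List.Base as List using (List; []; _∷_; map; _++_; filter; allFin; cartesianProduct; length)
open import Data.Product.Base using (_×_; _,_; proj₁; proj₂; ∃-syntax; map₂)
open import Data.Sum.Base using (_⊎_; inj₁; inj₂)
open import Relation.Binary.PropositionalEquality
open import Defs
open import Data.Nat.Solver using (module +-*-Solver)
open import Data.Fin.Properties as Fin using (_≟_; _<?_; punchIn-punchOut; punchOut-punchIn; punchInᵢ≢i; punchIn-injective)
import Data.Integer.Properties as ℤ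
import Data.Rational.Properties as ℚ
open import Data.Rational.Unnormalised.Base as ℚᵘ using (mkℚᵘ; *≤*; *<*; *≡*)
import Data.Rational.Unnormalised.Properties as ℚᵘ
import Data.Bool.Properties as Bool
open import Data.List.Membership.Propositional using (_∈_)
open import Data.List.Relation.Unary.Any using (here; there)
open import Data.Empty using (⊥-elim)
open import Function.Base using (_∘_; id)
import Algebra.Properties.Semiring.Sum ℕ.+-*-semiring as Sum
open import Relation.Nullary.Negation using (¬_; contradiction)
open import Relation.Unary using (Decidable)
open import Relation.Binary.Definitions using (tri<; tri≈; tri>)
open import Data.Maybe.Base using (Maybe; just; nothing; maybe′)
import Data.Rational.Solver as ℚSolver
open import Data.Nat.DivMod using (0/n≡0)
open import Data.List.Membership.Propositional.Properties using (∈-map⁻)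
open import Data.List.Relation.Unary.All as All using (All; []; _∷_)
open import Data.List.Relation.Binary.Permutation.Propositional using (_↭_; ↭-sym; ↭-trans; ↭-refl; prep; swap; ↭⇒↭ₛ; ↭-reflexive)
open import Data.List.Relation.Binary.Permutation.Propositional.Properties using (All-resp-↭)
open import Data.List.Sort.InsertionSort.Properties ℕ.≤-decTotalOrder using (sort-↭; sort-↗)
open import Data.List.Relation.Unary.Sorted.TotalOrder.Properties using (↗↭↗⇒≋)
open import Data.List.Relation.Unary.Sorted.TotalOrder ℕ.≤-totalOrder using (Sorted; sorted?)
open import Data.List.Relation.Binary.Pointwise using (Pointwise-≡⇒≡)

-- Every edge xy inside a blob of H is packed fully: it spreads weight 1 over the
-- triangles whose apex lies in one of the two blobs joined to that of x in the
-- colour of xy. How the weight is split between these two blobs (the plan) may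
-- depend on the blob and on the colour only, so the load on an edge between two
-- blobs is bounded by their sizes alone, whatever the colours inside the blobs.
-- The capacity left over on these edges carries triangles through u, that is, a
-- fractional matching between the red (and between the blue) neighbours of u in
-- different blobs. A flipped edge is avoided by the plans; it contributes weight 1
-- of triangles of its new colour, with apices in the blob joined to both its ends
-- in that colour. Up to the 20 affine symmetries of ℤ/5 this leaves, for every
-- size tuple, finitely many numbers of red neighbours of u in the blobs. For each
-- of them either some plan with a greedy matching beats n(n-1)/4, or u has the
-- colours of a vertex of some blob up to at most one edge, so that G is in 𝒞.
-- These finitely many cases are decided by evaluation.

-- The inside of a blob may be coloured in any way, so the case analysis is finite only if no choice
-- ever looks there. Hence all inner edges of one blob and one colour split their weight alike, and
-- the load on an edge between two blobs is estimated as if every other vertex of either blob gave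
-- an inner edge of the critical colour. What remains are small integers. The tests judge results,
-- not the way they were found: a division that rounds, a truncated subtraction or a poor greedy
-- choice can at worst make a test fail. Weight is attached to pairs of a base edge and an apex.
-- Summing over ordered bases counts every triangle twice, which is why 6 times such a sum stands
-- where the target asks for 12 times a total weight. The affine maps of ℤ/5 are sharply
-- 2-transitive, so a flipped edge between two blobs can be moved to the blobs 0 and 1 in exactly
-- two ways, which differ by i ↦ 1 - i. A flipped edge inside a blob does not disturb the blow-up at
-- all, and every tuple of `ℬ₂` is in `ℬ₁`.

data Five : Set where
  five : ℕ → ℕ → ℕ → ℕ → ℕ → Five

infixl 10 _!_
_!_ : Five → Fin 5 → ℕ
five a b c d e ! 0F = a
five a b c d e ! 1F = b
five a b c d e ! 2F = c
five a b c d e ! 3F = d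
five a b c d e ! 4F = e

-- The weights are multiples of 1/D. A plan splits in twelfths, and 60 is divisible
-- by all blob sizes that occur, also after removing a vertex.
D : ℕ
D = 720

-- The red pentagon, the blue pentagram and values on pairs of blobs

on : Bool → ℕ → ℕ
on true  n = n
on false n = 0

same : Colour → Colour → Bool
same red  red  = true
same blue blue = true
same red  blue = false
same blue red  = false

-- next and prev are the red neighbours on the pentagon, next² and prev² the blue ones.
data Link : Set where
  own next prev next² prev² : Link

link : Fin 5 → Fin 5 → Link
link 0F 0F = own
link 0F 1F = next
link 0F 2F = next²
link 0F 3F = prev²
link 0F 4F = prev
link 1F 0F = prev
link 1F 1F = own
link 1F 2F = next
link 1F 3F = next²
link 1F 4F = prev²
link 2F 0F = prev²
link 2F 1F = prev
link 2F 2F = own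
link 2F 3F = next
link 2F 4F = next²
link 3F 0F = next²
link 3F 1F = prev²
link 3F 2F = prev
link 3F 3F = own
link 3F 4F = next
link 4F 0F = next
link 4F 1F = next²
link 4F 2F = prev²
link 4F 3F = prev
link 4F 4F = own

linked : Colour → Fin 5 → Fin 5 → Bool
linked c i j with link i j
... | own   = false
... | next  = same red c
... | prev  = same red c
... | next² = same blue c
... | prev² = same blue c

-- Values on the ten pairs of blobs: the red ones in the order 01, 12, 23, 34, 40,
-- the blue ones in the order 02, 24, 41, 13, 30.
onPairs : Five → Five → Fin 5 → Fin 5 → ℕ
onPairs v w 0F 1F = v ! 0F
onPairs v w 1F 0F = v ! 0F
onPairs v w 1F 2F = v ! 1F
onPairs v w 2F 1F = v ! 1F
onPairs v w 2F 3F = v ! 2F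
onPairs v w 3F 2F = v ! 2F
onPairs v w 3F 4F = v ! 3F
onPairs v w 4F 3F = v ! 3F
onPairs v w 4F 0F = v ! 4F
onPairs v w 0F 4F = v ! 4F
onPairs v w 0F 2F = w ! 0F
onPairs v w 2F 0F = w ! 0F
onPairs v w 2F 4F = w ! 1F
onPairs v w 4F 2F = w ! 1F
onPairs v w 4F 1F = w ! 2F
onPairs v w 1F 4F = w ! 2F
onPairs v w 1F 3F = w ! 3F
onPairs v w 3F 1F = w ! 3F
onPairs v w 3F 0F = w ! 4F
onPairs v w 0F 3F = w ! 4F
onPairs v w _  _  = 0

-- Blobs in the order 0, 2, 4, 1, 3 of the blue cycle. After this reordering the blue side is a
-- 5-cycle of consecutive classes and shares the functions written for red.
pentagram : Five → Five
pentagram (five a b c d e) = five a c e b d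

-- The flipped edge, if there is one (ε = 1), joins the blobs 0 and 1.
defect : ℕ → Fin 5 → Fin 5 → ℕ
defect ε = onPairs (five ε 0 0 0 0) (five 0 0 0 0 0)

-- Load of the triangles through the flipped edge and blob 3.
defectLoad : ℕ → Fin 5 → Fin 5 → ℕ
defectLoad t = onPairs (five 0 0 0 0 0) (five 0 0 0 t t)

-- Plans for the inner edges and the capacity they leave

infixl 7 _div_
_div_ : ℕ → ℕ → ℕ
m div zero  = 0
m div suc n = m quot suc n

-- In twelfths, how much of the weight of a red (first component) or blue inner
-- edge of blob i goes to apices in its next red or blue neighbour, the rest
-- going to the previous one.
Plan : Set
Plan = Five × Five

twelfths : Plan → Fin 5 → Fin 5 → ℕ
twelfths (x , y) i j with link i j
... | own   = 0
... | next  = x ! i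
... | prev  = 12 ∸ x ! i
... | next² = y ! i
... | prev² = 12 ∸ y ! i

-- As 60 · 12 = `D`, the shares of the two neighbours in one colour add up to `D`. If ε = 1, every
-- inner edge of blob 0 avoids the end of the flipped edge in blob 1, and vice versa, not only the
-- inner edges that meet the flipped edge: so the weight per apex remains a function of the two
-- blobs. One function serves both colours, because the pair of blobs determines its colour.
apexWeight : Five → ℕ → Plan → Fin 5 → Fin 5 → ℕ
apexWeight a ε π i j = 60 * twelfths π i j div (a ! j ∸ defect ε i j)

-- Blob 3 is the only one linked in blue to both 0 and 1, and an edge flipped between these two has
-- become blue.
flipWeight : Five → ℕ → ℕ
flipWeight a ε = ε * D div (a ! 3F)

residue : Five → ℕ → Plan → Fin 5 → Fin 5 → ℕ
residue a ε π i j = D ∸ defectLoad (flipWeight a ε) i j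
  ∸ (a ! i ∸ 1) * apexWeight a ε π i j ∸ (a ! j ∸ 1) * apexWeight a ε π j i

residues : Five → ℕ → Plan → Five × Five
residues a ε π =
  five (k 0F 1F) (k 1F 2F) (k 2F 3F) (k 3F 4F) (k 4F 0F) ,
  five (k 0F 2F) (k 2F 4F) (k 4F 1F) (k 1F 3F) (k 3F 0F)
  where k = residue a ε π

∀₅ : (Fin 5 → Bool) → Bool
∀₅ f = f 0F ∧ f 1F ∧ f 2F ∧ f 3F ∧ f 4F

∃₅ : (Fin 5 → Bool) → Bool
∃₅ f = f 0F ∨ f 1F ∨ f 2F ∨ f 3F ∨ f 4F

∑₅ : (Fin 5 → ℕ) → ℕ
∑₅ f = f 0F + (f 1F + (f 2F + (f 3F + f 4F)))

planOK : Five → ℕ → Plan → Bool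
planOK a ε π =
  ∀₅ (λ i → spent red i ∧ spent blue i) ∧ ∀₅ (λ i → ∀₅ (λ j → fits (residues a ε π) i j)) ∧
  (a ! 3F * flipWeight a ε ≡ᵇ ε * D)
  where
  p = apexWeight a ε π
  -- Asking for equality with `D` catches weight lost by rounding in `apexWeight`.
  spent : Colour → Fin 5 → Bool
  spent c i = ∑₅ (λ j → on (linked c i j) ((a ! j ∸ defect ε i j) * p i j)) ≡ᵇ D
  -- Adding the load to the residue again detects an overload that the truncated subtraction in
  -- `residue` has hidden.
  fits : Five × Five → Fin 5 → Fin 5 → Bool
  fits (k , k′) i j = onPairs k k′ i j
    + ((a ! i ∸ 1) * p i j + ((a ! j ∸ 1) * p j i + defectLoad (flipWeight a ε) i j)) ≤ᵇ D

-- Fractional matchings among the neighbours of `u`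

min : ℕ → ℕ → ℕ
min m n = if m <ᵇ n then m else n

rotate : ℕ → Five → Five
rotate zero    v = v
rotate (suc k) (five a b c d e) = rotate k (five b c d e a)

-- A fractional matching of a blown-up 5-cycle with class sizes r: a weight per
-- edge, at most k, with total at most D at every vertex.
greedy : Five → Five → Five
greedy (five k₀ k₁ k₂ k₃ k₄) (five r₀ r₁ r₂ r₃ r₄) = go₀ (edge k₀ D D r₀ r₁)
  where
  -- `ρ` and `ρ′` are the capacities left at a vertex of each end class. A vertex of the first class
  -- has `r′` edges into the second, so each of them can carry `ρ div r′`; likewise from the other
  -- end.
  edge : ℕ → ℕ → ℕ → ℕ → ℕ → ℕ
  edge k ρ ρ′ r r′ = min k (min (ρ div r′) (ρ′ div r))
  go₃ : ℕ → ℕ → ℕ → ℕ → Five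
  go₃ m₀ m₁ m₂ m₃ = five m₀ m₁ m₂ m₃ (edge k₄ (D ∸ r₃ * m₃) (D ∸ r₁ * m₀) r₄ r₀)
  go₂ : ℕ → ℕ → ℕ → Five
  go₂ m₀ m₁ m₂ = go₃ m₀ m₁ m₂ (edge k₃ (D ∸ r₂ * m₂) D r₃ r₄)
  go₁ : ℕ → ℕ → Five
  go₁ m₀ m₁ = go₂ m₀ m₁ (edge k₂ (D ∸ r₁ * m₁) D r₂ r₃)
  go₀ : ℕ → Five
  go₀ m₀ = go₁ m₀ (edge k₁ (D ∸ r₀ * m₀) D r₁ r₂)

valid : Five → Five → Five → Bool
valid (five k₀ k₁ k₂ k₃ k₄) (five r₀ r₁ r₂ r₃ r₄) (five m₀ m₁ m₂ m₃ m₄) =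
  (m₀ ≤ᵇ k₀) ∧ (m₁ ≤ᵇ k₁) ∧ (m₂ ≤ᵇ k₂) ∧ (m₃ ≤ᵇ k₃) ∧ (m₄ ≤ᵇ k₄) ∧
  (r₁ * m₀ + r₄ * m₄ ≤ᵇ D) ∧ (r₂ * m₁ + r₀ * m₀ ≤ᵇ D) ∧ (r₃ * m₂ + r₁ * m₁ ≤ᵇ D) ∧
  (r₄ * m₃ + r₂ * m₂ ≤ᵇ D) ∧ (r₀ * m₄ + r₃ * m₃ ≤ᵇ D)

-- ε is subtracted because the edge 01 of the cycle may contain the flipped edge.
gain : ℕ → Five → Five → ℕ
gain ε (five r₀ r₁ r₂ r₃ r₄) (five m₀ m₁ m₂ m₃ m₄) =
  (r₀ * r₁ ∸ ε) * m₀ + r₁ * r₂ * m₁ + r₂ * r₃ * m₂ + r₃ * r₄ * m₃ + r₄ * r₀ * m₄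

-- The greedy matching started at edge s of the cycle. Its validity is tested rather
-- than proved.
matching : Five → Five → ℕ → Five
-- Together the two rotations make five steps, so the weights return to their own edges.
matching k r s = validOr0 (rotate (5 ∸ s) (greedy (rotate s k) (rotate s r)))
  where
  validOr0 : Five → Five
  validOr0 μ = if valid k r μ then μ else five 0 0 0 0 0

matchings : Five → Five → List Five
matchings k r = map (matching k r) (0 ∷ 1 ∷ 2 ∷ 3 ∷ 4 ∷ [])

heavy : ℕ → ℕ → ℕ → Five → Five → List Five → List Five → Bool
heavy N B ε r r′ μs μs′ = any (λ μ → heavyWith (gain ε r μ) μs′) μs
  where
  heavyWith : ℕ → List Five → Bool
  heavyWith g = any (λ μ′ → N <ᵇ B + 12 * (g + gain 0 r′ μ′))

-- The number of edges at u whose colour differs from that in blob j.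
misfits : Five → Five → Fin 5 → ℕ
misfits (five r₀ r₁ r₂ r₃ r₄) (five b₀ b₁ b₂ b₃ b₄) = λ
  { 0F → b₁ + (r₂ + (r₃ + b₄))
  ; 1F → b₀ + (b₂ + (r₃ + r₄))
  ; 2F → r₀ + (b₁ + (b₃ + r₄))
  ; 3F → r₀ + (r₁ + (b₂ + b₄))
  ; 4F → b₀ + (r₁ + (r₂ + b₃)) }

increment : Fin 5 → Five → Five
increment 0F (five a b c d e) = five (suc a) b c d e
increment 1F (five a b c d e) = five a (suc b) c d e
increment 2F (five a b c d e) = five a b (suc c) d e
increment 3F (five a b c d e) = five a b c (suc d) e
increment 4F (five a b c d e) = five a b c d (suc e)

toList : Five → List ℕ
toList (five a b c d e) = tuple a b c d e

_∈ᵇ_ : Five → List (List ℕ) → Bool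
v ∈ᵇ ℬ = does (mem? (List.≡-dec ℕ._≟_) (sort (toList v)) ℬ)

-- `ε + misfits r b j` is the number of edges in which `G` differs from a blow-up once `u` has
-- joined blob `j`: with none `G` can lie in `𝒞₁`, with one in `𝒞₂`. The edges from `u` into blob
-- `j` itself are free.
fitsIn : ℕ → Five → Five → Five → Fin 5 → Bool
fitsIn ε a r b j = fitsWith (ε + misfits r b j)
  where
  fitsWith : ℕ → Bool
  fitsWith 0 = increment j a ∈ᵇ ℬ₁
  fitsWith 1 = increment j a ∈ᵇ ℬ₂
  fitsWith _ = false

-- The finite check and its data

packable : ℕ → ℕ → ℕ → Five → Five → List (Five × Five) → Bool
packable N B ε r b = any λ (k , k′) →
  heavy N B ε r (pentagram b) (matchings k r) (matchings k′ (pentagram b))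

∀≤ : ℕ → (ℕ → Bool) → Bool
∀≤ zero    f = f zero
∀≤ (suc n) f = f (suc n) ∧ ∀≤ n f

total : Five → ℕ
total (five a b c d e) = a + (b + (c + (d + e)))

-- Inner edges are counted in both directions, in keeping with sums over ordered bases.
pairs : Five → ℕ
pairs (five a b c d e) =
  a * (a ∸ 1) + (b * (b ∸ 1) + (c * (c ∸ 1) + (d * (d ∸ 1) + e * (e ∸ 1))))

allRed : ℕ → ℕ → ℕ → Five → List (Five × Five) → Bool
allRed N B ε a@(five a₀ a₁ a₂ a₃ a₄) ks =
  ∀≤ a₀ λ r₀ → ∀≤ a₁ λ r₁ → ∀≤ a₂ λ r₂ → ∀≤ a₃ λ r₃ → ∀≤ a₄ λ r₄ →
    decided (five r₀ r₁ r₂ r₃ r₄) (five (a₀ ∸ r₀) (a₁ ∸ r₁) (a₂ ∸ r₂) (a₃ ∸ r₃) (a₄ ∸ r₄))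
  where
  decided : Five → Five → Bool
  decided r b = ∃₅ (fitsIn ε a r b) ∨ packable N B ε r b ks

-- The packing beats n(n-1)/4 when target < 12 · (its total weight, in units of 1/D);
-- base is the share of the inner edges and of the flipped edge in the right-hand side.
target : Five → ℕ
target a = suc (total a) * total a * D

base : ℕ → Five → ℕ
base ε a = 6 * (pairs a * D + 2 * (ε * D))

rowOK : ℕ → Five × List Plan → Bool
rowOK ε (a , πs) =
  all (planOK a ε) πs ∧ allRed (target a) (base ε a) ε a (map (residues a ε) πs)

-- One arrangement of each tuple of ℬ₁ for every orbit of the symmetries, with plans
-- found by linear programming.
table₁ : List (Five × List Plan)
table₁ =
  (five 3 3 3 4 4 , (five 2 1 3 5 4 , five 9 6 7 6 6) ∷ (five 5 2 4 2 5 , five 8 0 5 7 6) ∷ (five 3 5 0 3 4 , five 1 2 1 1 2) ∷ (five 0 0 0 6 2 , five 0 0 0 0 3) ∷ [])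
  ∷ (five 2 3 4 4 4 , (five 3 4 6 6 5 , five 5 3 6 5 6) ∷ (five 0 2 3 1 3 , five 0 0 4 2 0) ∷ [])
  ∷ (five 3 3 3 3 5 , (five 5 5 3 2 5 , five 1 3 4 3 5) ∷ (five 4 3 0 0 6 , five 0 4 0 1 5) ∷ [])
  ∷ (five 3 3 4 4 4 , (five 6 5 5 6 5 , five 4 6 6 5 7) ∷ (five 3 4 6 3 3 , five 3 3 4 5 3) ∷ [])
  ∷ (five 2 4 4 4 4 , (five 3 7 7 5 5 , five 3 5 7 5 7) ∷ [])
  ∷ (five 3 3 3 4 5 , (five 3 9 7 5 5 , five 4 4 4 5 5) ∷ (five 1 5 6 6 4 , five 6 3 4 5 6) ∷ [])
  ∷ (five 3 4 4 4 4 , (five 3 4 4 3 3 , five 3 3 4 3 3) ∷ (five 3 5 5 3 3 , five 2 3 4 3 4) ∷ [])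
  ∷ (five 3 3 4 4 5 , (five 3 4 5 4 3 , five 3 3 4 3 5) ∷ (five 1 4 3 2 3 , five 2 1 4 5 3) ∷ [])
  ∷ (five 3 3 4 5 4 , (five 4 5 6 5 5 , five 4 2 5 6 5) ∷ (five 1 2 2 4 1 , five 1 2 2 4 1) ∷ [])
  ∷ (five 4 4 4 4 4 , (five 6 6 6 6 6 , five 6 6 6 6 6) ∷ [])
  ∷ (five 3 4 4 4 5 , (five 3 4 3 4 6 , five 3 3 6 3 5) ∷ (five 4 6 5 5 4 , five 5 4 7 4 6) ∷ [])
  ∷ (five 4 4 4 4 5 , (five 5 6 6 7 6 , five 6 5 7 6 6) ∷ [])
  ∷ (five 3 4 4 5 5 , (five 3 6 4 5 3 , five 3 3 4 3 4) ∷ (five 6 6 7 7 7 , five 8 6 6 6 8) ∷ [])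
  ∷ (five 3 4 5 5 4 , (five 2 2 2 1 1 , five 2 2 4 3 2) ∷ (five 6 8 7 5 5 , five 6 7 7 5 5) ∷ [])
  ∷ (five 4 4 4 5 5 , (five 5 6 7 7 5 , five 5 6 7 6 6) ∷ [])
  ∷ (five 4 4 5 5 5 , (five 5 7 7 6 5 , five 6 6 7 6 5) ∷ [])
  ∷ (five 4 5 5 5 5 , (five 6 7 6 6 5 , five 6 6 7 5 6) ∷ [])
  ∷ (five 5 5 5 5 5 , (five 6 6 6 6 6 , five 6 6 6 6 6) ∷ [])
  ∷ []

-- Arrangements of the tuples of ℬ₂ up to the symmetry i ↦ 1 - i, which preserves
-- the pair of blobs 0 and 1 of the flipped edge.
table₂ : List (Five × List Plan)
table₂ =
  (five 3 3 3 4 4 , (five 3 6 6 5 5 , five 9 2 7 6 5) ∷ (five 0 4 1 6 3 , five 6 0 0 3 3) ∷ (five 0 0 0 0 0 , five 8 0 2 6 1) ∷ [])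
  ∷ (five 3 3 4 3 4 , (five 4 7 6 4 5 , five 10 3 6 6 5) ∷ (five 0 0 3 0 2 , five 8 1 7 6 5) ∷ [])
  ∷ (five 3 4 3 3 4 , (five 1 7 7 4 4 , five 7 2 5 4 4) ∷ (five 1 5 3 2 5 , five 0 0 0 0 0) ∷ (five 1 7 5 6 3 , five 6 0 2 2 4) ∷ (five 0 4 0 0 0 , five 2 0 0 2 0) ∷ [])
  ∷ (five 3 4 3 4 3 , (five 0 7 5 5 4 , five 5 0 0 3 0) ∷ (five 2 5 4 4 2 , five 6 4 5 5 0) ∷ [])
  ∷ (five 3 4 4 3 3 , (five 2 6 5 3 3 , five 8 3 5 5 3) ∷ (five 3 6 7 6 4 , five 6 2 6 5 0) ∷ (five 0 7 5 0 2 , five 1 0 3 0 0) ∷ (five 0 4 4 0 0 , five 4 0 2 4 0) ∷ [])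
  ∷ (five 4 4 3 3 3 , (five 2 4 3 0 0 , five 6 1 2 0 0) ∷ (five 3 7 3 3 0 , five 6 1 0 3 0) ∷ (five 0 2 4 0 0 , five 6 3 6 3 0) ∷ (five 2 7 4 0 1 , five 7 2 6 2 0) ∷ (five 0 0 0 0 0 , five 6 3 0 4 0) ∷ [])
  ∷ (five 3 3 4 4 4 , (five 0 4 5 3 1 , five 7 1 6 5 4) ∷ (five 0 2 4 5 4 , five 7 0 4 3 3) ∷ (five 0 0 2 0 2 , five 10 0 6 6 2) ∷ [])
  ∷ (five 3 4 3 4 4 , (five 0 6 5 5 5 , five 3 1 1 3 3) ∷ (five 0 4 4 4 0 , five 2 0 1 3 1) ∷ (five 0 4 0 3 0 , five 0 0 0 0 4) ∷ [])
  ∷ (five 3 4 4 3 4 , (five 8 10 8 7 7 , five 12 4 8 6 5) ∷ (five 3 7 7 3 6 , five 4 0 5 2 4) ∷ [])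
  ∷ (five 3 4 4 4 3 , (five 3 7 6 4 2 , five 4 2 4 4 0) ∷ (five 3 8 7 6 1 , five 8 1 4 4 1) ∷ (five 0 4 0 2 0 , five 2 0 1 0 0) ∷ (five 0 7 3 0 0 , five 0 0 0 0 0) ∷ [])
  ∷ (five 4 4 3 3 4 , (five 2 4 0 1 3 , five 7 2 6 2 4) ∷ (five 1 4 0 0 3 , five 4 1 0 0 2) ∷ (five 1 3 0 0 2 , five 6 0 0 2 0) ∷ [])
  ∷ (five 4 4 3 4 3 , (five 2 4 0 4 0 , five 7 3 6 5 4) ∷ (five 0 3 0 2 0 , five 6 3 2 6 1) ∷ (five 0 0 0 0 0 , five 4 0 2 0 0) ∷ (five 0 0 0 0 0 , five 1 1 0 1 0) ∷ [])
  ∷ (five 3 4 4 4 4 , (five 1 5 5 4 4 , five 5 2 5 5 4) ∷ (five 3 6 6 3 3 , five 3 0 4 3 3) ∷ [])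
  ∷ (five 4 4 3 4 4 , (five 3 4 1 3 3 , five 6 3 3 3 4) ∷ (five 0 3 0 0 0 , five 6 1 8 5 4) ∷ [])
  ∷ (five 4 4 4 3 4 , (five 2 4 3 2 2 , five 6 1 5 2 3) ∷ (five 0 0 0 0 0 , five 6 0 2 4 0) ∷ [])
  ∷ (five 4 4 4 4 4 , (five 3 6 6 3 2 , five 6 2 5 5 2) ∷ (five 0 3 0 0 0 , five 0 0 0 0 0) ∷ [])
  ∷ (five 4 4 4 4 5 , (five 4 5 5 5 5 , five 6 4 6 5 5) ∷ (five 1 2 2 2 2 , five 5 1 2 3 2) ∷ [])
  ∷ (five 4 4 4 5 4 , (five 0 1 0 2 0 , five 4 0 0 3 0) ∷ (five 1 2 1 2 1 , five 1 0 2 3 2) ∷ [])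
  ∷ (five 4 5 4 4 4 , (five 0 3 0 0 0 , five 4 0 0 1 0) ∷ (five 0 4 2 0 0 , five 0 0 0 0 0) ∷ [])
  ∷ []

-- A record, so that comparing types never evaluates the check again.
record TableOK (ε : ℕ) (table : List (Five × List Plan)) : Set where
  field rows-OK : all (rowOK ε) table ≡ true

table₁-OK : TableOK 0 table₁
table₁-OK = record { rows-OK = refl }

table₂-OK : TableOK 1 table₂
table₂-OK = record { rows-OK = refl }

private variable
  m n : ℕ
  A : Set

-- Fractions with natural numerators

/-≤ : ∀ a b d e → a * suc e ≤ b * suc d → (+ a) / suc d ℚ.≤ (+ b) / suc e
/-≤ a b d e h = ℚ.toℚᵘ-cancel-≤ (ℚᵘ.≤-respˡ-≃ (ℚᵘ.≃-sym (ℚ.toℚᵘ-fromℚᵘ (mkℚᵘ (+ a) d)))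
  (ℚᵘ.≤-respʳ-≃ (ℚᵘ.≃-sym (ℚ.toℚᵘ-fromℚᵘ (mkℚᵘ (+ b) e)))
    (*≤* (subst₂ ℤ._≤_ (ℤ.pos-* a (suc e)) (ℤ.pos-* b (suc d)) (ℤ.+≤+ h)))))

/-< : ∀ a b d e → a * suc e < b * suc d → (+ a) / suc d ℚ.< (+ b) / suc e
/-< a b d e h = ℚ.toℚᵘ-cancel-< (ℚᵘ.<-respˡ-≃ (ℚᵘ.≃-sym (ℚ.toℚᵘ-fromℚᵘ (mkℚᵘ (+ a) d)))
  (ℚᵘ.<-respʳ-≃ (ℚᵘ.≃-sym (ℚ.toℚᵘ-fromℚᵘ (mkℚᵘ (+ b) e)))
    (*<* (subst₂ ℤ._<_ (ℤ.pos-* a (suc e)) (ℤ.pos-* b (suc d)) (ℤ.+<+ h)))))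

/-+ : ∀ a b d → (+ a) / suc d ℚ.+ (+ b) / suc d ≡ (+ (a + b)) / suc d
/-+ a b d = ℚ.toℚᵘ-injective
  (ℚᵘ.≃-trans (ℚ.toℚᵘ-homo-+ ((+ a) / suc d) ((+ b) / suc d))
  (ℚᵘ.≃-trans (ℚᵘ.+-cong (ℚ.toℚᵘ-fromℚᵘ (mkℚᵘ (+ a) d)) (ℚ.toℚᵘ-fromℚᵘ (mkℚᵘ (+ b) d)))
  (ℚᵘ.≃-trans (*≡* eq) (ℚᵘ.≃-sym (ℚ.toℚᵘ-fromℚᵘ (mkℚᵘ (+ (a + b)) d))))))
  where
  eq : ((+ a) ℤ.* (+ suc d) ℤ.+ (+ b) ℤ.* (+ suc d)) ℤ.* (+ suc d) ≡ (+ (a + b)) ℤ.* ((+ suc d) ℤ.* (+ suc d))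
  eq = trans (cong (ℤ._* (+ suc d)) (sym (ℤ.*-distribʳ-+ (+ suc d) (+ a) (+ b))))
             (ℤ.*-assoc (+ (a + b)) (+ suc d) (+ suc d))

-- Sums over ℕ

on-∧ : ∀ b c k → on (b ∧ c) k ≡ on b (on c k)
on-∧ true  c k = refl
on-∧ false c k = refl

on-+ : ∀ b k l → on b (k + l) ≡ on b k + on b l
on-+ true  k l = refl
on-+ false k l = refl

on-≤ : ∀ b k → on b k ≤ k
on-≤ true  k = ℕ.≤-refl
on-≤ false k = z≤n

on-mono : ∀ b {k l} → k ≤ l → on b k ≤ on b l
on-mono true  h = h
on-mono false h = z≤n

on-dec-≤ : ∀ {P : Set} (P? : Dec P) {k l} → (P → k ≤ l) → on (does P?) k ≤ l
on-dec-≤ (yes p) h = h p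
on-dec-≤ (no _)  h = z≤n

on-0 : ∀ b → on b 0 ≡ 0
on-0 true  = refl
on-0 false = refl

-- Abstract, since the unfolded sum of the library defeats unification.
abstract

  sum : (Fin n → ℕ) → ℕ
  sum = Sum.sum

  sum₅ : (f : Fin 5 → ℕ) → sum f ≡ ∑₅ f
  sum₅ f = cong (λ s → f 0F + (f 1F + (f 2F + (f 3F + s)))) (ℕ.+-identityʳ (f 4F))

  sum-cong : {f g : Fin n → ℕ} → (∀ i → f i ≡ g i) → sum f ≡ sum g
  sum-cong = Sum.sum-cong-≗

  sum-+ : (f g : Fin n → ℕ) → sum (λ i → f i + g i) ≡ sum f + sum g
  sum-+ = Sum.∑-distrib-+

  sum-comm : ∀ {m} (f : Fin m → Fin n → ℕ) → (sum λ i → sum λ j → f i j) ≡ (sum λ j → sum λ i → f i j)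
  sum-comm f = Sum.∑-comm f

  sum-*ʳ : (f : Fin n → ℕ) (k : ℕ) → sum (λ i → f i * k) ≡ sum f * k
  sum-*ʳ f k = sym (Sum.*-distribʳ-sum k f)

  sum-punchIn : (u : Fin (suc n)) (f : Fin (suc n) → ℕ) → sum f ≡ f u + sum (f ∘ punchIn u)
  sum-punchIn u f = Sum.sum-remove {i = u} f

  sum-mono : {f g : Fin n → ℕ} → (∀ i → f i ≤ g i) → sum f ≤ sum g
  sum-mono {zero}  h = z≤n
  sum-mono {suc n} h = ℕ.+-mono-≤ (h zero) (sum-mono (h ∘ suc))

  sum-0 : {f : Fin n → ℕ} → (∀ i → f i ≡ 0) → sum f ≡ 0
  sum-0 {zero}  h = refl
  sum-0 {suc n} h = cong₂ _+_ (h zero) (sum-0 (h ∘ suc))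

  sum-1 : ∀ n → sum {n} (λ _ → 1) ≡ n
  sum-1 zero    = refl
  sum-1 (suc n) = cong suc (sum-1 n)

  sum-δ : (x : Fin n) (f : Fin n → ℕ) → sum (λ i → on (does (i ≟ x)) (f i)) ≡ f x
  sum-δ {suc n} zero    f = trans (cong₂ _+_ refl (sum-0 {n} (λ i → refl))) (ℕ.+-identityʳ _)
  sum-δ {suc n} (suc x) f = sum-δ x (f ∘ suc)

  Σₗ : (A → ℕ) → List A → ℕ
  Σₗ f []       = 0
  Σₗ f (x ∷ xs) = f x + Σₗ f xs

  Σₗ-++ : ∀ (f : A → ℕ) xs ys → Σₗ f (xs ++ ys) ≡ Σₗ f xs + Σₗ f ys
  Σₗ-++ f []       ys = refl
  Σₗ-++ f (x ∷ xs) ys = trans (cong₂ _+_ refl (Σₗ-++ f xs ys)) (sym (ℕ.+-assoc (f x) _ _))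

  Σₗ-map : ∀ {B : Set} (f : B → ℕ) (g : A → B) xs → Σₗ f (map g xs) ≡ Σₗ (f ∘ g) xs
  Σₗ-map f g []       = refl
  Σₗ-map f g (x ∷ xs) = cong₂ _+_ refl (Σₗ-map f g xs)

  Σₗ-filter : ∀ {P : A → Set} (P? : Decidable P) (f : A → ℕ) xs →
              Σₗ f (filter P? xs) ≡ Σₗ (λ x → on (does (P? x)) (f x)) xs
  Σₗ-filter P? f [] = refl
  Σₗ-filter P? f (x ∷ xs) with does (P? x)
  ... | true  = cong₂ _+_ refl (Σₗ-filter P? f xs)
  ... | false = Σₗ-filter P? f xs

  Σₗ-cartesianProduct : ∀ {B : Set} (f : A × B → ℕ) xs ys →
    Σₗ f (cartesianProduct xs ys) ≡ Σₗ (λ x → Σₗ (λ y → f (x , y)) ys) xs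
  Σₗ-cartesianProduct f []       ys = refl
  Σₗ-cartesianProduct f (x ∷ xs) ys =
    trans (Σₗ-++ f (map (x ,_) ys) (cartesianProduct xs ys))
          (cong₂ _+_ (Σₗ-map f (x ,_) ys) (Σₗ-cartesianProduct f xs ys))

  Σₗ-tabulate : ∀ (f : A → ℕ) (g : Fin n → A) → Σₗ f (List.tabulate g) ≡ sum (f ∘ g)
  Σₗ-tabulate {n = zero}  f g = refl
  Σₗ-tabulate {n = suc n} f g = cong₂ _+_ refl (Σₗ-tabulate f (g ∘ suc))

  Σₗ-length : (xs : List A) → Σₗ (λ _ → 1) xs ≡ List.length xs
  Σₗ-length []       = refl
  Σₗ-length (_ ∷ xs) = cong suc (Σₗ-length xs)

  ∑-/ : ∀ d (f : A → ℕ) L → ∑ L (λ x → (+ f x) / suc d) ≡ (+ Σₗ f L) / suc d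
  ∑-/ d f [] = ℚ.≤-antisym (/-≤ 0 0 0 d z≤n) (/-≤ 0 0 d 0 z≤n)
  ∑-/ d f (x ∷ L) = trans (cong₂ ℚ._+_ {x = (+ f x) / suc d} refl (∑-/ d f L)) (/-+ (f x) (Σₗ f L) d)

≤sum : (f : Fin n → ℕ) (i : Fin n) → f i ≤ sum f
≤sum f i = ℕ.≤-trans (ℕ.≤-reflexive (sym (sum-δ i f))) (sum-mono λ j → on-≤ (does (j ≟ i)) (f j))

sum-on : ∀ b (f : Fin n → ℕ) → sum (λ i → on b (f i)) ≡ on b (sum f)
sum-on true  f = refl
sum-on false f = sum-0 (λ i → refl)

sum-allTriples : (f : Triple n → ℕ) →
  Σₗ f (allTriples n) ≡ sum λ i → sum λ j → sum λ k → f (i , j , k)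
sum-allTriples {n} f = trans (Σₗ-cartesianProduct f (allFin n) _)
  (trans (Σₗ-tabulate _ id) (sum-cong λ i →
   trans (Σₗ-cartesianProduct (λ T → f (i , T)) (allFin n) (allFin n))
  (trans (Σₗ-tabulate _ id) (sum-cong λ j → Σₗ-tabulate (λ k → f (i , j , k)) id))))

-- Packings from integral weights

module _ (F : Graph n) (w : Fin n → Fin n → Fin n → ℕ) (w-sym : ∀ x y z → w x y z ≡ w y x z) where

  private
    adjᵇ : Fin n → Fin n → Bool
    adjᵇ x y = does (adj? F x y)

    triangleᵇ : Fin n → Fin n → Fin n → Bool
    triangleᵇ x y z = adjᵇ x y ∧ adjᵇ y z ∧ adjᵇ x z

  -- A triangle may receive weight from each of its three sides as base, with the opposite vertex as
  -- apex. This is the share of one side; `load` adds the three.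
  apexOn : Fin n → Fin n → Fin n → ℕ
  apexOn x y z = on (triangleᵇ x y z) (w x y z)

  load : Fin n → Fin n → Fin n → ℕ
  load x y z = apexOn x y z + (apexOn y z x + apexOn x z y)

  private
    adjᵇ-sym : ∀ x y → adjᵇ x y ≡ adjᵇ y x
    adjᵇ-sym x y with adj? F x y
    ... | yes p = sym (dec-true (adj? F y x) (adj-sym F p))
    ... | no ¬p = sym (dec-false (adj? F y x) (¬p ∘ adj-sym F))

    adjᵇ-irrefl : ∀ x → adjᵇ x x ≡ false
    adjᵇ-irrefl x = dec-false (adj? F x x) (irrefl F)

    ∧-rot : ∀ a b c → a ∧ b ∧ c ≡ b ∧ c ∧ a
    ∧-rot true  true  true  = refl
    ∧-rot true  true  false = refl
    ∧-rot true  false c     = refl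
    ∧-rot false true  true  = refl
    ∧-rot false true  false = refl
    ∧-rot false false c     = refl

    ∧-swap : ∀ a b c → a ∧ b ∧ c ≡ a ∧ c ∧ b
    ∧-swap true  b c = Bool.∧-comm b c
    ∧-swap false b c = refl

    triangle-sym : ∀ x y z → triangleᵇ x y z ≡ triangleᵇ y x z
    triangle-sym x y z rewrite adjᵇ-sym x y = ∧-swap (adjᵇ y x) (adjᵇ y z) (adjᵇ x z)

    triangle-rot : ∀ x y z → triangleᵇ x y z ≡ triangleᵇ y z x
    triangle-rot x y z rewrite adjᵇ-sym x z | adjᵇ-sym x y = ∧-rot (adjᵇ y x) (adjᵇ y z) (adjᵇ z x)

    triangle-flip : ∀ x y z → triangleᵇ x y z ≡ triangleᵇ x z y
    triangle-flip x y z = trans (triangle-sym x y z) (trans (triangle-rot y x z) refl)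

    apex-sym : ∀ x y z → apexOn x y z ≡ apexOn y x z
    apex-sym x y z = cong₂ on (triangle-sym x y z) (w-sym x y z)

    weightOf : Fin n → Fin n → Fin n → ℕ
    weightOf x y z = w x y z + (w y z x + w x z y)

    load-on : ∀ x y z → load x y z ≡ on (triangleᵇ x y z) (weightOf x y z)
    load-on x y z rewrite sym (triangle-rot x y z) | sym (triangle-flip x y z) =
      trans (cong₂ _+_ refl (sym (on-+ b _ _))) (sym (on-+ b _ _))
      where b = triangleᵇ x y z

    load-sym : ∀ x y z → load x y z ≡ load y x z
    load-sym x y z = cong₂ _+_ (apex-sym x y z) (ℕ.+-comm (apexOn y z x) (apexOn x z y))

    load-rot : ∀ x y z → load x y z ≡ load x z y
    load-rot x y z rewrite apex-sym z y x =
      solve 3 (λ a b c → a :+ (b :+ c) := c :+ (b :+ a)) refl (apexOn x y z) (apexOn y z x) (apexOn x z y)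
      where open +-*-Solver

    Ω : Triple n → ℕ
    Ω (i , j , k) = weightOf i j k

    ω : Triple n → ℚ
    ω T = (+ Ω T) / D

    _<ᶠ_ : Fin n → Fin n → Bool
    i <ᶠ j = does (i <? j)

    isTriangle-on : ∀ i j k →
      on (does (isTriangle? F (i , j , k))) (weightOf i j k) ≡ on (i <ᶠ j) (on (j <ᶠ k) (load i j k))
    isTriangle-on i j k =
      trans (on-∧ (i <ᶠ j) _ _) (cong (on (i <ᶠ j))
      (trans (on-∧ (j <ᶠ k) _ _) (cong (on (j <ᶠ k)) (sym (load-on i j k)))))

    sum-triangles : (g : Triple n → Bool) →
      Σₗ (λ T → on (g T) (Ω T)) (triangles F) ≡
      sum λ i → sum λ j → sum λ k → on (g (i , j , k)) (on (i <ᶠ j) (on (j <ᶠ k) (load i j k)))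
    sum-triangles g = trans (Σₗ-filter (isTriangle? F) _ (allTriples n))
      (trans (sum-allTriples _) (sum-cong λ i → sum-cong λ j → sum-cong λ k →
        trans (on-comm (does (isTriangle? F (i , j , k))) (g (i , j , k)) _)
              (cong (on (g (i , j , k))) (isTriangle-on i j k))))
      where
      on-comm : ∀ b c k → on b (on c k) ≡ on c (on b k)
      on-comm true  c k = refl
      on-comm false c k = sym (on-0 c)

    <ᶠ-true : ∀ {i j} → i Fin.< j → (i <ᶠ j) ≡ true
    <ᶠ-true {i} {j} = dec-true (i <? j)

    <ᶠ-false : ∀ {i j} → ¬ i Fin.< j → (i <ᶠ j) ≡ false
    <ᶠ-false {i} {j} = dec-false (i <? j)

    triangle-xx : ∀ x z → triangleᵇ x x z ≡ false
    triangle-xx x z rewrite adjᵇ-irrefl x = refl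

    apex-xx : ∀ x z → apexOn x x z ≡ 0
    apex-xx x z = cong (λ b → on b _) (triangle-xx x z)

    apex-xyx : ∀ x y → apexOn x y x ≡ 0
    apex-xyx x y = cong (λ b → on b _) (trans (triangle-flip x y x) (triangle-xx x y))

    apex-xyy : ∀ x y → apexOn x y y ≡ 0
    apex-xyy x y = trans (apex-sym x y y) (apex-xyx y x)

    split-≶ : ∀ x y z → apexOn x y z ≡ on (x <ᶠ y) (apexOn x y z) + on (y <ᶠ x) (apexOn x y z)
    split-≶ x y z with Fin.<-cmp x y
    ... | tri< x<y _ y≮x rewrite <ᶠ-true x<y | <ᶠ-false y≮x = sym (ℕ.+-identityʳ _)
    ... | tri> x≮y _ y<x rewrite <ᶠ-false x≮y | <ᶠ-true y<x = refl
    ... | tri≈ x≮y refl _ rewrite <ᶠ-false x≮y | apex-xx x z = refl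

    -- Given x < y, the apex lies above, between or below the two. The equality cases are harmless
    -- since `apexOn` vanishes on repeated vertices.
    split-apex : ∀ x y z → on (x <ᶠ y) (apexOn x y z) ≡
      on (x <ᶠ y) (on (y <ᶠ z) (apexOn x y z)) +
      (on (x <ᶠ z) (on (z <ᶠ y) (apexOn x y z)) + on (z <ᶠ x) (on (x <ᶠ y) (apexOn x y z)))
    split-apex x y z with Fin.<-cmp x y
    split-apex x y z | tri< x<y _ _ rewrite <ᶠ-true x<y with Fin.<-cmp y z
    ... | tri< y<z _ z≮y rewrite <ᶠ-true y<z | <ᶠ-false z≮y | <ᶠ-false (λ z<x → z≮y (Fin.<-trans z<x x<y))
          | on-0 (x <ᶠ z) = sym (ℕ.+-identityʳ _)
    ... | tri≈ y≮z refl _ rewrite apex-xyy x y | on-0 (y <ᶠ y) | on-0 (x <ᶠ y) | on-0 (y <ᶠ x) = refl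
    ... | tri> y≮z _ z<y rewrite <ᶠ-false y≮z | <ᶠ-true z<y with Fin.<-cmp x z
    ...   | tri< x<z _ z≮x rewrite <ᶠ-true x<z | <ᶠ-false z≮x = sym (ℕ.+-identityʳ _)
    ...   | tri≈ _ refl _ rewrite apex-xyx x y | on-0 (x <ᶠ x) = refl
    ...   | tri> x≮z _ z<x rewrite <ᶠ-false x≮z | <ᶠ-true z<x = refl
    split-apex x y z | tri≈ x≮y refl _ rewrite <ᶠ-false x≮y | apex-xx x z | on-0 (z <ᶠ x) | on-0 (x <ᶠ z) = refl
    split-apex x y z | tri> x≮y _ y<x rewrite <ᶠ-false x≮y | on-0 (z <ᶠ x) with x <? z
    ... | no  x≮z rewrite <ᶠ-false x≮z = refl
    ... | yes x<z rewrite <ᶠ-true x<z | <ᶠ-false (λ z<y → x≮y (Fin.<-trans x<z z<y)) = refl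

    Σ³ : (Fin n → Fin n → Fin n → ℕ) → ℕ
    Σ³ f = sum λ x → sum λ y → sum λ z → f x y z

    Σ³-cong : ∀ {f g} → (∀ x y z → f x y z ≡ g x y z) → Σ³ f ≡ Σ³ g
    Σ³-cong h = sum-cong λ x → sum-cong λ y → sum-cong λ z → h x y z

    Σ³-+ : ∀ f g → Σ³ (λ x y z → f x y z + g x y z) ≡ Σ³ f + Σ³ g
    Σ³-+ f g = trans (sum-cong λ x → trans (sum-cong λ y → sum-+ _ _) (sum-+ _ _)) (sum-+ _ _)

    Σ³-swap₁₂ : ∀ f → Σ³ (λ x y z → f y x z) ≡ Σ³ f
    Σ³-swap₁₂ f = sum-comm (λ x y → sum λ z → f y x z)

    Σ³-swap₂₃ : ∀ f → Σ³ (λ x y z → f x z y) ≡ Σ³ f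
    Σ³-swap₂₃ f = sum-cong λ x → sum-comm (λ y z → f x z y)

    sorted : (Fin n → Fin n → Fin n → ℕ) → Fin n → Fin n → Fin n → ℕ
    sorted f x y z = on (x <ᶠ y) (on (y <ᶠ z) (f x y z))

    -- Symmetry in the base leaves twice the sum over x < y. Sorting by the position of the apex
    -- then sends each share to the increasing triple of its triangle, where the three shares add up
    -- to `load`.
    sorted-total : Σ³ apexOn ≡ 2 * Σ³ (sorted load)
    sorted-total = begin
      Σ³ apexOn
        ≡⟨ Σ³-cong split-≶ ⟩
      Σ³ (λ x y z → on (x <ᶠ y) (apexOn x y z) + on (y <ᶠ x) (apexOn x y z))
        ≡⟨ Σ³-+ _ _ ⟩
      Σ³ half + Σ³ (λ x y z → on (y <ᶠ x) (apexOn x y z))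
        ≡⟨ cong₂ _+_ {x = Σ³ half} refl (trans (Σ³-cong λ x y z → cong (on (y <ᶠ x)) (apex-sym x y z)) (Σ³-swap₁₂ half)) ⟩
      Σ³ half + Σ³ half
        ≡⟨ cong₂ _+_ {x = Σ³ half} refl (sym (ℕ.+-identityʳ _)) ⟩
      2 * Σ³ half
        ≡⟨ cong (2 *_) half-sorted ⟩
      2 * Σ³ (sorted load) ∎
      where
      open ≡-Reasoning
      half : Fin n → Fin n → Fin n → ℕ
      half x y z = on (x <ᶠ y) (apexOn x y z)
      sorted-+ : ∀ f g x y z → sorted (λ x y z → f x y z + g x y z) x y z ≡ sorted f x y z + sorted g x y z
      sorted-+ f g x y z = trans (cong (on (x <ᶠ y)) (on-+ (y <ᶠ z) _ _)) (on-+ (x <ᶠ y) _ _)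
      middle : Σ³ (λ x y z → on (x <ᶠ z) (on (z <ᶠ y) (apexOn x y z))) ≡ Σ³ (sorted λ x y z → apexOn x z y)
      middle = Σ³-swap₂₃ (sorted λ x y z → apexOn x z y)
      last : Σ³ (λ x y z → on (z <ᶠ x) (on (x <ᶠ y) (apexOn x y z))) ≡ Σ³ (sorted λ x y z → apexOn y z x)
      last = trans (Σ³-swap₂₃ (λ x y z → on (y <ᶠ x) (on (x <ᶠ z) (apexOn x z y))))
                   (Σ³-swap₁₂ (sorted λ x y z → apexOn y z x))
      half-sorted : Σ³ half ≡ Σ³ (sorted load)
      half-sorted = begin
        Σ³ half ≡⟨ Σ³-cong split-apex ⟩
        _ ≡⟨ Σ³-+ _ _ ⟩
        _ ≡⟨ cong₂ _+_ {x = Σ³ (sorted apexOn)} refl (trans (Σ³-+ _ _) (trans (ℕ.+-comm (Σ³ λ x y z → on (x <ᶠ z) (on (z <ᶠ y) (apexOn x y z))) _) (cong₂ _+_ last middle))) ⟩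
        _ ≡⟨ cong₂ _+_ {x = Σ³ (sorted apexOn)} refl (sym (trans (Σ³-cong (sorted-+ _ _)) (Σ³-+ (sorted λ x y z → apexOn y z x) _))) ⟩
        _ ≡⟨ sym (trans (Σ³-cong (sorted-+ apexOn _)) (Σ³-+ (sorted apexOn) _)) ⟩
        Σ³ (sorted load) ∎

    -- In an increasing triple the pair x < y can occupy the first two, the outer two or the last
    -- two places. The right-hand side has one term for each possibility.
    through : ∀ {x y} → x Fin.< y → ∀ i j k →
      on (does (contains? x y (i , j , k))) (sorted load i j k) ≤
      on (does (i ≟ x)) (on (does (j ≟ y)) (on (y <ᶠ k) (load x y k))) +
      (on (does (i ≟ x)) (on (does (k ≟ y)) (on (x <ᶠ j) (on (j <ᶠ y) (load x y j)))) +
       on (does (j ≟ x)) (on (does (k ≟ y)) (on (i <ᶠ x) (load x y i))))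
    through {x} {y} x<y i j k =
      on-dec-≤ (contains? x y (i , j , k)) λ (x∈ , y∈) → on-dec-≤ (i <? j) λ i<j → on-dec-≤ (j <? k) λ j<k →
      cases i<j j<k x∈ y∈
      where
      t₁ t₂ t₃ : ℕ
      t₁ = on (does (i ≟ x)) (on (does (j ≟ y)) (on (y <ᶠ k) (load x y k)))
      t₂ = on (does (i ≟ x)) (on (does (k ≟ y)) (on (x <ᶠ j) (on (j <ᶠ y) (load x y j))))
      t₃ = on (does (j ≟ x)) (on (does (k ≟ y)) (on (i <ᶠ x) (load x y i)))
      ≤₁ : load i j k ≡ t₁ → load i j k ≤ t₁ + (t₂ + t₃)
      ≤₁ eq = ℕ.≤-trans (ℕ.≤-reflexive eq) (ℕ.m≤m+n t₁ (t₂ + t₃))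
      ≤₂ : load i j k ≡ t₂ → load i j k ≤ t₁ + (t₂ + t₃)
      ≤₂ eq = ℕ.≤-trans (ℕ.≤-reflexive eq) (ℕ.≤-trans (ℕ.m≤m+n t₂ t₃) (ℕ.m≤n+m (t₂ + t₃) t₁))
      ≤₃ : load i j k ≡ t₃ → load i j k ≤ t₁ + (t₂ + t₃)
      ≤₃ eq = ℕ.≤-trans (ℕ.≤-reflexive eq) (ℕ.≤-trans (ℕ.m≤n+m t₃ t₂) (ℕ.m≤n+m (t₂ + t₃) t₁))
      absurd : ∀ {A : Set} {a b} → a Fin.< b → b Fin.< a → A
      absurd p q = contradiction q (Fin.<-asym p)
      ≟-refl : ∀ a → does (a ≟ a) ≡ true
      ≟-refl a = dec-true (a ≟ a) refl
      cases : i Fin.< j → j Fin.< k → x ∈ vertices (i , j , k) → y ∈ vertices (i , j , k) → load i j k ≤ t₁ + (t₂ + t₃)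
      cases i<j j<k (here refl) (here refl) = ⊥-elim (Fin.<-irrefl refl x<y)
      cases i<j j<k (here refl) (there (here refl)) = ≤₁ eq
        where
        eq : load i j k ≡ on (does (i ≟ i)) (on (does (j ≟ j)) (on (j <ᶠ k) (load i j k)))
        eq rewrite ≟-refl i | ≟-refl j | <ᶠ-true j<k = refl
      cases i<j j<k (here refl) (there (there (here refl))) = ≤₂ eq
        where
        eq : load i j k ≡ on (does (i ≟ i)) (on (does (k ≟ k)) (on (i <ᶠ j) (on (j <ᶠ k) (load i k j))))
        eq rewrite ≟-refl i | ≟-refl k | <ᶠ-true i<j | <ᶠ-true j<k = load-rot i j k
      cases i<j j<k (there (here refl)) (here refl) = absurd i<j x<y
      cases i<j j<k (there (here refl)) (there (here refl)) = ⊥-elim (Fin.<-irrefl refl x<y)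
      cases i<j j<k (there (here refl)) (there (there (here refl))) = ≤₃ eq
        where
        eq : load i j k ≡ on (does (j ≟ j)) (on (does (k ≟ k)) (on (i <ᶠ j) (load j k i)))
        eq rewrite ≟-refl j | ≟-refl k | <ᶠ-true i<j = trans (load-sym i j k) (load-rot j i k)
      cases i<j j<k (there (there (here refl))) (here refl) = absurd (Fin.<-trans i<j j<k) x<y
      cases i<j j<k (there (there (here refl))) (there (here refl)) = absurd j<k x<y
      cases i<j j<k (there (there (here refl))) (there (there (here refl))) = ⊥-elim (Fin.<-irrefl refl x<y)

    Σ³-mono : ∀ {f g} → (∀ x y z → f x y z ≤ g x y z) → Σ³ f ≤ Σ³ g
    Σ³-mono h = sum-mono λ x → sum-mono λ y → sum-mono λ z → h x y z

    Σ³-δ₁₂ : ∀ x y f → Σ³ (λ i j k → on (does (i ≟ x)) (on (does (j ≟ y)) (f k))) ≡ sum f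
    Σ³-δ₁₂ x y f = trans (sum-cong λ i → trans (sum-cong λ j → trans (sum-on (does (i ≟ x)) _)
        (cong (on (does (i ≟ x))) (sum-on (does (j ≟ y)) f))) (sum-on (does (i ≟ x)) _))
      (trans (sum-δ x _) (sum-δ y _))

    through-total : ∀ {x y} → x Fin.< y →
      Σ³ (λ i j k → on (does (contains? x y (i , j , k))) (sorted load i j k)) ≤ sum (load x y)
    through-total {x} {y} x<y = begin
      Σ³ (λ i j k → on (does (contains? x y (i , j , k))) (sorted load i j k))
        ≤⟨ Σ³-mono (through x<y) ⟩
      Σ³ (λ i j k → on (does (i ≟ x)) (on (does (j ≟ y)) (f₁ k)) +
        (on (does (i ≟ x)) (on (does (k ≟ y)) (f₂ j)) + on (does (j ≟ x)) (on (does (k ≟ y)) (f₃ i))))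
        ≡⟨ trans (Σ³-+ _ _) (cong₂ _+_ (Σ³-δ₁₂ x y f₁) (trans (Σ³-+ _ _) (cong₂ _+_
             (trans (Σ³-swap₂₃ (λ i k j → on (does (i ≟ x)) (on (does (k ≟ y)) (f₂ j)))) (Σ³-δ₁₂ x y f₂))
             (trans (sym (Σ³-swap₁₂ _)) (trans (Σ³-swap₂₃ (λ j k i → on (does (j ≟ x)) (on (does (k ≟ y)) (f₃ i)))) (Σ³-δ₁₂ x y f₃)))))) ⟩
      sum f₁ + (sum f₂ + sum f₃)
        ≡⟨ sym (trans (sum-+ f₁ _) (cong₂ _+_ refl (sum-+ f₂ f₃))) ⟩
      sum (λ z → f₁ z + (f₂ z + f₃ z))
        ≤⟨ sum-mono exclusive ⟩
      sum (load x y) ∎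
      where
      open ℕ.≤-Reasoning
      f₁ f₂ f₃ : Fin n → ℕ
      f₁ z = on (y <ᶠ z) (load x y z)
      f₂ z = on (x <ᶠ z) (on (z <ᶠ y) (load x y z))
      f₃ z = on (z <ᶠ x) (load x y z)
      -- The ranges y < z, x < z < y and z < x are disjoint, so at most one of the three terms
      -- counts.
      exclusive : ∀ z → f₁ z + (f₂ z + f₃ z) ≤ load x y z
      exclusive z with Fin.<-cmp x z
      ... | tri< x<z _ z≮x rewrite <ᶠ-true x<z | <ᶠ-false z≮x with Fin.<-cmp y z
      ...   | tri< y<z _ z≮y rewrite <ᶠ-true y<z | <ᶠ-false z≮y = ℕ.≤-reflexive (ℕ.+-identityʳ _)
      ...   | tri≈ y≮z _ z≮y rewrite <ᶠ-false y≮z | <ᶠ-false z≮y = z≤n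
      ...   | tri> y≮z _ z<y rewrite <ᶠ-false y≮z | <ᶠ-true z<y = ℕ.≤-reflexive (ℕ.+-identityʳ _)
      exclusive z | tri≈ x≮z refl _ rewrite <ᶠ-false x≮z | <ᶠ-false (Fin.<-asym x<y) = z≤n
      exclusive z | tri> x≮z _ z<x rewrite <ᶠ-false x≮z | <ᶠ-true z<x
        | <ᶠ-false (Fin.<-asym (Fin.<-trans z<x x<y)) = ℕ.≤-refl

    edge-total : ∀ {x y} → Adj F x y →
      Σₗ Ω (filter (contains? x y) (triangles F)) ≤ sum (load x y)
    edge-total {x} {y} xy = ℕ.≤-trans (ℕ.≤-reflexive
      (trans (Σₗ-filter (contains? x y) Ω (triangles F)) (sum-triangles (does ∘ contains? x y)))) bound
      where
      contains-sym : ∀ T → does (contains? x y T) ≡ does (contains? y x T)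
      contains-sym T = Bool.∧-comm (does (mem? _≟_ x (vertices T))) _
      bound : Σ³ (λ i j k → on (does (contains? x y (i , j , k))) (sorted load i j k)) ≤ sum (load x y)
      bound with Fin.<-cmp x y
      ... | tri< x<y _ _ = through-total x<y
      ... | tri≈ _ refl _ = ⊥-elim (irrefl F xy)
      ... | tri> _ _ y<x = ℕ.≤-trans
        (ℕ.≤-reflexive (Σ³-cong λ i j k → cong (λ b → on b (sorted load i j k)) (contains-sym (i , j , k))))
        (ℕ.≤-trans (through-total y<x) (ℕ.≤-reflexive (sum-cong (load-sym y x))))

  -- The bridge from weights symmetric in the base, for which no order of the vertices matters, to
  -- packings on increasing triples. The factor 2 comes from the two orders of a base.
  ν*-≥ : (∀ x y → Adj F x y → sum (load x y) ≤ D) →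
    ∃[ W ] (sum λ x → sum λ y → sum λ z → apexOn x y z) ≡ 2 * W × ((+ W) / D) ℚ.≤ ν* F
  ν*-≥ load≤D = Σ³ (sorted load) , sorted-total ,
    subst (ℚ._≤ ν* F) weight≡ (IsMaxWeight.bound (ν*-isMaxWeight F) ω packing)
    where
    weight≡ : weight F ω ≡ (+ Σ³ (sorted load)) / D
    -- Denominators are passed as predecessors: 719 is `D` minus 1.
    weight≡ = trans (∑-/ 719 Ω (triangles F)) (cong (λ k → (+ k) / D) (sum-triangles (λ _ → true)))
    packing : IsPacking F ω
    packing = record
      { ≥0   = λ T _ → /-≤ 0 (Ω T) 0 719 z≤n
      -- The weight of a triangle is one term of the load on its side `i j`, so the bound for edges
      -- covers it.
      ; ≤1   = λ { (i , j , k) (i<j , j<k , ij , jk , ik) → /-≤ (Ω (i , j , k)) 1 719 0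
                 (subst₂ _≤_ (sym (ℕ.*-identityʳ _)) refl
                 (ℕ.≤-trans (ℕ.≤-reflexive (sym (trans (load-on i j k)
                    (cong (λ b → on b (weightOf i j k)) (cong₂ _∧_ (dec-true (adj? F i j) ij)
                      (cong₂ _∧_ (dec-true (adj? F j k) jk) (dec-true (adj? F i k) ik)))))))
                 (ℕ.≤-trans (≤sum (load i j) k) (load≤D i j ij)))) }
      ; edge = λ x y xy → subst (ℚ._≤ 1ℚ) (sym (∑-/ 719 Ω (filter (contains? x y) (triangles F))))
                 (/-≤ (Σₗ Ω (filter (contains? x y) (triangles F))) 1 719 0 (subst₂ _≤_ (sym (ℕ.*-identityʳ _)) refl
                   (ℕ.≤-trans (edge-total xy) (load≤D x y xy))))
      }

-- Counting vertices blob by blob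

*-on : ∀ b k l → k * on b l ≡ on b (k * l)
*-on true  k l = refl
*-on false k l = ℕ.*-zeroʳ k

∧-true : ∀ {b c} → b ∧ c ≡ true → b ≡ true × c ≡ true
∧-true {true} {true} _ = refl , refl

does-iff : ∀ {P Q : Set} (P? : Dec P) (Q? : Dec Q) → (P → Q) → (Q → P) → does P? ≡ does Q?
does-iff P? (yes q) f g = dec-true P? (g q)
does-iff P? (no ¬q) f g = dec-false P? (¬q ∘ f)

≟-sym : (x y : Fin n) → does (x ≟ y) ≡ does (y ≟ x)
≟-sym x y = does-iff (x ≟ y) (y ≟ x) sym sym

on-* : ∀ b k l → on b (k * l) ≡ on b k * l
on-* true  k l = refl
on-* false k l = refl

on-1 : ∀ b k → on b k ≡ on b 1 * k
on-1 true  k = sym (ℕ.+-identityʳ k)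
on-1 false k = refl

on-swap : ∀ b c k → on b (on c k) ≡ on c (on b k)
on-swap true  c k = refl
on-swap false c k = sym (on-0 c)

-- Double counting; by this step sums over vertices become expressions in the sizes of the blobs.
sum-fibres : (f : Fin n → Fin 5) (k : Fin n → ℕ) (g : Fin 5 → ℕ) →
  sum (λ x → k x * g (f x)) ≡ sum λ i → sum (λ x → on (does (f x ≟ i)) (k x)) * g i
sum-fibres f k g = sym (begin
  sum (λ i → sum (λ x → on (does (f x ≟ i)) (k x)) * g i)
    ≡⟨ sum-cong (λ i → sym (sum-*ʳ _ (g i))) ⟩
  sum (λ i → sum λ x → on (does (f x ≟ i)) (k x) * g i)
    ≡⟨ sum-comm _ ⟩
  sum (λ x → sum λ i → on (does (f x ≟ i)) (k x) * g i)
    ≡⟨ sum-cong (λ x → trans (sum-cong λ i → trans (sym (on-* (does (f x ≟ i)) (k x) (g i)))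
         (cong (λ b → on b (k x * g i)) (≟-sym (f x) i))) (sum-δ (f x) (λ i → k x * g i))) ⟩
  sum (λ x → k x * g (f x)) ∎)
  where
  open ≡-Reasoning

fibre-remove : (f : Fin n → Fin 5) (y : Fin n) (j : Fin 5) →
  sum (λ z → on (does (f z ≟ j)) (on (not (does (z ≟ y))) 1)) ≡
  sum (λ z → on (does (f z ≟ j)) 1) ∸ on (does (f y ≟ j)) 1
fibre-remove f y j = sym (trans (cong (_∸ on (does (f y ≟ j)) 1) split) (ℕ.m+n∸m≡n (on (does (f y ≟ j)) 1) rest))
  where
  open ≡-Reasoning
  rest : ℕ
  rest = sum λ z → on (does (f z ≟ j)) (on (not (does (z ≟ y))) 1)
  one : ∀ s → 1 ≡ on s 1 + on (not s) 1
  one true  = refl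
  one false = refl
  split : sum (λ z → on (does (f z ≟ j)) 1) ≡ on (does (f y ≟ j)) 1 + rest
  split = begin
    sum (λ z → on (does (f z ≟ j)) 1)
      ≡⟨ sum-cong (λ z → trans (cong (on (does (f z ≟ j))) (one (does (z ≟ y)))) (on-+ (does (f z ≟ j)) _ _)) ⟩
    sum (λ z → on (does (f z ≟ j)) (on (does (z ≟ y)) 1) + on (does (f z ≟ j)) (on (not (does (z ≟ y))) 1))
      ≡⟨ sum-+ _ _ ⟩
    sum (λ z → on (does (f z ≟ j)) (on (does (z ≟ y)) 1)) + rest
      ≡⟨ cong (λ k → k + rest) (trans (sum-cong λ z → on-swap (does (f z ≟ j)) (does (z ≟ y)) 1)
           (sum-δ y (λ z → on (does (f z ≟ j)) 1))) ⟩
    on (does (f y ≟ j)) 1 + rest ∎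

-- Links between blobs

same-refl : ∀ c → same c c ≡ true
same-refl red  = refl
same-refl blue = refl

same⇒≡ : ∀ c d → same c d ≡ true → c ≡ d
same⇒≡ red  red  _ = refl
same⇒≡ blue blue _ = refl

linked-diag : ∀ c i → linked c i i ≡ false
linked-diag c 0F = refl
linked-diag c 1F = refl
linked-diag c 2F = refl
linked-diag c 3F = refl
linked-diag c 4F = refl

linked-cases : ∀ i j → i ≡ j ⊎ ∃[ c ] linked c i j ≡ true
linked-cases i j with from-yes (Fin.all? λ i → Fin.all? λ j →
    (i ≟ j) ⊎-dec (linked red i j Bool.≟ true) ⊎-dec (linked blue i j Bool.≟ true)) i j
... | inj₁ i≡j      = inj₁ i≡j
... | inj₂ (inj₁ l) = inj₂ (red , l)
... | inj₂ (inj₂ l) = inj₂ (blue , l)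

-- Numerical certificates and configurations

classSize : Five → Five → Colour → Fin 5 → ℕ
classSize r b red  = r !_
classSize r b blue = b !_

-- p i j is the weight that an inner edge of blob i puts on an apex in blob j,
-- μ i j that of the triangle formed by u and an edge between blobs i and j, and
-- t that of the triangle formed by the flipped edge and a vertex of blob 3.
record Certificate (a : Five) (ε : ℕ) (r b : Five) : Set where
  field
    p μ    : Fin 5 → Fin 5 → ℕ
    t      : ℕ
    p-diag : ∀ i → p i i ≡ 0
    μ-diag : ∀ i → μ i i ≡ 0
    μ-sym  : ∀ i j → μ i j ≡ μ j i
    spent  : ∀ c i → ∑₅ (λ j → on (linked c i j) ((a ! j ∸ defect ε i j) * p i j)) ≡ D
    room   : ∀ i j → μ i j + ((a ! i ∸ 1) * p i j + ((a ! j ∸ 1) * p j i + defectLoad t i j)) ≤ D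
    degree : ∀ c i → ∑₅ (λ j → on (linked c i j) (classSize r b c j * μ i j)) ≤ D
    t-spent : a ! 3F * t ≡ ε * D
  crossGain : Colour → ℕ
  crossGain c = ∑₅ λ i → ∑₅ λ j →
    on (linked c i j) ((classSize r b c i * classSize r b c j ∸ defect ε i j) * μ i j)
  field
    enough : target a < 6 * (pairs a * D + 2 * (ε * D) + (crossGain red + crossGain blue))

-- κ colours the edges of H, q those at u. The edge relation S holds the flipped
-- edge, and ex i z says that z is a vertex of the flipped edge whose other vertex
-- lies in blob i.
record Configuration (m : ℕ) : Set where
  field
    blob     : Fin m → Fin 5
    κ        : Fin m → Fin m → Colour
    q        : Fin m → Colour
    S        : Fin m → Fin m → Bool
    ex       : Fin 5 → Fin m → Bool
    ε        : ℕ
    κ-sym    : ∀ x y → κ x y ≡ κ y x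
    S-sym    : ∀ x y → S x y ≡ S y x
    cross    : ∀ x y c → linked c (blob x) (blob y) ≡ true → S x y ≡ false → κ x y ≡ c
    S-blobs  : ∀ x y → S x y ≡ true → (blob x ≡ 0F × blob y ≡ 1F) ⊎ (blob x ≡ 1F × blob y ≡ 0F)
    S-blue   : ∀ x y → S x y ≡ true → κ x y ≡ blue
    S-ex     : ∀ x y → S x y ≡ true → ex (blob x) y ≡ true
    S-unique : ∀ x → sum (λ y → on (S x y) 1) ≤ 1
    S-total  : sum (λ x → sum λ y → on (S x y) 1) ≡ 2 * ε
    S-defect : ∀ i j → sum (λ x → on (does (blob x ≟ i)) (sum λ y → on (does (blob y ≟ j)) (on (S x y) 1))) ≤ defect ε i j
    ε²       : ε * ε ≡ ε
  size : Fin 5 → ℕ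
  size i = sum λ x → on (does (blob x ≟ i)) 1
  colouredSize : Colour → Fin 5 → ℕ
  colouredSize c i = sum λ x → on (does (blob x ≟ i)) (on (same c (q x)) 1)
  field
    ex-count : ∀ i j → sum (λ z → on (does (blob z ≟ j)) (on (not (ex i z)) 1)) ≡ size j ∸ defect ε i j

-- Weights on `H` together with `u`, and the loads they cause

module Weights {m : ℕ} (C : Configuration m) (a r b : Five)
  (size-a : ∀ i → Configuration.size C i ≡ a ! i)
  (size-rb : ∀ c i → Configuration.colouredSize C c i ≡ classSize r b c i)
  (cert : Certificate a (Configuration.ε C) r b) where

  open Configuration C
  open Certificate cert

  -- nothing stands for u
  V : Set
  V = Maybe (Fin m)

  ΣV : (V → ℕ) → ℕ
  ΣV f = f nothing + sum (f ∘ just)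

  adjV : Colour → V → V → Bool
  adjV c nothing  nothing  = false
  adjV c nothing  (just y) = same c (q y)
  adjV c (just x) nothing  = same c (q x)
  adjV c (just x) (just y) = not (does (x ≟ y)) ∧ same c (κ x y)

  -- A triangle through `u` is charged to its side opposite `u`, so bases at `u` get 0. Triangles of
  -- `H` take the inner edge or the flipped edge as base. Whether the three vertices span a triangle
  -- of the colour at hand is left to `apexV`, which is why the link of the apex is not tested here.
  wV : V → V → V → ℕ
  wV (just x) (just y) (just z) =
    on (does (blob x ≟ blob y)) (on (not (ex (blob x) z)) (p (blob x) (blob z))) +
    on (S x y) (on (does (blob z ≟ 3F)) t)
  wV (just x) (just y) nothing  = on (not (S x y)) (μ (blob x) (blob y))
  wV (just x) nothing  Z = 0
  wV nothing  Y        Z = 0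

  apexV : Colour → V → V → V → ℕ
  apexV c X Y Z = on (adjV c X Y ∧ adjV c Y Z ∧ adjV c X Z) (wV X Y Z)

  wV-sym : ∀ X Y Z → wV X Y Z ≡ wV Y X Z
  wV-sym (just x) (just y) (just z) = cong₂ _+_ inner (cong (λ s → on s _) (S-sym x y))
    where
    inner : on (does (blob x ≟ blob y)) (on (not (ex (blob x) z)) (p (blob x) (blob z))) ≡
            on (does (blob y ≟ blob x)) (on (not (ex (blob y) z)) (p (blob y) (blob z)))
    inner with blob x ≟ blob y
    ... | no x≢y = sym (cong (λ s → on s _) (dec-false (blob y ≟ blob x) (x≢y ∘ sym)))
    ... | yes x≡y rewrite x≡y | dec-true (blob y ≟ blob y) refl = refl
  wV-sym (just x) (just y) nothing  = cong₂ on (cong not (S-sym x y)) (μ-sym (blob x) (blob y))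
  wV-sym (just x) nothing  Z = refl
  wV-sym nothing  (just y) Z = refl
  wV-sym nothing  nothing  Z = refl

  private
    on-≤-if : ∀ b {k l} → (b ≡ true → k ≤ l) → on b k ≤ l
    on-≤-if true  h = h refl
    on-≤-if false h = z≤n

    adj⇒κ : ∀ {c x y} → adjV c (just x) (just y) ≡ true → x ≢ y × κ x y ≡ c
    adj⇒κ {c} {x} {y} h with x ≟ y | h
    ... | no x≢y | h′ = x≢y , sym (same⇒≡ c (κ x y) h′)

    κ⇒adj : ∀ {c x y} → x ≢ y → κ x y ≡ c → adjV c (just x) (just y) ≡ true
    κ⇒adj {c} {x} {y} x≢y refl rewrite dec-false (x ≟ y) x≢y = same-refl c

    S-irrefl : ∀ {x y} → blob x ≡ blob y → S x y ≡ false
    S-irrefl {x} {y} e with S x y in s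
    ... | false = refl
    ... | true with S-blobs x y s
    ...   | inj₁ (e₀ , e₁) with trans (sym e₀) (trans e e₁)
    ...     | ()
    S-irrefl {x} {y} e | true | inj₂ (e₁ , e₀) with trans (sym e₁) (trans e e₀)
    ...     | ()

    S-low : ∀ {x y} → S x y ≡ true → blob x ≢ 3F
    S-low {x} {y} s e with S-blobs x y s
    ... | inj₁ (e₀ , _) with trans (sym e₀) e
    ...   | ()
    S-low {x} {y} s e | inj₂ (e₁ , _) with trans (sym e₁) e
    ...   | ()

    -- The colour of an unflipped edge between distinct blobs determines their link.
    linked-of-κ : ∀ {x y c} → blob x ≢ blob y → S x y ≡ false → κ x y ≡ c → linked c (blob x) (blob y) ≡ true
    linked-of-κ {x} {y} {c} x≢y s refl with linked-cases (blob x) (blob y)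
    ... | inj₁ e       = ⊥-elim (x≢y e)
    ... | inj₂ (d , l) = subst (λ c → linked c (blob x) (blob y) ≡ true) (sym (cross x y d l s)) l

    fibre-size : ∀ j k → sum (λ z → on (does (blob z ≟ j)) k) ≡ a ! j * k
    fibre-size j k = trans (sum-cong λ z → on-1 (does (blob z ≟ j)) k)
      (trans (sum-*ʳ _ k) (cong (_* k) (size-a j)))

    others : ∀ y → sum (λ z → on (does (blob z ≟ blob y)) (on (not (does (z ≟ y))) 1)) ≡ a ! blob y ∸ 1
    others y = trans (fibre-remove blob y (blob y))
      (cong₂ _∸_ (size-a (blob y)) (cong (λ s → on s 1) (dec-true (blob y ≟ blob y) refl)))

    -- It serves twice: as the full load on an inner edge and as the contribution of that edge to
    -- the total weight.
    inner-sum : ∀ c i → sum (λ z → on (linked c i (blob z)) (on (not (ex i z)) (p i (blob z)))) ≡ D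
    inner-sum c i = begin
      sum (λ z → on (linked c i (blob z)) (on (not (ex i z)) (p i (blob z))))
        ≡⟨ sum-cong (λ z → trans (on-swap (linked c i (blob z)) (not (ex i z)) (p i (blob z))) (on-1 (not (ex i z)) (on (linked c i (blob z)) (p i (blob z))))) ⟩
      sum (λ z → on (not (ex i z)) 1 * on (linked c i (blob z)) (p i (blob z)))
        ≡⟨ sum-fibres blob _ (λ j → on (linked c i j) (p i j)) ⟩
      sum (λ j → sum (λ z → on (does (blob z ≟ j)) (on (not (ex i z)) 1)) * on (linked c i j) (p i j))
        ≡⟨ sum-cong (λ j → trans (cong (_* on (linked c i j) (p i j)) (trans (ex-count i j) (cong (_∸ defect ε i j) (size-a j))))
             (*-on (linked c i j) (a ! j ∸ defect ε i j) (p i j))) ⟩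
      sum (λ j → on (linked c i j) ((a ! j ∸ defect ε i j) * p i j))
        ≡⟨ sum₅ _ ⟩
      ∑₅ (λ j → on (linked c i j) ((a ! j ∸ defect ε i j) * p i j))
        ≡⟨ spent c i ⟩
      D ∎
      where open ≡-Reasoning

    apexV≤ : ∀ c X Y Z → apexV c X Y Z ≤ wV X Y Z
    apexV≤ c X Y Z = on-≤ (adjV c X Y ∧ adjV c Y Z ∧ adjV c X Z) _

  u-load : ∀ c y → sum (λ z → apexV c (just y) (just z) nothing) ≤ D
  u-load c y = begin
    sum (λ z → apexV c (just y) (just z) nothing)
      ≤⟨ sum-mono bound ⟩
    sum (λ z → on (same c (q z)) 1 * on (linked c (blob y) (blob z)) (μ (blob y) (blob z)))
      ≡⟨ sum-fibres blob _ (λ j → on (linked c (blob y) j) (μ (blob y) j)) ⟩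
    sum (λ j → sum (λ z → on (does (blob z ≟ j)) (on (same c (q z)) 1)) * on (linked c (blob y) j) (μ (blob y) j))
      ≡⟨ sum-cong (λ j → trans (cong (_* on (linked c (blob y) j) (μ (blob y) j)) (size-rb c j)) (*-on (linked c (blob y) j) (classSize r b c j) (μ (blob y) j))) ⟩
    sum (λ j → on (linked c (blob y) j) (classSize r b c j * μ (blob y) j))
      ≡⟨ sum₅ _ ⟩
    ∑₅ (λ j → on (linked c (blob y) j) (classSize r b c j * μ (blob y) j))
      ≤⟨ degree c (blob y) ⟩
    D ∎
    where
    open ℕ.≤-Reasoning
    bound : ∀ z → apexV c (just y) (just z) nothing ≤
            on (same c (q z)) 1 * on (linked c (blob y) (blob z)) (μ (blob y) (blob z))
    bound z = on-≤-if (adjV c (just y) (just z) ∧ same c (q z) ∧ same c (q y)) λ h →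
      let (yz , h′) = ∧-true h
          (zc , _)  = ∧-true h′
      in go (S y z) refl zc (proj₂ (adj⇒κ yz))
      where
      go : ∀ s → S y z ≡ s → same c (q z) ≡ true → κ y z ≡ c →
           on (not s) (μ (blob y) (blob z)) ≤ on (same c (q z)) 1 * on (linked c (blob y) (blob z)) (μ (blob y) (blob z))
      go true  s zc k = z≤n
      go false s zc k with blob y ≟ blob z
      ... | yes e rewrite e | μ-diag (blob z) = z≤n
      ... | no y≢z rewrite zc | linked-of-κ y≢z s k = ℕ.≤-reflexive (sym (ℕ.+-identityʳ _))

  private
    low : Fin 5 → Bool
    low 0F = true
    low 1F = true
    low _  = false

    -- Bounds the load of the triangles with the flipped edge at a vertex of blob j
    -- on an edge between blobs i and j.
    apexLoad : Fin 5 → Fin 5 → ℕ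
    apexLoad j i = on (low j) (on (does (i ≟ 3F)) t)

    -- Only blob 3 paired with blob 0 or 1 carries such a load, and then only one of the two
    -- summands, because `low 3F` is false.
    apexLoads : ∀ i j → i ≢ j → apexLoad j i + apexLoad i j ≤ defectLoad t i j
    apexLoads 0F 0F h = z≤n
    apexLoads 0F 1F h = z≤n
    apexLoads 0F 2F h = z≤n
    apexLoads 0F 3F h = ℕ.≤-refl
    apexLoads 0F 4F h = z≤n
    apexLoads 1F 0F h = z≤n
    apexLoads 1F 1F h = z≤n
    apexLoads 1F 2F h = z≤n
    apexLoads 1F 3F h = ℕ.≤-refl
    apexLoads 1F 4F h = z≤n
    apexLoads 2F 0F h = z≤n
    apexLoads 2F 1F h = z≤n
    apexLoads 2F 2F h = z≤n
    apexLoads 2F 3F h = z≤n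
    apexLoads 2F 4F h = z≤n
    apexLoads 3F 0F h = ℕ.≤-reflexive (ℕ.+-identityʳ t)
    apexLoads 3F 1F h = ℕ.≤-reflexive (ℕ.+-identityʳ t)
    apexLoads 3F 2F h = z≤n
    apexLoads 3F 3F h = z≤n
    apexLoads 3F 4F h = z≤n
    apexLoads 4F 0F h = z≤n
    apexLoads 4F 1F h = z≤n
    apexLoads 4F 2F h = z≤n
    apexLoads 4F 3F h = z≤n
    apexLoads 4F 4F h = z≤n

    sum≤0 : ∀ {n} {f : Fin n → ℕ} → (∀ z → f z ≤ 0) → sum f ≤ 0
    sum≤0 h = ℕ.≤-reflexive (sum-0 λ z → ℕ.n≤0⇒n≡0 (h z))

    S-low′ : ∀ {x y} → S x y ≡ true → low (blob x) ≡ true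
    S-low′ {x} {y} s with S-blobs x y s
    ... | inj₁ (e , _) rewrite e = refl
    ... | inj₂ (e , _) rewrite e = refl

    -- The load on an edge xy between two blobs of the triangles charged to their edge yz.
    side-load : ∀ c x y → blob x ≢ blob y →
      sum (λ z → apexV c (just y) (just z) (just x)) ≤ (a ! blob y ∸ 1) * p (blob y) (blob x) + apexLoad (blob y) (blob x)
    side-load c x y x≢y = begin
      sum (λ z → apexV c (just y) (just z) (just x))
        ≤⟨ sum-mono bound ⟩
      sum (λ z → on (does (blob z ≟ blob y)) (on (not (does (z ≟ y))) 1) * p (blob y) (blob x) + on (S y z) 1 * apexLoad (blob y) (blob x))
        ≡⟨ trans (sum-+ _ _) (cong₂ _+_ (trans (sum-*ʳ _ _) (cong (_* p (blob y) (blob x)) (others y))) (sum-*ʳ _ _)) ⟩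
      (a ! blob y ∸ 1) * p (blob y) (blob x) + sum (λ z → on (S y z) 1) * apexLoad (blob y) (blob x)
        ≤⟨ ℕ.+-monoʳ-≤ ((a ! blob y ∸ 1) * p (blob y) (blob x)) (ℕ.≤-trans (ℕ.*-monoˡ-≤ (apexLoad (blob y) (blob x)) (S-unique y)) (ℕ.≤-reflexive (ℕ.+-identityʳ _))) ⟩
      (a ! blob y ∸ 1) * p (blob y) (blob x) + apexLoad (blob y) (blob x) ∎
      where
      open ℕ.≤-Reasoning
      bound : ∀ z → apexV c (just y) (just z) (just x) ≤
        on (does (blob z ≟ blob y)) (on (not (does (z ≟ y))) 1) * p (blob y) (blob x) + on (S y z) 1 * apexLoad (blob y) (blob x)
      bound z = on-≤-if (adjV c (just y) (just z) ∧ adjV c (just z) (just x) ∧ adjV c (just y) (just x)) λ h →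
        ℕ.+-mono-≤ (inner (proj₁ (adj⇒κ {c} (proj₁ (∧-true h))))) (flipped (S y z) refl)
        where
        inner : y ≢ z → on (does (blob y ≟ blob z)) (on (not (ex (blob y) x)) (p (blob y) (blob x))) ≤
                on (does (blob z ≟ blob y)) (on (not (does (z ≟ y))) 1) * p (blob y) (blob x)
        inner y≢z = on-dec-≤ (blob y ≟ blob z) λ e → ℕ.≤-trans (on-≤ (not (ex (blob y) x)) _) (ℕ.≤-reflexive (sym
          (trans (cong (_* p (blob y) (blob x)) (cong₂ on (dec-true (blob z ≟ blob y) (sym e)) (cong (λ s → on (not s) 1) (dec-false (z ≟ y) (y≢z ∘ sym)))))
                 (ℕ.+-identityʳ _))))
        flipped : ∀ s → S y z ≡ s → on s (on (does (blob x ≟ 3F)) t) ≤ on s 1 * apexLoad (blob y) (blob x)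
        flipped false _ = z≤n
        flipped true  s = ℕ.≤-reflexive (sym (trans (ℕ.+-identityʳ _) (cong (λ l → on l _) (S-low′ s))))

    -- An inner edge or the flipped edge occurs only as a base. Inner bases never use an apex in
    -- their own blob (`p-diag`) nor one at the flipped edge (`ex`), and apices over the flipped
    -- edge lie in blob 3, away from the blobs of its ends.
    no-side-load : ∀ c x y → (blob x ≡ blob y ⊎ S x y ≡ true) → ∀ z → apexV c (just y) (just z) (just x) ≤ 0
    no-side-load c x y h z = on-≤-if (adjV c (just y) (just z) ∧ adjV c (just z) (just x) ∧ adjV c (just y) (just x)) λ _ →
      ℕ.≤-reflexive (cong₂ _+_ (inner h) (flipped h (S y z) refl))
      where
      inner : (blob x ≡ blob y ⊎ S x y ≡ true) →
        on (does (blob y ≟ blob z)) (on (not (ex (blob y) x)) (p (blob y) (blob x))) ≡ 0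
      inner (inj₁ e) rewrite e | p-diag (blob y) | on-0 (not (ex (blob y) x)) = on-0 (does (blob y ≟ blob z))
      inner (inj₂ s) rewrite S-ex y x (trans (S-sym y x) s) = on-0 (does (blob y ≟ blob z))
      flipped : (blob x ≡ blob y ⊎ S x y ≡ true) → ∀ s → S y z ≡ s → on s (on (does (blob x ≟ 3F)) t) ≡ 0
      flipped h false _ = refl
      flipped (inj₁ e) true s = cong (λ d → on d t) (dec-false (blob x ≟ 3F) λ e′ → S-low s (trans (sym e) e′))
      flipped (inj₂ s′) true s = cong (λ d → on d t) (dec-false (blob x ≟ 3F) (S-low s′))

    leading-inner : ∀ c x y → S x y ≡ false → κ x y ≡ c → ∀ z →
      apexV c (just x) (just y) (just z) ≤ on (linked c (blob x) (blob z)) (on (not (ex (blob x) z)) (p (blob x) (blob z)))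
    leading-inner c x y s k z = on-≤-if (adjV c (just x) (just y) ∧ adjV c (just y) (just z) ∧ adjV c (just x) (just z)) λ h →
      bound (proj₂ (adj⇒κ {c} (proj₂ (∧-true {adjV c (just y) (just z)} (proj₂ (∧-true {adjV c (just x) (just y)} h))))))
      where
      excl : ∀ s′ → S x z ≡ s′ → κ x z ≡ c → on (not (ex (blob x) z)) (p (blob x) (blob z)) ≤
             on (linked c (blob x) (blob z)) (on (not (ex (blob x) z)) (p (blob x) (blob z)))
      excl true  s′ xz rewrite S-ex x z s′ = z≤n
      excl false s′ xz with blob x ≟ blob z
      ... | yes e rewrite sym e | p-diag (blob x) | on-0 (not (ex (blob x) z)) = z≤n
      ... | no x≢z rewrite linked-of-κ x≢z s′ xz = ℕ.≤-refl
      bound : κ x z ≡ c → wV (just x) (just y) (just z) ≤ on (linked c (blob x) (blob z)) (on (not (ex (blob x) z)) (p (blob x) (blob z)))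
      bound xz rewrite s = ℕ.≤-trans (ℕ.≤-reflexive (ℕ.+-identityʳ _)) (ℕ.≤-trans (on-≤ (does (blob x ≟ blob y)) _) (excl (S x z) refl xz))

    leading-cross : ∀ c x y → blob x ≢ blob y → S x y ≡ false → ∀ z → apexV c (just x) (just y) (just z) ≤ 0
    leading-cross c x y x≢y s z = ℕ.≤-trans (apexV≤ c (just x) (just y) (just z)) (ℕ.≤-reflexive eq)
      where
      eq : wV (just x) (just y) (just z) ≡ 0
      eq rewrite s | dec-false (blob x ≟ blob y) x≢y = refl

    leading-flipped : ∀ c x y → S x y ≡ true → ∀ z → apexV c (just x) (just y) (just z) ≤ on (does (blob z ≟ 3F)) t
    leading-flipped c x y s z = ℕ.≤-trans (apexV≤ c (just x) (just y) (just z)) (ℕ.≤-reflexive eq)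
      where
      x≢y : blob x ≢ blob y
      x≢y e with trans (sym (S-irrefl e)) s
      ... | ()
      eq : wV (just x) (just y) (just z) ≡ on (does (blob z ≟ 3F)) t
      eq rewrite s | dec-false (blob x ≟ blob y) x≢y = refl

    -- The equation `ε * ε ≡ ε` restricts ε to 0 and 1.
    a₃t≤D : ∀ {x y} → S x y ≡ true → a ! 3F * t ≤ D
    a₃t≤D {x} {y} s = ℕ.≤-trans (ℕ.≤-reflexive t-spent) (ε-small ε ε²)
      where
      ε-small : ∀ ε → ε * ε ≡ ε → ε * D ≤ D
      ε-small zero          _ = z≤n
      ε-small (suc zero)    _ = ℕ.≤-refl
      ε-small (suc (suc k)) h = ⊥-elim (ℕ.m+1+n≢m (suc (suc k)) h)

  loadV : Colour → V → V → V → ℕ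
  loadV c X Y Z = apexV c X Y Z + (apexV c Y Z X + apexV c X Z Y)

  private
    zeroLead : ∀ c Y Z → apexV c nothing Y Z ≡ 0
    zeroLead c Y Z = on-0 (adjV c nothing Y ∧ adjV c Y Z ∧ adjV c nothing Z)

    zeroLead′ : ∀ c y Z → apexV c (just y) nothing Z ≡ 0
    zeroLead′ c y Z = on-0 (adjV c (just y) nothing ∧ adjV c nothing Z ∧ adjV c (just y) Z)

    adjV-sym : ∀ c X Y → adjV c X Y ≡ adjV c Y X
    adjV-sym c nothing  nothing  = refl
    adjV-sym c nothing  (just y) = refl
    adjV-sym c (just x) nothing  = refl
    adjV-sym c (just x) (just y) = cong₂ (λ d k → not d ∧ same c k) (≟-sym x y) (κ-sym x y)

    apexV-sym : ∀ c X Y Z → apexV c X Y Z ≡ apexV c Y X Z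
    apexV-sym c X Y Z = cong₂ on (cong₂ _∧_ (adjV-sym c X Y) (Bool.∧-comm (adjV c Y Z) _)) (wV-sym X Y Z)

    loadV-sym : ∀ c X Y Z → loadV c X Y Z ≡ loadV c Y X Z
    loadV-sym c X Y Z = cong₂ _+_ (apexV-sym c X Y Z) (ℕ.+-comm (apexV c Y Z X) (apexV c X Z Y))

    load-u : ∀ c y → ΣV (loadV c nothing (just y)) ≤ D
    load-u c y = ℕ.≤-trans (ℕ.≤-reflexive (cong₂ _+_ zero-u (sum-cong only))) (u-load c y)
      where
      zero-u : loadV c nothing (just y) nothing ≡ 0
      zero-u = cong₂ _+_ (zeroLead c (just y) nothing) (cong₂ _+_ (zeroLead′ c y nothing) (zeroLead c nothing (just y)))
      only : ∀ z → loadV c nothing (just y) (just z) ≡ apexV c (just y) (just z) nothing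
      only z = trans (cong₂ _+_ (zeroLead c (just y) (just z)) (cong₂ _+_ refl (zeroLead c (just z) (just y)))) (ℕ.+-identityʳ _)

    -- There are three kinds of edges. The flipped edge carries just its own apices in blob 3, an
    -- inner edge just its own plan, which amounts to `D`. An edge between blobs is a base only for
    -- the apex `u`, with weight `μ`; the side loads from both of its blobs come on top, and `room`
    -- was made for this sum.
    load-H : ∀ c x y → adjV c (just x) (just y) ≡ true → ΣV (loadV c (just x) (just y)) ≤ D
    load-H c x y xy = begin
      ΣV (loadV c (just x) (just y))
        ≡⟨ cong₂ _+_ (trans (cong₂ _+_ {x = U} refl (cong₂ _+_ (zeroLead′ c y (just x)) (zeroLead′ c x (just y)))) (ℕ.+-identityʳ U))
             (trans (sum-+ b′ (λ z → y′ z + x′ z)) (cong₂ _+_ {x = B} refl (sum-+ y′ x′))) ⟩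
      apexV c (just x) (just y) nothing + (B + (Y + X))
        ≤⟨ cases (S x y) refl ⟩
      D ∎
      where
      open ℕ.≤-Reasoning
      b′ y′ x′ : Fin m → ℕ
      b′ z = apexV c (just x) (just y) (just z)
      y′ z = apexV c (just y) (just z) (just x)
      x′ z = apexV c (just x) (just z) (just y)
      U B Y X : ℕ
      U = apexV c (just x) (just y) nothing
      B = sum b′
      Y = sum y′
      X = sum x′
      κ≡c = proj₂ (adj⇒κ {c} {x} {y} xy)
      u≤ : apexV c (just x) (just y) nothing ≤ on (not (S x y)) (μ (blob x) (blob y))
      u≤ = apexV≤ c (just x) (just y) nothing
      cases : ∀ s → S x y ≡ s → apexV c (just x) (just y) nothing + (B + (Y + X)) ≤ D
      cases true s = begin
        apexV c (just x) (just y) nothing + (B + (Y + X))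
          ≤⟨ ℕ.+-mono-≤ (ℕ.≤-trans u≤ (ℕ.≤-reflexive (cong (λ s → on (not s) (μ (blob x) (blob y))) s)))
              (ℕ.+-mono-≤ (ℕ.≤-trans (sum-mono (leading-flipped c x y s)) (ℕ.≤-reflexive (fibre-size 3F t)))
              (ℕ.+-mono-≤ (sum≤0 (no-side-load c x y (inj₂ s)))
                          (sum≤0 (no-side-load c y x (inj₂ (trans (S-sym y x) s)))))) ⟩
        a ! 3F * t + 0 ≡⟨ ℕ.+-identityʳ _ ⟩
        a ! 3F * t ≤⟨ a₃t≤D s ⟩
        D ∎
      cases false s = unflipped s (blob x ≟ blob y)
        where
        unflipped : S x y ≡ false → Dec (blob x ≡ blob y) → apexV c (just x) (just y) nothing + (B + (Y + X)) ≤ D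
        unflipped s (yes e) = begin
          apexV c (just x) (just y) nothing + (B + (Y + X))
            ≤⟨ ℕ.+-mono-≤ (ℕ.≤-trans u≤ (ℕ.≤-trans (on-≤ (not (S x y)) _) (ℕ.≤-reflexive (trans (cong (λ i → μ i (blob y)) e) (μ-diag (blob y))))))
                (ℕ.+-mono-≤ (ℕ.≤-trans (sum-mono (leading-inner c x y s κ≡c)) (ℕ.≤-reflexive (inner-sum c (blob x))))
                (ℕ.+-mono-≤ (sum≤0 (no-side-load c x y (inj₁ e)))
                            (sum≤0 (no-side-load c y x (inj₁ (sym e)))))) ⟩
          D + 0 ≡⟨ ℕ.+-identityʳ D ⟩
          D ∎
        unflipped s (no x≢y) = begin
          apexV c (just x) (just y) nothing + (B + (Y + X))
            ≤⟨ ℕ.+-mono-≤ (ℕ.≤-trans u≤ (on-≤ (not (S x y)) _))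
                (ℕ.+-mono-≤ (sum≤0 (leading-cross c x y x≢y s))
                (ℕ.+-mono-≤ (side-load c x y x≢y) (side-load c y x (x≢y ∘ sym)))) ⟩
          μ i j + (pj + apexLoad j i + (pi + apexLoad i j))
            ≡⟨ cong (λ s → μ i j + s) (solve 4 (λ a b c d → (a :+ b) :+ (c :+ d) := c :+ (a :+ (b :+ d))) refl pj (apexLoad j i) pi (apexLoad i j)) ⟩
          μ i j + (pi + (pj + (apexLoad j i + apexLoad i j)))
            ≤⟨ ℕ.+-monoʳ-≤ (μ i j) (ℕ.+-monoʳ-≤ pi (ℕ.+-monoʳ-≤ pj (apexLoads i j x≢y))) ⟩
          μ i j + (pi + (pj + defectLoad t i j))
            ≤⟨ room i j ⟩
          D ∎
          where
          open +-*-Solver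
          i j : Fin 5
          i = blob x
          j = blob y
          pi pj : ℕ
          pi = (a ! i ∸ 1) * p i j
          pj = (a ! j ∸ 1) * p j i

  loadV≤D : ∀ c X Y → adjV c X Y ≡ true → ΣV (loadV c X Y) ≤ D
  loadV≤D c nothing  (just y) _ = load-u c y
  loadV≤D c (just x) nothing  _ = ℕ.≤-trans
    (ℕ.≤-reflexive (cong₂ _+_ (loadV-sym c (just x) nothing nothing) (sum-cong (loadV-sym c (just x) nothing ∘ just)))) (load-u c x)
  loadV≤D c (just x) (just y) h = load-H c x y h

  -- A lower bound for the total weight

  totalV : Colour → ℕ
  totalV c = ΣV λ X → ΣV λ Y → ΣV λ Z → apexV c X Y Z

  private
    cross-part : ∀ c x y →
      on (same c (q x)) (on (same c (q y)) (on (not (S x y)) 1)) * on (linked c (blob x) (blob y)) (μ (blob x) (blob y))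
        ≤ apexV c (just x) (just y) nothing
    cross-part c x y with same c (q x) in qx | same c (q y) in qy | S x y in s | linked c (blob x) (blob y) in l
    ... | false | _     | _     | _     = z≤n
    ... | true  | false | _     | _     = z≤n
    ... | true  | true  | true  | _     = z≤n
    ... | true  | true  | false | false = z≤n
    ... | true  | true  | false | true  = ℕ.≤-reflexive (trans (ℕ.+-identityʳ _) (sym
        (cong (λ d → on (d ∧ true) (μ (blob x) (blob y))) (κ⇒adj {c} x≢y (cross x y c l s)))))
      where
      x≢y : x ≢ y
      x≢y refl with trans (sym (linked-diag c (blob x))) l
      ... | ()

    -- Among all pairs of `c`-coloured neighbours of `u` in the two blobs, at most `defect ε i j`
    -- are joined by the flipped edge; the rest can carry a triangle through `u`.
    pair-count : ∀ c i j → classSize r b c i * classSize r b c j ∸ defect ε i j ≤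
      sum (λ x → on (does (blob x ≟ i)) (sum λ y → on (does (blob y ≟ j))
        (on (same c (q x)) (on (same c (q y)) (on (not (S x y)) 1)))))
    pair-count c i j = ℕ.m≤n+o⇒m∸n≤o (classSize r b c i * classSize r b c j) (defect ε i j) (begin
      classSize r b c i * classSize r b c j
        ≡⟨ cong₂ _*_ (sym (size-rb c i)) (sym (size-rb c j)) ⟩
      sum (λ x → on (does (blob x ≟ i)) (on (same c (q x)) 1)) * N
        ≡⟨ sym (sum-*ʳ _ N) ⟩
      sum (λ x → on (does (blob x ≟ i)) (on (same c (q x)) 1) * N)
        ≡⟨ sum-cong (λ x → trans (sym (on-* (does (blob x ≟ i)) (on (same c (q x)) 1) N))
             (cong (on (does (blob x ≟ i))) (trans (sym (on-1 (same c (q x)) N)) (sym (sum-on (same c (q x)) _))))) ⟩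
      sum (λ x → on (does (blob x ≟ i)) (sum λ y → on (same c (q x)) (on (does (blob y ≟ j)) (on (same c (q y)) 1))))
        ≤⟨ sum-mono (λ x → on-mono (does (blob x ≟ i)) (sum-mono λ y →
             split (same c (q x)) (does (blob y ≟ j)) (same c (q y)) (S x y))) ⟩
      sum (λ x → on (does (blob x ≟ i)) (sum λ y → flips x y + free x y))
        ≡⟨ trans (sum-cong (λ x → trans (cong (on (does (blob x ≟ i))) (sum-+ (flips x) (free x))) (on-+ (does (blob x ≟ i)) _ _)))
                 (sum-+ (λ x → on (does (blob x ≟ i)) (sum (flips x))) (λ x → on (does (blob x ≟ i)) (sum (free x)))) ⟩
      sum (λ x → on (does (blob x ≟ i)) (sum (flips x))) + Free
        ≤⟨ ℕ.+-monoˡ-≤ Free (S-defect i j) ⟩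
      defect ε i j + Free ∎)
      where
      open ℕ.≤-Reasoning
      N : ℕ
      N = sum λ y → on (does (blob y ≟ j)) (on (same c (q y)) 1)
      flips free : Fin m → Fin m → ℕ
      flips x y = on (does (blob y ≟ j)) (on (S x y) 1)
      free  x y = on (does (blob y ≟ j)) (on (same c (q x)) (on (same c (q y)) (on (not (S x y)) 1)))
      Free : ℕ
      Free = sum λ x → on (does (blob x ≟ i)) (sum (free x))
      split : ∀ sx d sy s → on sx (on d (on sy 1)) ≤ on d (on s 1) + on d (on sx (on sy (on (not s) 1)))
      split false d     sy    s     = z≤n
      split true  false sy    s     = z≤n
      split true  true  false s     = z≤n
      split true  true  true  true  = ℕ.≤-refl
      split true  true  true  false = ℕ.≤-refl

    crossGain≤ : ∀ c → crossGain c ≤ sum λ x → sum λ y → apexV c (just x) (just y) nothing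
    crossGain≤ c = begin
      crossGain c
        ≡⟨ sym (trans (sum-cong λ i → sum₅ _) (sum₅ _)) ⟩
      sum (λ i → sum λ j → on (linked c i j) ((classSize r b c i * classSize r b c j ∸ defect ε i j) * μ i j))
        ≤⟨ sum-mono (λ i → sum-mono λ j → ℕ.≤-trans (on-mono (linked c i j) (ℕ.*-monoˡ-≤ (μ i j) (pair-count c i j)))
             (ℕ.≤-reflexive (sym (*-on (linked c i j) (sum λ x → on (does (blob x ≟ i)) (K j x)) (μ i j))))) ⟩
      sum (λ i → sum λ j → sum (λ x → on (does (blob x ≟ i)) (K j x)) * g i j)
        ≡⟨ sum-comm _ ⟩
      sum (λ j → sum λ i → sum (λ x → on (does (blob x ≟ i)) (K j x)) * g i j)
        ≡⟨ sum-cong (λ j → sym (sum-fibres blob (K j) (λ i → g i j))) ⟩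
      sum (λ j → sum λ x → K j x * g (blob x) j)
        ≡⟨ sum-comm _ ⟩
      sum (λ x → sum λ j → K j x * g (blob x) j)
        ≡⟨ sum-cong (λ x → sym (sum-fibres blob (k x) (g (blob x)))) ⟩
      sum (λ x → sum λ y → k x y * g (blob x) (blob y))
        ≤⟨ sum-mono (λ x → sum-mono (cross-part c x)) ⟩
      sum (λ x → sum λ y → apexV c (just x) (just y) nothing) ∎
      where
      open ℕ.≤-Reasoning
      k : Fin m → Fin m → ℕ
      k x y = on (same c (q x)) (on (same c (q y)) (on (not (S x y)) 1))
      K : Fin 5 → Fin m → ℕ
      K j x = sum λ y → on (does (blob y ≟ j)) (k x y)
      g : Fin 5 → Fin 5 → ℕ
      g i j = on (linked c i j) (μ i j)

    inH : Colour → Fin m → Fin m → ℕ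
    inH c x y = sum λ z → apexV c (just x) (just y) (just z)

    inH≤ : ∀ c x y → inH c x y ≤ inH red x y + inH blue x y
    inH≤ red  x y = ℕ.m≤m+n _ _
    inH≤ blue x y = ℕ.m≤n+m _ (inH red x y)

    inner-part : ∀ x y → x ≢ y → blob x ≡ blob y → D ≤ inH (κ x y) x y
    inner-part x y x≢y e = ℕ.≤-trans (ℕ.≤-reflexive (sym (inner-sum c (blob x)))) (sum-mono bound)
      where
      c = κ x y
      bound : ∀ z → on (linked c (blob x) (blob z)) (on (not (ex (blob x) z)) (p (blob x) (blob z))) ≤ apexV c (just x) (just y) (just z)
      bound z = go (linked c (blob x) (blob z)) refl (ex (blob x) z) refl
        where
        go : ∀ s → linked c (blob x) (blob z) ≡ s → ∀ s′ → ex (blob x) z ≡ s′ →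
             on s (on (not s′) (p (blob x) (blob z))) ≤ apexV c (just x) (just y) (just z)
        go false _ _     _ = z≤n
        go true  _ true  _ = z≤n
        go true  l false h = ℕ.≤-reflexive (sym (cong₂ on adjs value))
          where
          -- If `w z` were flipped, `S-ex` would make `z` an excluded apex for this blob, against
          -- `h`.
          unflipped : ∀ w → blob w ≡ blob x → S w z ≡ false
          unflipped w e′ with S w z in s
          ... | false = refl
          ... | true with trans (sym (S-ex w z s)) (trans (cong (λ i → ex i z) e′) h)
          ...   | ()
          w≢z : ∀ w → blob w ≡ blob x → w ≢ z
          w≢z w e′ refl with trans (sym (linked-diag c (blob w))) (trans (cong (λ i → linked c i (blob w)) e′) l)
          ... | ()
          adj : ∀ w → blob w ≡ blob x → adjV c (just w) (just z) ≡ true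
          adj w e′ = κ⇒adj {c} (w≢z w e′) (cross w z c (trans (cong (λ i → linked c i (blob z)) e′) l) (unflipped w e′))
          adjs : adjV c (just x) (just y) ∧ adjV c (just y) (just z) ∧ adjV c (just x) (just z) ≡ true
          adjs = cong₂ _∧_ (κ⇒adj {c} x≢y refl) (cong₂ _∧_ (adj y (sym e)) (adj x refl))
          value : wV (just x) (just y) (just z) ≡ p (blob x) (blob z)
          value rewrite dec-true (blob x ≟ blob y) e | h | S-irrefl {x} {y} e = ℕ.+-identityʳ _

    flipped-part : ∀ x y → S x y ≡ true → a ! 3F * t ≤ inH blue x y
    flipped-part x y s = ℕ.≤-trans (ℕ.≤-reflexive (sym (fibre-size 3F t))) (sum-mono λ z → on-dec-≤ (blob z ≟ 3F) (bound z))
      where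
      low-blue : ∀ {i} → low i ≡ true → linked blue i 3F ≡ true
      low-blue {0F} _ = refl
      low-blue {1F} _ = refl
      adj : ∀ w z → low (blob w) ≡ true → blob z ≡ 3F → adjV blue (just w) (just z) ≡ true
      adj w z l e = κ⇒adj {blue} w≢z (cross w z blue (trans (cong (linked blue (blob w)) e) (low-blue l)) unflipped)
        where
        w≢z : w ≢ z
        w≢z refl with trans (sym l) (cong low e)
        ... | ()
        unflipped : S w z ≡ false
        unflipped with S w z in s′
        ... | false = refl
        ... | true  = ⊥-elim (S-low (trans (S-sym z w) s′) e)
      bound : ∀ z → blob z ≡ 3F → t ≤ apexV blue (just x) (just y) (just z)
      bound z e = ℕ.≤-reflexive (sym (trans (cong (λ d → on d (wV (just x) (just y) (just z))) adjs) value))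
        where
        x≢y : blob x ≢ blob y
        x≢y e with trans (sym (S-irrefl e)) s
        ... | ()
        adjs : adjV blue (just x) (just y) ∧ adjV blue (just y) (just z) ∧ adjV blue (just x) (just z) ≡ true
        adjs = cong₂ _∧_ (κ⇒adj {blue} (x≢y ∘ cong blob) (S-blue x y s))
          (cong₂ _∧_ (adj y z (S-low′ (trans (S-sym y x) s)) e) (adj x z (S-low′ s) e))
        value : wV (just x) (just y) (just z) ≡ t
        value rewrite dec-false (blob x ≟ blob y) x≢y | s | dec-true (blob z ≟ 3F) e = refl

    -- The flipped edge joins different blobs, so at most one of the two summands on the left is
    -- nonzero.
    H-part : ∀ x y → on (does (blob y ≟ blob x)) (on (not (does (y ≟ x))) 1) * D + on (S x y) 1 * (a ! 3F * t) ≤ inH red x y + inH blue x y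
    H-part x y = cases (S x y) refl
      where
      open ℕ.≤-Reasoning
      go : (d : Dec (blob y ≡ blob x)) (e : Dec (y ≡ x)) → on (does d) (on (not (does e)) 1) * D ≤ inH red x y + inH blue x y
      go (no _)  _       = z≤n
      go (yes _) (yes _) = z≤n
      go (yes e) (no y≢x) = ℕ.≤-trans (inner-part x y (y≢x ∘ sym) (sym e)) (inH≤ (κ x y) x y)
      cases : ∀ s → S x y ≡ s →
        on (does (blob y ≟ blob x)) (on (not (does (y ≟ x))) 1) * D + on s 1 * (a ! 3F * t) ≤ inH red x y + inH blue x y
      cases false s = ℕ.≤-trans (ℕ.≤-reflexive (ℕ.+-identityʳ _)) (go (blob y ≟ blob x) (y ≟ x))
      cases true  s = begin
        on (does (blob y ≟ blob x)) (on (not (does (y ≟ x))) 1) * D + (a ! 3F * t + 0)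
          ≡⟨ cong₂ _+_ (cong (λ d → on d (on (not (does (y ≟ x))) 1) * D) (dec-false (blob y ≟ blob x) y≢x)) (ℕ.+-identityʳ _) ⟩
        a ! 3F * t ≤⟨ flipped-part x y s ⟩
        inH blue x y ≤⟨ inH≤ blue x y ⟩
        inH red x y + inH blue x y ∎
        where
        y≢x : blob y ≢ blob x
        y≢x e with trans (sym (S-irrefl (sym e))) s
        ... | ()

    inner-total : sum (λ x → sum λ y → on (does (blob y ≟ blob x)) (on (not (does (y ≟ x))) 1) * D) ≡ pairs a * D
    inner-total = begin
      sum (λ x → sum λ y → on (does (blob y ≟ blob x)) (on (not (does (y ≟ x))) 1) * D)
        ≡⟨ sum-cong (λ x → trans (sum-*ʳ _ D) (cong (_* D) (trans (others x) (sym (ℕ.+-identityʳ _))))) ⟩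
      -- The factor 1 is the weight per vertex that `sum-fibres` collects into `size i`.
      sum (λ x → 1 * (a ! blob x ∸ 1) * D)
        ≡⟨ sum-*ʳ _ D ⟩
      sum (λ x → 1 * (a ! blob x ∸ 1)) * D
        ≡⟨ cong (_* D) (sum-fibres blob (λ _ → 1) (λ i → a ! i ∸ 1)) ⟩
      sum (λ i → size i * (a ! i ∸ 1)) * D
        ≡⟨ cong (_* D) (trans (sum-cong λ i → cong (_* (a ! i ∸ 1)) (size-a i)) (trans (sum₅ _) (pairs-∑₅ a))) ⟩
      pairs a * D ∎
      where
      open ≡-Reasoning
      pairs-∑₅ : ∀ a → ∑₅ (λ i → a ! i * (a ! i ∸ 1)) ≡ pairs a
      pairs-∑₅ (five _ _ _ _ _) = refl

    -- `S-total` sees the flipped edge in both orders and gives `2 * ε`, while `t-spent` brings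
    -- another ε; idempotence merges the two.
    flipped-total : sum (λ x → sum λ y → on (S x y) 1 * (a ! 3F * t)) ≡ 2 * (ε * D)
    flipped-total = begin
      sum (λ x → sum λ y → on (S x y) 1 * (a ! 3F * t))
        ≡⟨ trans (sum-cong λ x → sum-*ʳ _ (a ! 3F * t)) (sum-*ʳ _ (a ! 3F * t)) ⟩
      sum (λ x → sum λ y → on (S x y) 1) * (a ! 3F * t)
        ≡⟨ cong₂ _*_ S-total t-spent ⟩
      2 * ε * (ε * D)
        ≡⟨ trans (ℕ.*-assoc 2 ε (ε * D)) (cong (2 *_) (trans (sym (ℕ.*-assoc ε ε D)) (cong (_* D) ε²))) ⟩
      2 * (ε * D) ∎
      where open ≡-Reasoning

    H≤V : ∀ c → (sum λ x → sum λ y → apexV c (just x) (just y) nothing) + (sum λ x → sum λ y → inH c x y) ≤ totalV c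
    H≤V c = begin
      (sum λ x → sum λ y → apexV c (just x) (just y) nothing) + (sum λ x → sum λ y → inH c x y)
        ≡⟨ sym (trans (sum-cong λ x → sum-+ _ _) (sum-+ _ _)) ⟩
      sum (λ x → sum λ y → apexV c (just x) (just y) nothing + inH c x y)
        ≤⟨ sum-mono (λ x → ℕ.m≤n+m _ (ΣV λ Z → apexV c (just x) nothing Z)) ⟩
      sum (λ x → ΣV λ Y → ΣV λ Z → apexV c (just x) Y Z)
        ≤⟨ ℕ.m≤n+m _ (ΣV λ Y → ΣV λ Z → apexV c nothing Y Z) ⟩
      totalV c ∎
      where open ℕ.≤-Reasoning

  totalV-≥ : pairs a * D + 2 * (ε * D) + (crossGain red + crossGain blue) ≤ totalV red + totalV blue
  totalV-≥ = begin
    pairs a * D + 2 * (ε * D) + (crossGain red + crossGain blue)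
      ≡⟨ cong (λ s → s + (crossGain red + crossGain blue)) (sym (trans (trans (sum-cong λ x → sum-+ _ _) (sum-+ _ _)) (cong₂ _+_ inner-total flipped-total))) ⟩
    sum (λ x → sum λ y → on (does (blob y ≟ blob x)) (on (not (does (y ≟ x))) 1) * D + on (S x y) 1 * (a ! 3F * t)) + (crossGain red + crossGain blue)
      ≤⟨ ℕ.+-mono-≤ (sum-mono λ x → sum-mono λ y → H-part x y) (ℕ.+-mono-≤ (crossGain≤ red) (crossGain≤ blue)) ⟩
    sum (λ x → sum λ y → inH red x y + inH blue x y) + (U red + U blue)
      ≡⟨ cong (λ s → s + (U red + U blue)) (trans (sum-cong λ x → sum-+ (inH red x) (inH blue x)) (sum-+ (λ x → sum (inH red x)) (λ x → sum (inH blue x)))) ⟩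
    (I red + I blue) + (U red + U blue)
      ≡⟨ solve 4 (λ a b c d → (a :+ b) :+ (c :+ d) := (c :+ a) :+ (d :+ b)) refl (I red) (I blue) (U red) (U blue) ⟩
    (U red + I red) + (U blue + I blue)
      ≤⟨ ℕ.+-mono-≤ (H≤V red) (H≤V blue) ⟩
    totalV red + totalV blue ∎
    where
    open ℕ.≤-Reasoning
    open +-*-Solver
    U I : Colour → ℕ
    U c = sum λ x → sum λ y → apexV c (just x) (just y) nothing
    I c = sum λ x → sum λ y → inH c x y

-- Transfer of the weights to the colouring `G`

recolour : Bool → Colour → Colour
recolour false c = c
recolour true  c = opposite c

same-recolour : ∀ s c k → same c (recolour s k) ≡ does (k ≟ᶜ recolour s c)
same-recolour false red  red  = refl
same-recolour false red  blue = refl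
same-recolour false blue red  = refl
same-recolour false blue blue = refl
same-recolour true  red  red  = refl
same-recolour true  red  blue = refl
same-recolour true  blue red  = refl
same-recolour true  blue blue = refl

-- The vertex v of G as a vertex of G ∖ u, or nothing if v is u.
at : ∀ {m} (u v : Fin (suc m)) → Maybe (Fin m)
at u v with u ≟ v
... | yes _  = nothing
... | no u≢v = just (punchOut u≢v)

at-u : ∀ {m} (u : Fin (suc m)) → at u u ≡ nothing
at-u u with u ≟ u
... | yes _  = refl
... | no u≢u = ⊥-elim (u≢u refl)

at-punchIn : ∀ {m} (u : Fin (suc m)) x → at u (punchIn u x) ≡ just x
at-punchIn u x with u ≟ punchIn u x
... | yes e  = ⊥-elim (punchInᵢ≢i u x (sym e))
... | no u≢v = cong just (trans (Fin.punchOut-cong u refl) (punchOut-punchIn u))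

position : ∀ {m} (u v : Fin (suc m)) → v ≡ u ⊎ ∃[ x ] v ≡ punchIn u x
position u v with u ≟ v
... | yes e  = inj₁ (sym e)
... | no u≢v = inj₂ (punchOut u≢v , sym (punchIn-punchOut u≢v))

module _ {m : ℕ} (G : Colouring (suc m)) (u : Fin (suc m)) (s : Bool) (C : Configuration m)
  (κ≡ : ∀ x y → Configuration.κ C x y ≡ recolour s (colour G (punchIn u x) (punchIn u y)))
  (q≡ : ∀ x → Configuration.q C x ≡ recolour s (colour G u (punchIn u x)))
  (a r b : Five) (size-a : ∀ i → Configuration.size C i ≡ a ! i)
  (size-rb : ∀ c i → Configuration.colouredSize C c i ≡ classSize r b c i)
  (cert : Certificate a (Configuration.ε C) r b) where

  private
    open Configuration C
    open Certificate cert using (enough; crossGain)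
    open Weights C a r b size-a size-rb cert

    sum-at : (f : V → ℕ) → sum (f ∘ at u) ≡ ΣV f
    sum-at f = trans (sum-punchIn u (f ∘ at u)) (cong₂ _+_ (cong f (at-u u)) (sum-cong (cong f ∘ at-punchIn u)))

    F : Colour → Graph (suc m)
    F c = colourClass (recolour s c) G

    adj-at : ∀ c v w → does (adj? (F c) v w) ≡ adjV c (at u v) (at u w)
    adj-at c v w with position u v | position u w
    ... | inj₁ refl | inj₁ refl rewrite at-u u = cong (λ d → not d ∧ _) (dec-true (u ≟ u) refl)
    ... | inj₁ refl | inj₂ (y , refl) rewrite at-u u | at-punchIn u y | dec-false (u ≟ punchIn u y) (punchInᵢ≢i u y ∘ sym)
        = sym (trans (cong (same c) (q≡ y)) (same-recolour s c _))
    ... | inj₂ (x , refl) | inj₁ refl rewrite at-u u | at-punchIn u x | dec-false (punchIn u x ≟ u) (punchInᵢ≢i u x)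
        = sym (trans (cong (same c) (trans (q≡ x) (cong (recolour s) (colour-sym G u (punchIn u x))))) (same-recolour s c _))
    ... | inj₂ (x , refl) | inj₂ (y , refl) rewrite at-punchIn u x | at-punchIn u y = cong₂ (λ d k → not d ∧ k)
          (≟-punchIn (x ≟ y)) (sym (trans (cong (same c) (κ≡ x y)) (same-recolour s c _)))
      where
      ≟-punchIn : (d : Dec (x ≡ y)) → does (punchIn u x ≟ punchIn u y) ≡ does d
      ≟-punchIn (yes refl) = dec-true (punchIn u x ≟ punchIn u x) refl
      ≟-punchIn (no x≢y)   = dec-false (punchIn u x ≟ punchIn u y) (x≢y ∘ punchIn-injective u x y)

    w : Fin (suc m) → Fin (suc m) → Fin (suc m) → ℕ
    w x y z = wV (at u x) (at u y) (at u z)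

    w-sym : ∀ x y z → w x y z ≡ w y x z
    w-sym x y z = wV-sym (at u x) (at u y) (at u z)

    apexOn-at : ∀ c x y z → apexOn (F c) w w-sym x y z ≡ apexV c (at u x) (at u y) (at u z)
    apexOn-at c x y z = cong (λ d → on d (w x y z)) (cong₂ _∧_ (adj-at c x y) (cong₂ _∧_ (adj-at c y z) (adj-at c x z)))

    load≤D : ∀ c x y → Adj (F c) x y → sum (load (F c) w w-sym x y) ≤ D
    load≤D c x y xy = ℕ.≤-trans
      (ℕ.≤-reflexive (trans
        (sum-cong λ z → cong₂ _+_ (apexOn-at c x y z) (cong₂ _+_ (apexOn-at c y z x) (apexOn-at c x z y)))
        (sum-at (loadV c (at u x) (at u y)))))
      (loadV≤D c (at u x) (at u y) (trans (sym (adj-at c x y)) (dec-true (adj? (F c) x y) xy)))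

    total-at : ∀ c → (sum λ x → sum λ y → sum λ z → apexOn (F c) w w-sym x y z) ≡ totalV c
    total-at c = trans (sum-cong λ x → trans (sum-cong λ y → trans (sum-cong λ z → apexOn-at c x y z)
      (sum-at (λ Z → apexV c (at u x) (at u y) Z))) (sum-at (λ Y → ΣV λ Z → apexV c (at u x) Y Z)))
      (sum-at (λ X → ΣV λ Y → ΣV λ Z → apexV c X Y Z))

    lower : ∀ c → ∃[ W ] totalV c ≡ 2 * W × ((+ W) / D) ℚ.≤ ν* (F c)
    lower c = map₂ (λ (eq , le) → trans (sym (total-at c)) eq , le) (ν*-≥ (F c) w w-sym (load≤D c))

    -- The quantity `pack` treats the colours alike, so a packing found after swapping them counts
    -- for `G` as well.
    ν*-sum : ν* (F red) ℚ.+ ν* (F blue) ≡ ν* (colourClass red G) ℚ.+ ν* (colourClass blue G)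
    ν*-sum = go s
      where
      go : ∀ s → ν* (colourClass (recolour s red) G) ℚ.+ ν* (colourClass (recolour s blue) G) ≡ ν* (colourClass red G) ℚ.+ ν* (colourClass blue G)
      go false = refl
      go true  = ℚ.+-comm (ν* (colourClass blue G)) (ν* (colourClass red G))

    size-total : m ≡ total a
    size-total = begin
      m                         ≡⟨ sym (sum-1 m) ⟩
      sum {m} (λ x → 1 * 1)     ≡⟨ sum-fibres blob (λ _ → 1) (λ _ → 1) ⟩
      sum (λ i → size i * 1)    ≡⟨ sum-cong (λ i → trans (ℕ.*-identityʳ (size i)) (size-a i)) ⟩
      sum (a !_)                ≡⟨ trans (sum₅ _) (∑₅-total a) ⟩
      total a                   ∎
      where
      open ≡-Reasoning
      ∑₅-total : ∀ a → ∑₅ (a !_) ≡ total a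
      ∑₅-total (five _ _ _ _ _) = refl

  pack-large : pack G > (+ (suc m * m)) / 4
  pack-large = combine (lower red) (lower blue)
    where
    combine : (∃[ W ] totalV red ≡ 2 * W × ((+ W) / D) ℚ.≤ ν* (F red)) →
              (∃[ W ] totalV blue ≡ 2 * W × ((+ W) / D) ℚ.≤ ν* (F blue)) → pack G > (+ (suc m * m)) / 4
    combine (Wr , eqr , ler) (Wb , eqb , leb) = ℚ.<-≤-trans (/-< (suc m * m) (W + (W + W)) 3 719 bound) (begin
      (+ (W + (W + W))) / D
        ≡⟨ sym (trans (cong₂ ℚ._+_ {x = v} refl (/-+ W W 719)) (/-+ W (W + W) 719)) ⟩
      v ℚ.+ (v ℚ.+ v)
        ≡⟨ sym (solve 1 (λ v → con ((+ 3) / 1) :* v := v :+ (v :+ v)) refl v) ⟩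
      (+ 3) / 1 ℚ.* v
        ≤⟨ ℚ.*-monoˡ-≤-nonNeg ((+ 3) / 1) v≤ν ⟩
      pack G ∎)
      where
      open ℚ.≤-Reasoning
      open ℚSolver.+-*-Solver
      module N = +-*-Solver
      W : ℕ
      W = Wr + Wb
      v : ℚ
      v = (+ W) / D
      v≤ν : v ℚ.≤ ν* (colourClass red G) ℚ.+ ν* (colourClass blue G)
      v≤ν = subst₂ ℚ._≤_ (/-+ Wr Wb 719) ν*-sum (ℚ.+-mono-≤ ler leb)
      bound : suc m * m * D < (W + (W + W)) * 4
      -- Each `totalV` is twice a weight, so the factor 6 of `enough` turns into 12 · `W`: the 3
      -- from `pack` times the denominator 4.
      bound = ℕ.<-≤-trans (subst (λ k → suc k * k * D < _) (sym size-total) enough) (ℕ.≤-trans (ℕ.*-monoʳ-≤ 6 totalV-≥)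
        (ℕ.≤-reflexive (trans (cong (6 *_) (cong₂ _+_ eqr eqb))
          (N.solve 2 (λ x y → N.con 6 N.:* (N.con 2 N.:* x N.:+ N.con 2 N.:* y) N.:= ((x N.:+ y) N.:+ ((x N.:+ y) N.:+ (x N.:+ y))) N.:* N.con 4) refl Wr Wb))))

-- Soundness of the evaluated tests

∨-true : ∀ b {c} → b ∨ c ≡ true → b ≡ true ⊎ c ≡ true
∨-true true  _ = inj₁ refl
∨-true false h = inj₂ h

T-true : ∀ {b} → b ≡ true → T b
T-true refl = _

all-true : ∀ {A : Set} {f : A → Bool} {xs x} → all f xs ≡ true → x ∈ xs → f x ≡ true
all-true {xs = _ ∷ _} h (here refl) = proj₁ (∧-true h)
all-true {xs = _ ∷ _} h (there x∈)  = all-true (proj₂ (∧-true h)) x∈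

any-true : ∀ {A : Set} (f : A → Bool) xs → any f xs ≡ true → ∃[ x ] x ∈ xs × f x ≡ true
any-true f (x ∷ xs) h with ∨-true (f x) h
... | inj₁ fx = x , here refl , fx
... | inj₂ h′ with any-true f xs h′
...   | y , y∈ , fy = y , there y∈ , fy

∀₅-true : ∀ {f} → ∀₅ f ≡ true → ∀ i → f i ≡ true
∀₅-true h with ∧-true h
... | h₀ , h′ with ∧-true h′
...   | h₁ , h″ with ∧-true h″
...     | h₂ , h‴ with ∧-true h‴
...       | h₃ , h₄ = λ { 0F → h₀ ; 1F → h₁ ; 2F → h₂ ; 3F → h₃ ; 4F → h₄ }

∃₅-true : ∀ f → ∃₅ f ≡ true → ∃[ i ] f i ≡ true
∃₅-true f h with ∨-true (f 0F) h
... | inj₁ h₀ = 0F , h₀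
... | inj₂ h′ with ∨-true (f 1F) h′
...   | inj₁ h₁ = 1F , h₁
...   | inj₂ h″ with ∨-true (f 2F) h″
...     | inj₁ h₂ = 2F , h₂
...     | inj₂ h‴ with ∨-true (f 3F) h‴
...       | inj₁ h₃ = 3F , h₃
...       | inj₂ h₄ = 4F , h₄

∀≤-true : ∀ n {f} → ∀≤ n f ≡ true → ∀ {k} → k ≤ n → f k ≡ true
∀≤-true zero    h z≤n = h
∀≤-true (suc n) h k≤ with ℕ.m≤n⇒m<n∨m≡n k≤
... | inj₁ (s≤s k≤n) = ∀≤-true n (proj₂ (∧-true h)) k≤n
... | inj₂ refl      = proj₁ (∧-true h)

-- k bounds the weights μ per edge, r are the class sizes.
record Matching (k r μ : Five) : Set where
  field
    within : ∀ i → μ ! i ≤ k ! i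
    at₀ : r ! 1F * μ ! 0F + r ! 4F * μ ! 4F ≤ D
    at₁ : r ! 2F * μ ! 1F + r ! 0F * μ ! 0F ≤ D
    at₂ : r ! 3F * μ ! 2F + r ! 1F * μ ! 1F ≤ D
    at₃ : r ! 4F * μ ! 3F + r ! 2F * μ ! 2F ≤ D
    at₄ : r ! 0F * μ ! 4F + r ! 3F * μ ! 3F ≤ D

valid-sound : ∀ k r μ → valid k r μ ≡ true → Matching k r μ
valid-sound (five k₀ k₁ k₂ k₃ k₄) (five r₀ r₁ r₂ r₃ r₄) (five m₀ m₁ m₂ m₃ m₄) h
  with ∧-true {m₀ ≤ᵇ k₀} h
... | c₀ , h₁ with ∧-true {m₁ ≤ᵇ k₁} h₁
... | c₁ , h₂ with ∧-true {m₂ ≤ᵇ k₂} h₂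
... | c₂ , h₃ with ∧-true {m₃ ≤ᵇ k₃} h₃
... | c₃ , h₄ with ∧-true {m₄ ≤ᵇ k₄} h₄
... | c₄ , h₅ with ∧-true {r₁ * m₀ + r₄ * m₄ ≤ᵇ D} h₅
... | d₀ , h₆ with ∧-true {r₂ * m₁ + r₀ * m₀ ≤ᵇ D} h₆
... | d₁ , h₇ with ∧-true {r₃ * m₂ + r₁ * m₁ ≤ᵇ D} h₇
... | d₂ , h₈ with ∧-true {r₄ * m₃ + r₂ * m₂ ≤ᵇ D} h₈
... | d₃ , d₄ = record
  { within = λ { 0F → le m₀ k₀ c₀ ; 1F → le m₁ k₁ c₁ ; 2F → le m₂ k₂ c₂ ; 3F → le m₃ k₃ c₃ ; 4F → le m₄ k₄ c₄ }
  ; at₀ = le _ D d₀ ; at₁ = le _ D d₁ ; at₂ = le _ D d₂ ; at₃ = le _ D d₃ ; at₄ = le _ D d₄ }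
  where
  le : ∀ m n → (m ≤ᵇ n) ≡ true → m ≤ n
  le m n h = ℕ.≤ᵇ⇒≤ m n (T-true h)

zero-matching : ∀ k r → Matching k r (five 0 0 0 0 0)
zero-matching k r = record
  { within = λ { 0F → z≤n ; 1F → z≤n ; 2F → z≤n ; 3F → z≤n ; 4F → z≤n }
  ; at₀ = none (r ! 1F) (r ! 4F) ; at₁ = none (r ! 2F) (r ! 0F) ; at₂ = none (r ! 3F) (r ! 1F)
  ; at₃ = none (r ! 4F) (r ! 2F) ; at₄ = none (r ! 0F) (r ! 3F) }
  where
  none : ∀ m n → m * 0 + n * 0 ≤ D
  none m n rewrite ℕ.*-zeroʳ m | ℕ.*-zeroʳ n = z≤n

-- Nothing about the greedy choice has to be known: a result that fails `valid` was replaced by the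
-- zero matching.
matching-sound : ∀ k r s → Matching k r (matching k r s)
matching-sound k r s with valid k r (rotate (5 ∸ s) (greedy (rotate s k) (rotate s r))) in v
... | true  = valid-sound k r _ v
... | false = zero-matching k r

matchings-sound : ∀ k r {μ} → μ ∈ matchings k r → Matching k r μ
matchings-sound k r μ∈ with ∈-map⁻ (matching k r) {xs = 0 ∷ 1 ∷ 2 ∷ 3 ∷ 4 ∷ []} μ∈
... | s , _ , refl = matching-sound k r s

private
  -- In `∑₅` the two neighbours of a blob survive in the order of their indices, followed by 0
  -- unless one of them is blob 4. These three lemmas adapt the cyclic order of `Matching` to that.
  swap₂ : ∀ {x y} → x + y ≤ D → y + x ≤ D
  swap₂ {x} {y} = subst (_≤ D) (ℕ.+-comm x y)

  pad : ∀ {x y} → x + y ≤ D → x + (y + 0) ≤ D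
  pad {x} {y} = subst (λ z → x + z ≤ D) (sym (ℕ.+-identityʳ y))

  swap-pad : ∀ {x y} → x + y ≤ D → y + (x + 0) ≤ D
  swap-pad {x} {y} h = pad {y} {x} (swap₂ {x} {y} h)

onPairs-≤ : ∀ k k′ μ μ′ → (∀ i → μ ! i ≤ k ! i) → (∀ i → μ′ ! i ≤ k′ ! i) → ∀ i j → onPairs μ μ′ i j ≤ onPairs k k′ i j
onPairs-≤ k k′ μ μ′ h h′ 0F 0F = z≤n
onPairs-≤ k k′ μ μ′ h h′ 0F 1F = h 0F
onPairs-≤ k k′ μ μ′ h h′ 0F 2F = h′ 0F
onPairs-≤ k k′ μ μ′ h h′ 0F 3F = h′ 4F
onPairs-≤ k k′ μ μ′ h h′ 0F 4F = h 4F
onPairs-≤ k k′ μ μ′ h h′ 1F 0F = h 0F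
onPairs-≤ k k′ μ μ′ h h′ 1F 1F = z≤n
onPairs-≤ k k′ μ μ′ h h′ 1F 2F = h 1F
onPairs-≤ k k′ μ μ′ h h′ 1F 3F = h′ 3F
onPairs-≤ k k′ μ μ′ h h′ 1F 4F = h′ 2F
onPairs-≤ k k′ μ μ′ h h′ 2F 0F = h′ 0F
onPairs-≤ k k′ μ μ′ h h′ 2F 1F = h 1F
onPairs-≤ k k′ μ μ′ h h′ 2F 2F = z≤n
onPairs-≤ k k′ μ μ′ h h′ 2F 3F = h 2F
onPairs-≤ k k′ μ μ′ h h′ 2F 4F = h′ 1F
onPairs-≤ k k′ μ μ′ h h′ 3F 0F = h′ 4F
onPairs-≤ k k′ μ μ′ h h′ 3F 1F = h′ 3F
onPairs-≤ k k′ μ μ′ h h′ 3F 2F = h 2F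
onPairs-≤ k k′ μ μ′ h h′ 3F 3F = z≤n
onPairs-≤ k k′ μ μ′ h h′ 3F 4F = h 3F
onPairs-≤ k k′ μ μ′ h h′ 4F 0F = h 4F
onPairs-≤ k k′ μ μ′ h h′ 4F 1F = h′ 2F
onPairs-≤ k k′ μ μ′ h h′ 4F 2F = h′ 1F
onPairs-≤ k k′ μ μ′ h h′ 4F 3F = h 3F
onPairs-≤ k k′ μ μ′ h h′ 4F 4F = z≤n

onPairs-sym : ∀ v w i j → onPairs v w i j ≡ onPairs v w j i
onPairs-sym v w 0F 0F = refl
onPairs-sym v w 0F 1F = refl
onPairs-sym v w 0F 2F = refl
onPairs-sym v w 0F 3F = refl
onPairs-sym v w 0F 4F = refl
onPairs-sym v w 1F 0F = refl
onPairs-sym v w 1F 1F = refl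
onPairs-sym v w 1F 2F = refl
onPairs-sym v w 1F 3F = refl
onPairs-sym v w 1F 4F = refl
onPairs-sym v w 2F 0F = refl
onPairs-sym v w 2F 1F = refl
onPairs-sym v w 2F 2F = refl
onPairs-sym v w 2F 3F = refl
onPairs-sym v w 2F 4F = refl
onPairs-sym v w 3F 0F = refl
onPairs-sym v w 3F 1F = refl
onPairs-sym v w 3F 2F = refl
onPairs-sym v w 3F 3F = refl
onPairs-sym v w 3F 4F = refl
onPairs-sym v w 4F 0F = refl
onPairs-sym v w 4F 1F = refl
onPairs-sym v w 4F 2F = refl
onPairs-sym v w 4F 3F = refl
onPairs-sym v w 4F 4F = refl

onPairs-diag : ∀ v w i → onPairs v w i i ≡ 0
onPairs-diag v w 0F = refl
onPairs-diag v w 1F = refl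
onPairs-diag v w 2F = refl
onPairs-diag v w 3F = refl
onPairs-diag v w 4F = refl

0-div : ∀ n → 0 div n ≡ 0
0-div zero    = refl
0-div (suc n) = 0/n≡0 (suc n)

apexWeight-diag : ∀ a ε π i → apexWeight a ε π i i ≡ 0
apexWeight-diag a ε π@(_ , _) 0F = 0-div (a ! 0F)
apexWeight-diag a ε π@(_ , _) 1F = 0-div (a ! 1F)
apexWeight-diag a ε π@(_ , _) 2F = 0-div (a ! 2F)
apexWeight-diag a ε π@(_ , _) 3F = 0-div (a ! 3F)
apexWeight-diag a ε π@(_ , _) 4F = 0-div (a ! 4F)

module _ (a : Five) (ε : ℕ) (r b : Five) (π : Plan) (π-ok : planOK a ε π ≡ true)
  (μ μ′ : Five) (M : Matching (proj₁ (residues a ε π)) r μ)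
  (M′ : Matching (proj₂ (residues a ε π)) (pentagram b) μ′)
  (large : target a < base ε a + 12 * (gain ε r μ + gain 0 (pentagram b) μ′)) where

  private
    p : Fin 5 → Fin 5 → ℕ
    p = apexWeight a ε π

    spentOn : Colour → Fin 5 → ℕ
    spentOn c i = ∑₅ λ j → on (linked c i j) ((a ! j ∸ defect ε i j) * p i j)

    spentOK : Fin 5 → Bool
    spentOK i = (spentOn red i ≡ᵇ D) ∧ (spentOn blue i ≡ᵇ D)

    roomAt : Fin 5 → Fin 5 → ℕ
    roomAt i j = onPairs (proj₁ (residues a ε π)) (proj₂ (residues a ε π)) i j
      + ((a ! i ∸ 1) * p i j + ((a ! j ∸ 1) * p j i + defectLoad (flipWeight a ε) i j))

    parts : ∀₅ spentOK ≡ true × ∀₅ (λ i → ∀₅ λ j → roomAt i j ≤ᵇ D) ∧ (a ! 3F * flipWeight a ε ≡ᵇ ε * D) ≡ true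
    parts = ∧-true {∀₅ spentOK} π-ok

    parts′ : ∀₅ (λ i → ∀₅ λ j → roomAt i j ≤ᵇ D) ≡ true × (a ! 3F * flipWeight a ε ≡ᵇ ε * D) ≡ true
    parts′ = ∧-true {∀₅ (λ i → ∀₅ λ j → roomAt i j ≤ᵇ D)} (proj₂ parts)

    spent : ∀ c i → spentOn c i ≡ D
    spent red  i = ℕ.≡ᵇ⇒≡ _ D (T-true (proj₁ (∧-true {spentOn red i ≡ᵇ D} (∀₅-true {spentOK} (proj₁ parts) i))))
    spent blue i = ℕ.≡ᵇ⇒≡ _ D (T-true (proj₂ (∧-true {spentOn red i ≡ᵇ D} (∀₅-true {spentOK} (proj₁ parts) i))))

    room : ∀ i j → roomAt i j ≤ D
    room i j = ℕ.≤ᵇ⇒≤ (roomAt i j) D (T-true (∀₅-true {λ j → roomAt i j ≤ᵇ D} (∀₅-true {λ i → ∀₅ λ j → roomAt i j ≤ᵇ D} (proj₁ parts′) i) j))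

    module M  = Matching M
    module M′ = Matching M′

    degree : ∀ r b μ μ′ →
      r ! 1F * μ ! 0F + r ! 4F * μ ! 4F ≤ D → r ! 2F * μ ! 1F + r ! 0F * μ ! 0F ≤ D →
      r ! 3F * μ ! 2F + r ! 1F * μ ! 1F ≤ D → r ! 4F * μ ! 3F + r ! 2F * μ ! 2F ≤ D →
      r ! 0F * μ ! 4F + r ! 3F * μ ! 3F ≤ D →
      b ! 2F * μ′ ! 0F + b ! 3F * μ′ ! 4F ≤ D → b ! 4F * μ′ ! 1F + b ! 0F * μ′ ! 0F ≤ D →
      b ! 1F * μ′ ! 2F + b ! 2F * μ′ ! 1F ≤ D → b ! 3F * μ′ ! 3F + b ! 4F * μ′ ! 2F ≤ D →
      b ! 0F * μ′ ! 4F + b ! 1F * μ′ ! 3F ≤ D →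
      ∀ c i → ∑₅ (λ j → on (linked c i j) (classSize r b c j * onPairs μ μ′ i j)) ≤ D
    degree r b μ μ′ h₀ h₁ h₂ h₃ h₄ k₀ k₁ k₂ k₃ k₄ red  0F = h₀
    degree r b μ μ′ h₀ h₁ h₂ h₃ h₄ k₀ k₁ k₂ k₃ k₄ red  1F = swap-pad {r ! 2F * μ ! 1F} h₁
    degree r b μ μ′ h₀ h₁ h₂ h₃ h₄ k₀ k₁ k₂ k₃ k₄ red  2F = swap-pad {r ! 3F * μ ! 2F} h₂
    degree r b μ μ′ h₀ h₁ h₂ h₃ h₄ k₀ k₁ k₂ k₃ k₄ red  3F = swap₂ {r ! 4F * μ ! 3F} h₃
    degree r b μ μ′ h₀ h₁ h₂ h₃ h₄ k₀ k₁ k₂ k₃ k₄ red  4F = pad {r ! 0F * μ ! 4F} h₄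
    degree r b μ μ′ h₀ h₁ h₂ h₃ h₄ k₀ k₁ k₂ k₃ k₄ blue 0F = pad {b ! 2F * μ′ ! 0F} k₀
    degree r b μ μ′ h₀ h₁ h₂ h₃ h₄ k₀ k₁ k₂ k₃ k₄ blue 1F = k₃
    degree r b μ μ′ h₀ h₁ h₂ h₃ h₄ k₀ k₁ k₂ k₃ k₄ blue 2F = swap₂ {b ! 4F * μ′ ! 1F} k₁
    degree r b μ μ′ h₀ h₁ h₂ h₃ h₄ k₀ k₁ k₂ k₃ k₄ blue 3F = pad {b ! 0F * μ′ ! 4F} k₄
    degree r b μ μ′ h₀ h₁ h₂ h₃ h₄ k₀ k₁ k₂ k₃ k₄ blue 4F = pad {b ! 1F * μ′ ! 2F} k₂

    crossOf : Five → Five → Five → Five → Colour → ℕ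
    crossOf r b μ μ′ c = ∑₅ λ i → ∑₅ λ j →
      on (linked c i j) ((classSize r b c i * classSize r b c j ∸ defect ε i j) * onPairs μ μ′ i j)

    cross-red : ∀ r b μ μ′ → crossOf r b μ μ′ red ≡ 2 * gain ε r μ
    -- Truncated subtraction is an atom for the ring solver, so the two orders of the product of
    -- blobs 0 and 1 are identified beforehand.
    cross-red (five r₀ r₁ r₂ r₃ r₄) b (five m₀ m₁ m₂ m₃ m₄) μ′ rewrite ℕ.*-comm r₁ r₀ =
      solve 11 (λ x r₀ r₁ r₂ r₃ r₄ m₀ m₁ m₂ m₃ m₄ →
        (x :* m₀ :+ r₀ :* r₄ :* m₄) :+ ((x :* m₀ :+ (r₁ :* r₂ :* m₁ :+ con 0)) :+
        ((r₂ :* r₁ :* m₁ :+ (r₂ :* r₃ :* m₂ :+ con 0)) :+ ((r₃ :* r₂ :* m₂ :+ r₃ :* r₄ :* m₃) :+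
         (r₄ :* r₀ :* m₄ :+ (r₄ :* r₃ :* m₃ :+ con 0)))))
        := con 2 :* (x :* m₀ :+ r₁ :* r₂ :* m₁ :+ r₂ :* r₃ :* m₂ :+ r₃ :* r₄ :* m₃ :+ r₄ :* r₀ :* m₄))
        refl (r₀ * r₁ ∸ ε) r₀ r₁ r₂ r₃ r₄ m₀ m₁ m₂ m₃ m₄
      where open +-*-Solver

    cross-blue : ∀ r b μ μ′ → crossOf r b μ μ′ blue ≡ 2 * gain 0 (pentagram b) μ′
    cross-blue r (five b₀ b₁ b₂ b₃ b₄) μ (five m₀ m₁ m₂ m₃ m₄) =
      solve 10 (λ b₀ b₁ b₂ b₃ b₄ m₀ m₁ m₂ m₃ m₄ →
        (b₀ :* b₂ :* m₀ :+ (b₀ :* b₃ :* m₄ :+ con 0)) :+ ((b₁ :* b₃ :* m₃ :+ b₁ :* b₄ :* m₂) :+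
        ((b₂ :* b₀ :* m₀ :+ b₂ :* b₄ :* m₁) :+ ((b₃ :* b₀ :* m₄ :+ (b₃ :* b₁ :* m₃ :+ con 0)) :+
         (b₄ :* b₁ :* m₂ :+ (b₄ :* b₂ :* m₁ :+ con 0)))))
        := con 2 :* (b₀ :* b₂ :* m₀ :+ b₂ :* b₄ :* m₁ :+ b₄ :* b₁ :* m₂ :+ b₁ :* b₃ :* m₃ :+ b₃ :* b₀ :* m₄))
        refl b₀ b₁ b₂ b₃ b₄ m₀ m₁ m₂ m₃ m₄
      where open +-*-Solver

    distribute : ∀ x y z → 6 * x + 12 * (y + z) ≡ 6 * (x + (2 * y + 2 * z))
    distribute = solve 3 (λ x y z → con 6 :* x :+ con 12 :* (y :+ z) := con 6 :* (x :+ (con 2 :* y :+ con 2 :* z))) refl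
      where open +-*-Solver

    enough : target a < 6 * (pairs a * D + 2 * (ε * D) + (crossOf r b μ μ′ red + crossOf r b μ μ′ blue))
    enough = subst (target a <_) (trans
      (distribute (pairs a * D + 2 * (ε * D)) (gain ε r μ) (gain 0 (pentagram b) μ′))
      (cong (λ s → 6 * (pairs a * D + 2 * (ε * D) + s)) (sym (cong₂ _+_ (cross-red r b μ μ′) (cross-blue r b μ μ′))))) large

  certificate : Certificate a ε r b
  certificate = record
    { p = p ; μ = onPairs μ μ′ ; t = flipWeight a ε
    ; p-diag = apexWeight-diag a ε π
    ; μ-diag = onPairs-diag μ μ′
    ; μ-sym  = onPairs-sym μ μ′
    ; spent  = spent
    ; room   = λ i j → ℕ.≤-trans (ℕ.+-monoˡ-≤ _ (onPairs-≤ (proj₁ (residues a ε π)) (proj₂ (residues a ε π)) μ μ′ M.within M′.within i j)) (room i j)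
    ; degree = degrees b M′.at₀ M′.at₁ M′.at₂ M′.at₃ M′.at₄
    ; t-spent = ℕ.≡ᵇ⇒≡ (a ! 3F * flipWeight a ε) (ε * D) (T-true (proj₂ parts′))
    ; enough = enough
    }
    where
    degrees : ∀ b →
      (pentagram b) ! 1F * μ′ ! 0F + (pentagram b) ! 4F * μ′ ! 4F ≤ D → (pentagram b) ! 2F * μ′ ! 1F + (pentagram b) ! 0F * μ′ ! 0F ≤ D →
      (pentagram b) ! 3F * μ′ ! 2F + (pentagram b) ! 1F * μ′ ! 1F ≤ D → (pentagram b) ! 4F * μ′ ! 3F + (pentagram b) ! 2F * μ′ ! 2F ≤ D →
      (pentagram b) ! 0F * μ′ ! 4F + (pentagram b) ! 3F * μ′ ! 3F ≤ D →
      ∀ c i → ∑₅ (λ j → on (linked c i j) (classSize r b c j * onPairs μ μ′ i j)) ≤ D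
    -- Once `b` is a constructor, the entries of `pentagram b` compute to entries of `b`.
    degrees b@(five _ _ _ _ _) = degree r b μ μ′ M.at₀ M.at₁ M.at₂ M.at₃ M.at₄

data Extends (ε : ℕ) (a r b : Five) (j : Fin 5) : Set where
  matches  : ε + misfits r b j ≡ 0 → increment j a ∈ᵇ ℬ₁ ≡ true → Extends ε a r b j
  one-flip : ε + misfits r b j ≡ 1 → increment j a ∈ᵇ ℬ₂ ≡ true → Extends ε a r b j

fitsIn-sound : ∀ ε a r b j → fitsIn ε a r b j ≡ true → Extends ε a r b j
fitsIn-sound ε a r b j h with ε + misfits r b j in eq
... | 0 = matches eq h
... | 1 = one-flip eq h

_∖₅_ : Five → Five → Five
five a₀ a₁ a₂ a₃ a₄ ∖₅ five r₀ r₁ r₂ r₃ r₄ = five (a₀ ∸ r₀) (a₁ ∸ r₁) (a₂ ∸ r₂) (a₃ ∸ r₃) (a₄ ∸ r₄)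

packable-sound : ∀ ε a r b πs → all (planOK a ε) πs ≡ true →
  packable (target a) (base ε a) ε r b (map (residues a ε) πs) ≡ true → Certificate a ε r b
packable-sound ε a r b πs ok h = from-residues (any-true _ (map (residues a ε) πs) h)
  where
  Large : Five → Five → Set
  Large μ μ′ = (target a <ᵇ base ε a + 12 * (gain ε r μ + gain 0 (pentagram b) μ′)) ≡ true
  from-pair : ∀ π → π ∈ πs → ∀ μ → μ ∈ matchings (proj₁ (residues a ε π)) r →
    ∃[ μ′ ] μ′ ∈ matchings (proj₂ (residues a ε π)) (pentagram b) × Large μ μ′ → Certificate a ε r b
  from-pair π π∈ μ μ∈ (μ′ , μ′∈ , large) = certificate a ε r b π (all-true {xs = πs} ok π∈) μ μ′
    (matchings-sound _ r μ∈) (matchings-sound _ (pentagram b) μ′∈) (ℕ.<ᵇ⇒< (target a) _ (T-true large))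
  from-plan : ∀ π → π ∈ πs →
    ∃[ μ ] μ ∈ matchings (proj₁ (residues a ε π)) r ×
      any (λ μ′ → target a <ᵇ base ε a + 12 * (gain ε r μ + gain 0 (pentagram b) μ′))
        (matchings (proj₂ (residues a ε π)) (pentagram b)) ≡ true → Certificate a ε r b
  from-plan π π∈ (μ , μ∈ , h) = from-pair π π∈ μ μ∈ (any-true _ _ h)
  from-residues : ∃[ k ] k ∈ map (residues a ε) πs ×
    heavy (target a) (base ε a) ε r (pentagram b) (matchings (proj₁ k) r) (matchings (proj₂ k) (pentagram b)) ≡ true →
    Certificate a ε r b
  from-residues (k , k∈ , h) = via (∈-map⁻ (residues a ε) {xs = πs} k∈) h
    where
    via : ∃[ π ] π ∈ πs × k ≡ residues a ε π →
      heavy (target a) (base ε a) ε r (pentagram b) (matchings (proj₁ k) r) (matchings (proj₂ k) (pentagram b)) ≡ true →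
      Certificate a ε r b
    via (π , π∈ , refl) h = from-plan π π∈ (any-true _ _ h)

row-sound : ∀ ε a πs r → rowOK ε (a , πs) ≡ true → (∀ i → r ! i ≤ a ! i) →
  (∃[ j ] Extends ε a r (a ∖₅ r) j) ⊎ Certificate a ε r (a ∖₅ r)
row-sound ε a@(five a₀ a₁ a₂ a₃ a₄) πs r@(five r₀ r₁ r₂ r₃ r₄) ok r≤a =
  cases (∨-true (∃₅ (fitsIn ε a r (a ∖₅ r)))
    (∀≤-true a₄ (∀≤-true a₃ (∀≤-true a₂ (∀≤-true a₁ (∀≤-true a₀ (proj₂ rows) (r≤a 0F)) (r≤a 1F)) (r≤a 2F)) (r≤a 3F)) (r≤a 4F)))
  where
  rows : all (planOK a ε) πs ≡ true × allRed (target a) (base ε a) ε a (map (residues a ε) πs) ≡ true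
  rows = ∧-true {all (planOK a ε) πs} ok
  cases : ∃₅ (fitsIn ε a r (a ∖₅ r)) ≡ true ⊎ packable (target a) (base ε a) ε r (a ∖₅ r) (map (residues a ε) πs) ≡ true →
    (∃[ j ] Extends ε a r (a ∖₅ r) j) ⊎ Certificate a ε r (a ∖₅ r)
  cases (inj₁ h) = let (j , f) = ∃₅-true (fitsIn ε a r (a ∖₅ r)) h in inj₁ (j , fitsIn-sound ε a r (a ∖₅ r) j f)
  cases (inj₂ h) = inj₂ (packable-sound ε a r (a ∖₅ r) πs (proj₁ rows) h)

-- Symmetries of the pentagon pattern

-- The affine maps of ℤ/5; those with multiplier ±2 swap the colours.
record Symmetry : Set where
  field
    to from   : Fin 5 → Fin 5
    swaps     : Bool
    from-to   : ∀ i → from (to i) ≡ i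
    to-from   : ∀ i → to (from i) ≡ i
    linked-to : ∀ c i j → linked c (to i) (to j) ≡ linked (recolour swaps c) i j

open Symmetry

∀c? : {P : Colour → Set} → (∀ c → Dec (P c)) → Dec (∀ c → P c)
∀c? P? with P? red | P? blue
... | yes p | yes q = yes λ { red → p ; blue → q }
... | no ¬p | _     = no λ h → ¬p (h red)
... | _     | no ¬q = no λ h → ¬q (h blue)

identity rotation doubling : Symmetry
identity = record
  { to = id ; from = id ; swaps = false
  ; from-to = λ _ → refl ; to-from = λ _ → refl ; linked-to = λ _ _ _ → refl }
rotation = record
  { to = up ; from = down ; swaps = false
  ; from-to = from-yes (Fin.all? λ i → down (up i) ≟ i)
  ; to-from = from-yes (Fin.all? λ i → up (down i) ≟ i)
  ; linked-to = from-yes (∀c? λ c → Fin.all? λ i → Fin.all? λ j → linked c (up i) (up j) Bool.≟ linked c i j) }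
  where
  up down : Fin 5 → Fin 5
  up   = λ { 0F → 1F ; 1F → 2F ; 2F → 3F ; 3F → 4F ; 4F → 0F }
  down = λ { 0F → 4F ; 1F → 0F ; 2F → 1F ; 3F → 2F ; 4F → 3F }
doubling = record
  { to = double ; from = halve ; swaps = true
  ; from-to = from-yes (Fin.all? λ i → halve (double i) ≟ i)
  ; to-from = from-yes (Fin.all? λ i → double (halve i) ≟ i)
  ; linked-to = from-yes (∀c? λ c → Fin.all? λ i → Fin.all? λ j → linked c (double i) (double j) Bool.≟ linked (opposite c) i j) }
  where
  double halve : Fin 5 → Fin 5
  double = λ { 0F → 0F ; 1F → 2F ; 2F → 4F ; 3F → 1F ; 4F → 3F }
  halve  = λ { 0F → 0F ; 1F → 3F ; 2F → 1F ; 3F → 4F ; 4F → 2F }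

opposite² : ∀ c → opposite (opposite c) ≡ c
opposite² red  = refl
opposite² blue = refl

recolour-xor : ∀ s s′ c → recolour s (recolour s′ c) ≡ recolour (s xor s′) c
recolour-xor false s′    c = refl
recolour-xor true  false c = refl
recolour-xor true  true  c = opposite² c

recolour² : ∀ s c → recolour s (recolour s c) ≡ c
recolour² false c = refl
recolour² true  c = opposite² c

_⊙_ : Symmetry → Symmetry → Symmetry
σ ⊙ τ = record
  { to = to σ ∘ to τ ; from = from τ ∘ from σ ; swaps = swaps τ xor swaps σ
  ; from-to = λ i → trans (cong (from τ) (from-to σ (to τ i))) (from-to τ i)
  ; to-from = λ i → trans (cong (to σ) (to-from τ (from σ i))) (to-from σ i)
  ; linked-to = λ c i j → trans (linked-to σ c (to τ i) (to τ j)) (trans (linked-to τ (recolour (swaps σ) c) i j)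
      (cong (λ c → linked c i j) (recolour-xor (swaps τ) (swaps σ) c))) }

orbit : ℕ → Symmetry → Symmetry → List Symmetry
orbit zero    σ τ = []
orbit (suc k) σ τ = τ ∷ orbit k σ (σ ⊙ τ)

-- As 2 generates the units modulo 5, the powers of `doubling` followed by rotations are all the
-- maps i ↦ 2^k i + l.
symmetries : List Symmetry
symmetries = List.concatMap (orbit 5 rotation) (orbit 4 doubling identity)

arrange : (Fin 5 → Fin 5) → Five → Five
arrange f v = five (v ! f 0F) (v ! f 1F) (v ! f 2F) (v ! f 3F) (v ! f 4F)

_≡₅ᵇ_ : Five → Five → Bool
five a b c d e ≡₅ᵇ five a′ b′ c′ d′ e′ = (a ≡ᵇ a′) ∧ (b ≡ᵇ b′) ∧ (c ≡ᵇ c′) ∧ (d ≡ᵇ d′) ∧ (e ≡ᵇ e′)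

listed : List (Five × List Plan) → Five → Bool
listed table v = any (λ row → v ≡₅ᵇ proj₁ row) table

-- All entries of the tuples lie between 2 and 5, so 4^5 candidates contain every arrangement.
∀₂₋₅ : (Five → Bool) → Bool
∀₂₋₅ f = ∀≤ 3 λ a → ∀≤ 3 λ b → ∀≤ 3 λ c → ∀≤ 3 λ d → ∀≤ 3 λ e → f (five (2 + a) (2 + b) (2 + c) (2 + d) (2 + e))

arranged₁ : Five → Bool
arranged₁ v = not (v ∈ᵇ ℬ₁) ∨ any (λ σ → listed table₁ (arrange (from σ) v)) symmetries

-- Completeness of the table: no arrangement of a tuple of `ℬ₁` is missing up to symmetry.
arranged₁-all : ∀₂₋₅ arranged₁ ≡ true
arranged₁-all = refl

movesTo01 : Fin 5 → Fin 5 → Symmetry → Bool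
movesTo01 i j σ = does (to σ i ≟ 0F) ∧ does (to σ j ≟ 1F)

-- The flipped edge has no direction. By sharp 2-transitivity one symmetry takes (i, j) to (0, 1)
-- and one takes (j, i) there; a symmetry that swaps the colours deals with an edge between
-- blue-linked blobs. Either of the two resulting arrangements may be the one listed.
relocates : Five → Fin 5 → Fin 5 → Symmetry → Bool
relocates v i j σ = (movesTo01 i j σ ∨ movesTo01 j i σ) ∧ listed table₂ (arrange (from σ) v)

relocatable : Five → Fin 5 → Fin 5 → Bool
relocatable v i j = does (i ≟ j) ∨ any (relocates v i j) symmetries

arranged₂ : Five → Bool
arranged₂ v = not (v ∈ᵇ ℬ₂) ∨ ∀₅ λ i → ∀₅ (relocatable v i)

arranged₂-all : ∀₂₋₅ arranged₂ ≡ true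
arranged₂-all = refl

-- Blob sizes up to order

does-true : ∀ {P : Set} (P? : Dec P) → does P? ≡ true → P
does-true (yes p) _ = p

sizesOf : (Fin n → Fin 5) → Five
sizesOf blob = five (c 0F) (c 1F) (c 2F) (c 3F) (c 4F)
  where
  c : Fin 5 → ℕ
  c i = sum λ x → on (does (blob x ≟ i)) 1

sizesOf-! : (blob : Fin n → Fin 5) → ∀ i → sizesOf blob ! i ≡ sum λ x → on (does (blob x ≟ i)) 1
sizesOf-! blob 0F = refl
sizesOf-! blob 1F = refl
sizesOf-! blob 2F = refl
sizesOf-! blob 3F = refl
sizesOf-! blob 4F = refl

blobSizes≡ : (blob : Fin n → Fin 5) → blobSizes blob ≡ toList (sizesOf blob)
blobSizes≡ {n} blob = cong₅ (size≡ 0F) (size≡ 1F) (size≡ 2F) (size≡ 3F) (size≡ 4F)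
  where
  size≡ : ∀ i → length (filter (λ x → blob x ≟ i) (allFin n)) ≡ sum λ x → on (does (blob x ≟ i)) 1
  size≡ i = trans (sym (Σₗ-length (filter (λ x → blob x ≟ i) (allFin n))))
    (trans (Σₗ-filter (λ x → blob x ≟ i) (λ _ → 1) (allFin n)) (Σₗ-tabulate _ id))
  cong₅ : ∀ {a a′ b b′ c c′ d d′ e e′ : ℕ} → a ≡ a′ → b ≡ b′ → c ≡ c′ → d ≡ d′ → e ≡ e′ →
          tuple a b c d e ≡ tuple a′ b′ c′ d′ e′
  cong₅ refl refl refl refl refl = refl

sort-unique : ∀ {xs ys} → xs ↭ ys → Sorted ys → sort xs ≡ ys
sort-unique {xs} xs↭ys ys↗ = Pointwise-≡⇒≡ (↗↭↗⇒≋ ℕ.≤-totalOrder (sort-↗ xs) ys↗ (↭⇒↭ₛ (↭-trans (sort-↭ xs) xs↭ys)))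

-- The tuples are listed in increasing order, so sorting any arrangement gives back the tuple
-- itself.
∈ᵇ-↭ : ∀ ℬ → All Sorted ℬ → ∀ {v b} → b ∈ ℬ → toList v ↭ b → v ∈ᵇ ℬ ≡ true
∈ᵇ-↭ ℬ ℬ↗ {v} b∈ v↭b = dec-true (mem? (List.≡-dec ℕ._≟_) (sort (toList v)) ℬ)
  (subst (_∈ ℬ) (sym (sort-unique v↭b (All.lookup ℬ↗ b∈))) b∈)

ℬ₁↗ : All Sorted ℬ₁
ℬ₁↗ = from-yes (All.all? (sorted? ℕ._≤?_) ℬ₁)

ℬ₂↗ : All Sorted ℬ₂
ℬ₂↗ = from-yes (All.all? (sorted? ℕ._≤?_) ℬ₂)

-- Colourings following the pentagon pattern

Follows : Bool → Colouring n → (Fin n → Fin 5) → Set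
Follows s G blob = ∀ x y c → linked c (blob x) (blob y) ≡ true → recolour s (colour G x y) ≡ c

linked-⊕ : ∀ i → linked red i (i ⊕ 1) ≡ true × linked blue i (i ⊕ 2) ≡ true
linked-⊕ = from-yes (Fin.all? λ i → (linked red i (i ⊕ 1) Bool.≟ true) ×-dec (linked blue i (i ⊕ 2) Bool.≟ true))

linked-shift : ∀ i j → (linked red i j ≡ true → j ≡ i ⊕ 1 ⊎ i ≡ j ⊕ 1) × (linked blue i j ≡ true → j ≡ i ⊕ 2 ⊎ i ≡ j ⊕ 2)
linked-shift = from-yes (Fin.all? λ i → Fin.all? λ j →
  ((linked red i j Bool.≟ true) →-dec ((j ≟ i ⊕ 1) ⊎-dec (i ≟ j ⊕ 1))) ×-dec
  ((linked blue i j Bool.≟ true) →-dec ((j ≟ i ⊕ 2) ⊎-dec (i ≟ j ⊕ 2))))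

linked-sym : ∀ c i j → linked c i j ≡ linked c j i
linked-sym = from-yes (∀c? λ c → Fin.all? λ i → Fin.all? λ j → linked c i j Bool.≟ linked c j i)

blowUp-follows : {G : Colouring n} {blob : Fin n → Fin 5} → IsPentagonBlowUp G blob → Follows false G blob
blowUp-follows {G = G} P x y red l with proj₁ (linked-shift _ _) l
... | inj₁ e = IsPentagonBlowUp.red-edges P _ x y refl e
... | inj₂ e = trans (colour-sym G x y) (IsPentagonBlowUp.red-edges P _ y x refl e)
blowUp-follows {G = G} P x y blue l with proj₂ (linked-shift _ _) l
... | inj₁ e = IsPentagonBlowUp.blue-edges P _ x y refl e
... | inj₂ e = trans (colour-sym G x y) (IsPentagonBlowUp.blue-edges P _ y x refl e)

nonempty-blob : (blob : Fin n → Fin 5) (i : Fin 5) → 1 ≤ sizesOf blob ! i → ∃[ x ] blob x ≡ i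
nonempty-blob blob i 1≤ with Fin.any? (λ x → blob x ≟ i)
... | yes h = h
... | no ¬h = contradiction (subst (1 ≤_) (trans (sizesOf-! blob i) (sum-0 λ x →
        cong (λ b → on b 1) (dec-false (blob x ≟ i) λ e → ¬h (x , e)))) 1≤) λ ()

five-cong : ∀ {a a′ b b′ c c′ d d′ e e′} → a ≡ a′ → b ≡ b′ → c ≡ c′ → d ≡ d′ → e ≡ e′ →
            five a b c d e ≡ five a′ b′ c′ d′ e′
five-cong refl refl refl refl refl = refl

move-sizes : (σ : Symmetry) (blob : Fin n → Fin 5) → sizesOf (to σ ∘ blob) ≡ arrange (from σ) (sizesOf blob)
move-sizes σ blob = five-cong (moved 0F) (moved 1F) (moved 2F) (moved 3F) (moved 4F)
  where
  ≟-to : ∀ k i → does (to σ k ≟ i) ≡ does (k ≟ from σ i)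
  ≟-to k i with k ≟ from σ i
  ... | yes refl = dec-true (to σ (from σ i) ≟ i) (to-from σ i)
  ... | no k≢    = dec-false (to σ k ≟ i) λ { refl → k≢ (sym (from-to σ k)) }
  moved : ∀ i → (sum λ x → on (does (to σ (blob x) ≟ i)) 1) ≡ sizesOf blob ! from σ i
  moved i = trans (sum-cong λ x → cong (λ b → on b 1) (≟-to (blob x) i)) (sym (sizesOf-! blob (from σ i)))

-- Positive sizes make the blobs non-empty. If the colours are swapped, relabelling the blobs by
-- `doubling` swaps them back and merely permutes the sizes.
follows⇒blowUp : ∀ ℬ → All (All (1 ≤_)) ℬ → ∀ s (G : Colouring n) blob → Follows s G blob →
                 sizesOf blob ∈ᵇ ℬ ≡ true → BlowUpWithSizesIn ℬ G
follows⇒blowUp ℬ pos false G blob F v∈ = blob , record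
    { nonempty   = λ i → nonempty-blob blob i (positive i)
    ; red-edges  = λ { i x y refl e → F x y red (trans (cong (linked red (blob x)) e) (proj₁ (linked-⊕ (blob x)))) }
    ; blue-edges = λ { i x y refl e → F x y blue (trans (cong (linked blue (blob x)) e) (proj₂ (linked-⊕ (blob x)))) }
    } , sort (toList v) , b∈ , subst (_↭ sort (toList v)) (sym (blobSizes≡ blob)) (↭-sym (sort-↭ (toList v)))
  where
  v = sizesOf blob
  b∈ : sort (toList v) ∈ ℬ
  b∈ = does-true (mem? (List.≡-dec ℕ._≟_) (sort (toList v)) ℬ) v∈
  entries : ∀ v → All (1 ≤_) (toList v) → ∀ i → 1 ≤ v ! i
  entries (five _ _ _ _ _) (h ∷ _) 0F = h
  entries (five _ _ _ _ _) (_ ∷ h ∷ _) 1F = h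
  entries (five _ _ _ _ _) (_ ∷ _ ∷ h ∷ _) 2F = h
  entries (five _ _ _ _ _) (_ ∷ _ ∷ _ ∷ h ∷ _) 3F = h
  entries (five _ _ _ _ _) (_ ∷ _ ∷ _ ∷ _ ∷ h ∷ _) 4F = h
  positive : ∀ i → 1 ≤ v ! i
  positive = entries v (All-resp-↭ (sort-↭ (toList v)) (All.lookup pos b∈))
follows⇒blowUp ℬ pos true G blob F v∈ = follows⇒blowUp ℬ pos false G (to doubling ∘ blob)
  (λ x y c l → trans (sym (opposite² (colour G x y))) (trans (cong opposite (F x y (opposite c) (trans (sym (linked-to doubling c (blob x) (blob y))) l))) (opposite² c)))
  (trans (cong (λ xs → does (mem? (List.≡-dec ℕ._≟_) xs ℬ)) same-sort) v∈)
  where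
  double-sizes : sizesOf (to doubling ∘ blob) ≡ arrange (from doubling) (sizesOf blob)
  double-sizes = move-sizes doubling blob
  same-sort : sort (toList (sizesOf (to doubling ∘ blob))) ≡ sort (toList (sizesOf blob))
  same-sort = sort-unique (↭-trans (↭-reflexive (cong toList double-sizes)) (↭-trans (halved (sizesOf blob)) (↭-sym (sort-↭ (toList (sizesOf blob)))))) (sort-↗ (toList (sizesOf blob)))
    where
    halved : ∀ v → toList (arrange (from doubling) v) ↭ toList v
    halved (five a b c d e) = prep a (↭-trans (swap d b ↭-refl) (prep b (↭-trans (prep d (swap e c ↭-refl)) (swap d c ↭-refl))))

-- Adding `u` to a blob

extend : Fin (suc m) → Fin 5 → (Fin m → Fin 5) → Fin (suc m) → Fin 5
extend u j blob v = maybe′ blob j (at u v)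

extend-u : ∀ (u : Fin (suc m)) j blob → extend u j blob u ≡ j
extend-u u j blob = cong (maybe′ blob j) (at-u u)

extend-punchIn : ∀ (u : Fin (suc m)) j blob x → extend u j blob (punchIn u x) ≡ blob x
extend-punchIn u j blob x = cong (maybe′ blob j) (at-punchIn u x)

extend-sizes : ∀ (u : Fin (suc m)) j blob → sizesOf (extend u j blob) ≡ increment j (sizesOf blob)
extend-sizes u j blob = trans (five-cong (count 0F) (count 1F) (count 2F) (count 3F) (count 4F)) (add j)
  where
  count : ∀ i → (sum λ v → on (does (extend u j blob v ≟ i)) 1) ≡ on (does (j ≟ i)) 1 + sizesOf blob ! i
  count i = trans (sum-punchIn u _) (cong₂ _+_ (cong (λ k → on (does (k ≟ i)) 1) (extend-u u j blob))
    (trans (sum-cong λ x → cong (λ k → on (does (k ≟ i)) 1) (extend-punchIn u j blob x)) (sym (sizesOf-! blob i))))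
  add : ∀ j → five (on (does (j ≟ 0F)) 1 + sizesOf blob ! 0F) (on (does (j ≟ 1F)) 1 + sizesOf blob ! 1F)
    (on (does (j ≟ 2F)) 1 + sizesOf blob ! 2F) (on (does (j ≟ 3F)) 1 + sizesOf blob ! 3F)
    (on (does (j ≟ 4F)) 1 + sizesOf blob ! 4F) ≡ increment j (sizesOf blob)
  add 0F = refl
  add 1F = refl
  add 2F = refl
  add 3F = refl
  add 4F = refl

linked-irrefl : ∀ {A : Set} c i → linked c i i ≡ true → A
linked-irrefl c i l with trans (sym (linked-diag c i)) l
... | ()

follows-extend : ∀ s (G : Colouring (suc m)) u j blob → Follows s (G ∖ u) blob →
  (∀ x c → linked c j (blob x) ≡ true → recolour s (colour G u (punchIn u x)) ≡ c) → Follows s G (extend u j blob)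
follows-extend s G u j blob F Fu v w c l with position u v | position u w
... | inj₁ refl | inj₁ refl = linked-irrefl c (extend u j blob u) l
... | inj₁ refl | inj₂ (y , refl) = Fu y c (subst₂ (λ i k → linked c i k ≡ true) (extend-u u j blob) (extend-punchIn u j blob y) l)
... | inj₂ (x , refl) | inj₁ refl = trans (cong (recolour s) (colour-sym G (punchIn u x) u))
    (Fu x c (trans (linked-sym c j (blob x)) (subst₂ (λ i k → linked c i k ≡ true) (extend-punchIn u j blob x) (extend-u u j blob) l)))
... | inj₂ (x , refl) | inj₂ (y , refl) = F x y c
    (subst₂ (λ i k → linked c i k ≡ true) (extend-punchIn u j blob x) (extend-punchIn u j blob y) l)

flip-on : ∀ (G : Colouring n) {a b x y} → SamePair a b x y → colour (flip G a b) x y ≡ opposite (colour G x y)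
flip-on G {a} {b} {x} {y} h = cong (λ d → if d then _ else _) (dec-true (samePair? a b x y) h)

flip-off : ∀ (G : Colouring n) {a b x y} → ¬ SamePair a b x y → colour (flip G a b) x y ≡ colour G x y
flip-off G {a} {b} {x} {y} h = cong (λ d → if d then _ else _) (dec-false (samePair? a b x y) h)

recolour-opposite : ∀ s c → recolour s (opposite c) ≡ opposite (recolour s c)
recolour-opposite false c = refl
recolour-opposite true  c = refl

linked-unique : ∀ {c d} i j → linked c i j ≡ true → linked d i j ≡ true → c ≡ d
linked-unique {c} {d} i j l l′ = from-yes (∀c? λ c → ∀c? λ d → Fin.all? λ i → Fin.all? λ j →
  (linked c i j Bool.≟ true) →-dec (linked d i j Bool.≟ true) →-dec (c ≟ᶜ d)) c d i j l l′

≢⇒opposite : ∀ {c d} → c ≢ d → opposite c ≡ d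
≢⇒opposite {red}  {red}  h = ⊥-elim (h refl)
≢⇒opposite {red}  {blue} h = refl
≢⇒opposite {blue} {red}  h = refl
≢⇒opposite {blue} {blue} h = ⊥-elim (h refl)

-- No colour links a blob to itself, so a vertex of blob `j` never misfits.
misfit : (Fin m → Colour) → Fin 5 → (Fin m → Fin 5) → Fin m → Bool
misfit q j blob x = linked (opposite (q x)) j (blob x)

misfit-false : ∀ (q : Fin m → Colour) j blob x c → misfit q j blob x ≡ false → linked c j (blob x) ≡ true → q x ≡ c
misfit-false q j blob x c h l with q x ≟ᶜ c
... | yes e = e
... | no ≢c with trans (sym h) (trans (cong (λ d → linked d j (blob x)) (≢⇒opposite ≢c)) l)
...   | ()

none-true : (f : Fin n → Bool) → (sum λ x → on (f x) 1) ≡ 0 → ∀ x → f x ≡ false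
none-true f h x with f x in e
... | false = refl
... | true  = contradiction (ℕ.≤-trans (ℕ.≤-reflexive (sym (cong (λ b → on b 1) e)))
                (ℕ.≤-trans (≤sum (λ x → on (f x) 1) x) (ℕ.≤-reflexive h))) λ ()

one-true : (f : Fin n → Bool) → (sum λ x → on (f x) 1) ≡ 1 → ∃[ x ] f x ≡ true × (∀ y → y ≢ x → f y ≡ false)
one-true f h with Fin.any? (λ x → f x Bool.≟ true)
... | no ¬t = contradiction (trans (sym h) (sum-0 λ x → cong (λ b → on b 1) (Bool.¬-not λ e → ¬t (x , e)))) λ ()
... | yes (x , fx) = x , fx , λ y y≢x → Bool.¬-not (two y y≢x)
  where
  two : ∀ y → y ≢ x → f y ≢ true
  two y y≢x fy = contradiction (begin
    2 ≡⟨ sym (cong₂ _+_ (sum-δ x (λ _ → 1)) (sum-δ y (λ _ → 1))) ⟩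
    (sum λ z → on (does (z ≟ x)) 1) + (sum λ z → on (does (z ≟ y)) 1) ≡⟨ sym (sum-+ _ _) ⟩
    (sum λ z → on (does (z ≟ x)) 1 + on (does (z ≟ y)) 1) ≤⟨ sum-mono at-most ⟩
    (sum λ z → on (f z) 1) ≡⟨ h ⟩
    1 ∎) λ { (s≤s ()) }
    where
    open ℕ.≤-Reasoning
    at-most : ∀ z → on (does (z ≟ x)) 1 + on (does (z ≟ y)) 1 ≤ on (f z) 1
    at-most z with z ≟ x
    ... | yes refl rewrite dec-false (z ≟ y) (y≢x ∘ sym) | fx = ℕ.≤-refl
    ... | no _ = on-dec-≤ (z ≟ y) λ { refl → ℕ.≤-reflexive (sym (cong (λ b → on b 1) fy)) }

-- Red and blue neighbours of `u` by blob

redSizes : (Fin m → Colour) → (Fin m → Fin 5) → Five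
redSizes q blob = five (c 0F) (c 1F) (c 2F) (c 3F) (c 4F)
  where
  c : Fin 5 → ℕ
  c i = sum λ x → on (does (blob x ≟ i)) (on (same red (q x)) 1)

redSizes-! : (q : Fin m → Colour) (blob : Fin m → Fin 5) → ∀ i →
  redSizes q blob ! i ≡ sum λ x → on (does (blob x ≟ i)) (on (same red (q x)) 1)
redSizes-! q blob 0F = refl
redSizes-! q blob 1F = refl
redSizes-! q blob 2F = refl
redSizes-! q blob 3F = refl
redSizes-! q blob 4F = refl

∖₅-! : ∀ a r i → (a ∖₅ r) ! i ≡ a ! i ∸ r ! i
∖₅-! (five _ _ _ _ _) (five _ _ _ _ _) 0F = refl
∖₅-! (five _ _ _ _ _) (five _ _ _ _ _) 1F = refl
∖₅-! (five _ _ _ _ _) (five _ _ _ _ _) 2F = refl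
∖₅-! (five _ _ _ _ _) (five _ _ _ _ _) 3F = refl
∖₅-! (five _ _ _ _ _) (five _ _ _ _ _) 4F = refl

module _ (q : Fin m → Colour) (blob : Fin m → Fin 5) where

  private
    a r : Five
    a = sizesOf blob
    r = redSizes q blob

    coloured : Colour → Fin 5 → ℕ
    coloured c i = sum λ x → on (does (blob x ≟ i)) (on (same c (q x)) 1)

    red+blue : ∀ i → a ! i ≡ r ! i + coloured blue i
    red+blue i = begin
      a ! i ≡⟨ sizesOf-! blob i ⟩
      (sum λ x → on (does (blob x ≟ i)) 1)
        ≡⟨ sum-cong (λ x → trans (cong (on (does (blob x ≟ i))) (split (q x))) (on-+ (does (blob x ≟ i)) _ _)) ⟩
      (sum λ x → on (does (blob x ≟ i)) (on (same red (q x)) 1) + on (does (blob x ≟ i)) (on (same blue (q x)) 1))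
        ≡⟨ sum-+ _ _ ⟩
      coloured red i + coloured blue i
        ≡⟨ cong (λ k → k + coloured blue i) (sym (redSizes-! q blob i)) ⟩
      r ! i + coloured blue i ∎
      where
      open ≡-Reasoning
      split : ∀ c → 1 ≡ on (same red c) 1 + on (same blue c) 1
      split red  = refl
      split blue = refl

  redSizes-≤ : ∀ i → redSizes q blob ! i ≤ sizesOf blob ! i
  redSizes-≤ i = subst (r ! i ≤_) (sym (red+blue i)) (ℕ.m≤m+n (r ! i) (coloured blue i))

  class-sizes : ∀ c i → coloured c i ≡ classSize (redSizes q blob) (sizesOf blob ∖₅ redSizes q blob) c i
  class-sizes red  i = sym (redSizes-! q blob i)
  class-sizes blue i = sym (trans (∖₅-! a r i) (trans (cong (_∸ r ! i) (red+blue i)) (ℕ.m+n∸m≡n (r ! i) (coloured blue i))))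

  -- A misfit is a red neighbour of `u` in a blob linked in blue to `j`, or a blue one in a blob
  -- linked in red. Sorted by blobs, these counts are the four terms of `misfits`.
  misfits-sum : ∀ j → misfits (redSizes q blob) (sizesOf blob ∖₅ redSizes q blob) j ≡ sum λ x → on (misfit q j blob x) 1
  misfits-sum j = sym (begin
    (sum λ x → on (misfit q j blob x) 1)
      ≡⟨ sum-cong (λ x → split (q x) (blob x)) ⟩
    (sum λ x → on (same red (q x)) 1 * on (linked blue j (blob x)) 1 + on (same blue (q x)) 1 * on (linked red j (blob x)) 1)
      ≡⟨ trans (sum-+ _ _) (cong₂ _+_ (sum-fibres blob _ (λ i → on (linked blue j i) 1)) (sum-fibres blob _ (λ i → on (linked red j i) 1))) ⟩
    (sum λ i → coloured red i * on (linked blue j i) 1) + (sum λ i → coloured blue i * on (linked red j i) 1)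
      ≡⟨ cong₂ _+_ (trans (sum-cong λ i → cong (_* on (linked blue j i) 1) (class-sizes red i)) (sum₅ _))
                   (trans (sum-cong λ i → cong (_* on (linked red j i) 1) (class-sizes blue i)) (sum₅ _)) ⟩
    ∑₅ (λ i → r ! i * on (linked blue j i) 1) + ∑₅ (λ i → (a ∖₅ r) ! i * on (linked red j i) 1)
      ≡⟨ by-blob r (a ∖₅ r) j ⟩
    misfits r (a ∖₅ r) j ∎)
    where
    open ≡-Reasoning
    split : ∀ c i → on (linked (opposite c) j i) 1 ≡ on (same red c) 1 * on (linked blue j i) 1 + on (same blue c) 1 * on (linked red j i) 1
    split red  i = sym (trans (ℕ.+-identityʳ _) (ℕ.+-identityʳ _))
    split blue i = sym (ℕ.+-identityʳ _)
    open +-*-Solver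
    by-blob : ∀ r b j → ∑₅ (λ i → r ! i * on (linked blue j i) 1) + ∑₅ (λ i → b ! i * on (linked red j i) 1) ≡ misfits r b j
    by-blob (five r₀ r₁ r₂ r₃ r₄) (five b₀ b₁ b₂ b₃ b₄) 0F = solve 10 (λ r₀ r₁ r₂ r₃ r₄ b₀ b₁ b₂ b₃ b₄ →
      (r₀ :* con 0 :+ (r₁ :* con 0 :+ (r₂ :* con 1 :+ (r₃ :* con 1 :+ r₄ :* con 0)))) :+
      (b₀ :* con 0 :+ (b₁ :* con 1 :+ (b₂ :* con 0 :+ (b₃ :* con 0 :+ b₄ :* con 1)))) := b₁ :+ (r₂ :+ (r₃ :+ b₄)))
      refl r₀ r₁ r₂ r₃ r₄ b₀ b₁ b₂ b₃ b₄
    by-blob (five r₀ r₁ r₂ r₃ r₄) (five b₀ b₁ b₂ b₃ b₄) 1F = solve 10 (λ r₀ r₁ r₂ r₃ r₄ b₀ b₁ b₂ b₃ b₄ →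
      (r₀ :* con 0 :+ (r₁ :* con 0 :+ (r₂ :* con 0 :+ (r₃ :* con 1 :+ r₄ :* con 1)))) :+
      (b₀ :* con 1 :+ (b₁ :* con 0 :+ (b₂ :* con 1 :+ (b₃ :* con 0 :+ b₄ :* con 0)))) := b₀ :+ (b₂ :+ (r₃ :+ r₄)))
      refl r₀ r₁ r₂ r₃ r₄ b₀ b₁ b₂ b₃ b₄
    by-blob (five r₀ r₁ r₂ r₃ r₄) (five b₀ b₁ b₂ b₃ b₄) 2F = solve 10 (λ r₀ r₁ r₂ r₃ r₄ b₀ b₁ b₂ b₃ b₄ →
      (r₀ :* con 1 :+ (r₁ :* con 0 :+ (r₂ :* con 0 :+ (r₃ :* con 0 :+ r₄ :* con 1)))) :+
      (b₀ :* con 0 :+ (b₁ :* con 1 :+ (b₂ :* con 0 :+ (b₃ :* con 1 :+ b₄ :* con 0)))) := r₀ :+ (b₁ :+ (b₃ :+ r₄)))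
      refl r₀ r₁ r₂ r₃ r₄ b₀ b₁ b₂ b₃ b₄
    by-blob (five r₀ r₁ r₂ r₃ r₄) (five b₀ b₁ b₂ b₃ b₄) 3F = solve 10 (λ r₀ r₁ r₂ r₃ r₄ b₀ b₁ b₂ b₃ b₄ →
      (r₀ :* con 1 :+ (r₁ :* con 1 :+ (r₂ :* con 0 :+ (r₃ :* con 0 :+ r₄ :* con 0)))) :+
      (b₀ :* con 0 :+ (b₁ :* con 0 :+ (b₂ :* con 1 :+ (b₃ :* con 0 :+ b₄ :* con 1)))) := r₀ :+ (r₁ :+ (b₂ :+ b₄)))
      refl r₀ r₁ r₂ r₃ r₄ b₀ b₁ b₂ b₃ b₄
    by-blob (five r₀ r₁ r₂ r₃ r₄) (five b₀ b₁ b₂ b₃ b₄) 4F = solve 10 (λ r₀ r₁ r₂ r₃ r₄ b₀ b₁ b₂ b₃ b₄ →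
      (r₀ :* con 0 :+ (r₁ :* con 1 :+ (r₂ :* con 1 :+ (r₃ :* con 0 :+ r₄ :* con 0)))) :+
      (b₀ :* con 1 :+ (b₁ :* con 0 :+ (b₂ :* con 0 :+ (b₃ :* con 1 :+ b₄ :* con 0)))) := b₀ :+ (r₁ :+ (r₂ :+ b₃)))
      refl r₀ r₁ r₂ r₃ r₄ b₀ b₁ b₂ b₃ b₄

≡₅ᵇ⇒≡ : ∀ v w → v ≡₅ᵇ w ≡ true → v ≡ w
≡₅ᵇ⇒≡ (five a b c d e) (five a′ b′ c′ d′ e′) h =
  let (h₀ , h₁) = ∧-true {a ≡ᵇ a′} h
      (k₁ , h₂) = ∧-true {b ≡ᵇ b′} h₁
      (k₂ , h₃) = ∧-true {c ≡ᵇ c′} h₂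
      (k₃ , k₄) = ∧-true {d ≡ᵇ d′} h₃
  in five-cong (eq a a′ h₀) (eq b b′ k₁) (eq c c′ k₂) (eq d d′ k₃) (eq e e′ k₄)
  where
  eq : ∀ m n → (m ≡ᵇ n) ≡ true → m ≡ n
  eq m n h = ℕ.≡ᵇ⇒≡ m n (T-true h)

listed-sound : ∀ ε table v r → TableOK ε table → listed table v ≡ true → (∀ i → r ! i ≤ v ! i) →
  (∃[ j ] Extends ε v r (v ∖₅ r) j) ⊎ Certificate v ε r (v ∖₅ r)
listed-sound ε table v r ok h r≤v = go (any-true (λ row → v ≡₅ᵇ proj₁ row) table h)
  where
  go : ∃[ row ] row ∈ table × v ≡₅ᵇ proj₁ row ≡ true → (∃[ j ] Extends ε v r (v ∖₅ r) j) ⊎ Certificate v ε r (v ∖₅ r)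
  go ((a , πs) , row∈ , e) with ≡₅ᵇ⇒≡ v a e
  ... | refl = row-sound ε v πs r (all-true {xs = table} (TableOK.rows-OK ok) row∈) r≤v

module _ (G : Colouring (suc m)) (u : Fin (suc m)) (s : Bool) (C : Configuration m)
  (κ≡ : ∀ x y → Configuration.κ C x y ≡ recolour s (colour G (punchIn u x) (punchIn u y)))
  (q≡ : ∀ x → Configuration.q C x ≡ recolour s (colour G u (punchIn u x)))
  (table : List (Five × List Plan)) (ok : TableOK (Configuration.ε C) table)
  (h : listed table (sizesOf (Configuration.blob C)) ≡ true) where

  open Configuration C

  -- Here the evaluated table meets the colouring: its row for the sizes of the blobs is read at the
  -- actual numbers of red neighbours of `u`.
  dichotomy : pack G > (+ (suc m * m)) / 4 ⊎ ∃[ j ] Extends ε (sizesOf blob) (redSizes q blob) (sizesOf blob ∖₅ redSizes q blob) j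
  dichotomy with listed-sound ε table (sizesOf blob) (redSizes q blob) ok h (redSizes-≤ q blob)
  ... | inj₁ e    = inj₂ e
  ... | inj₂ cert = inj₁ (pack-large G u s C κ≡ q≡ (sizesOf blob) (redSizes q blob) (sizesOf blob ∖₅ redSizes q blob)
                      (λ i → sym (sizesOf-! blob i)) (class-sizes q blob) cert)

-- Configurations without and with a flipped edge

does-false : ∀ {P : Set} (P? : Dec P) → does P? ≡ false → ¬ P
does-false (no ¬p) _ = ¬p

sum-on-δ : (b : Fin n → Bool) (x : Fin n) (k : ℕ) → (sum λ y → on (b y) (on (does (y ≟ x)) k)) ≡ on (b x) k
sum-on-δ b x k = trans (sum-cong λ y → on-swap (b y) (does (y ≟ x)) k) (sum-δ x (λ y → on (b y) k))

plain : (H : Colouring m) (s : Bool) (blob : Fin m → Fin 5) (q : Fin m → Colour) → Follows s H blob → Configuration m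
plain H s blob q F = record
  { blob = blob ; κ = λ x y → recolour s (colour H x y) ; q = q
  ; S = λ _ _ → false ; ex = λ _ _ → false ; ε = 0
  ; κ-sym    = λ x y → cong (recolour s) (colour-sym H x y)
  ; S-sym    = λ _ _ → refl
  ; cross    = λ x y c l _ → F x y c l
  ; S-blobs  = λ _ _ ()
  ; S-blue   = λ _ _ ()
  ; S-ex     = λ _ _ ()
  ; S-unique = λ x → ℕ.≤-trans (ℕ.≤-reflexive (sum-0 λ y → refl)) z≤n
  ; S-total  = sum-0 λ x → sum-0 λ y → refl
  ; S-defect = λ i j → ℕ.≤-trans (ℕ.≤-reflexive (sum-0 λ x →
      trans (cong (on (does (blob x ≟ i))) (sum-0 λ y → on-0 (does (blob y ≟ j)))) (on-0 (does (blob x ≟ i))))) z≤n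
  ; ε²       = refl
  ; ex-count = λ i j → cong ((sum λ z → on (does (blob z ≟ j)) 1) ∸_) (sym (no-defect i j))
  }
  where
  no-defect : ∀ i j → defect 0 i j ≡ 0
  no-defect = from-yes (Fin.all? λ i → Fin.all? λ j → defect 0 i j ℕ.≟ 0)

record FollowsBut (s : Bool) (H : Colouring m) (blob : Fin m → Fin 5) (a b : Fin m) : Set where
  field
    elsewhere : ∀ x y c → linked c (blob x) (blob y) ≡ true → ¬ SamePair a b x y → recolour s (colour H x y) ≡ c
    at-pair   : ∀ x y c → linked c (blob x) (blob y) ≡ true → SamePair a b x y → recolour s (colour H x y) ≡ opposite c

flipped : (H : Colouring m) (s : Bool) (blob : Fin m → Fin 5) (q : Fin m → Colour) (a b : Fin m) →
          blob a ≡ 0F → blob b ≡ 1F → FollowsBut s H blob a b → Configuration m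
flipped {m} H s blob q a b a∈0 b∈1 F = record
  { blob = blob ; κ = λ x y → recolour s (colour H x y) ; q = q ; S = S ; ex = ex ; ε = 1
  ; κ-sym    = λ x y → cong (recolour s) (colour-sym H x y)
  ; S-sym    = λ x y → does-iff (samePair? a b x y) (samePair? a b y x) pair-sym pair-sym
  ; cross    = λ x y c l h → FollowsBut.elsewhere F x y c l (does-false (samePair? a b x y) h)
  ; S-blobs  = λ x y h → pair-blobs (does-true (samePair? a b x y) h)
  ; S-blue   = λ x y h → pair-blue (does-true (samePair? a b x y) h)
  ; S-ex     = λ x y h → pair-ex (does-true (samePair? a b x y) h)
  ; S-unique = λ x → ℕ.≤-trans (ℕ.≤-reflexive (row x)) (at-most-one x)
  ; S-total  = trans (sum-cong row) (trans (sum-+ _ _) (cong₂ _+_ (sum-δ a (λ _ → 1)) (sum-δ b (λ _ → 1))))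
  ; S-defect = λ i j → ℕ.≤-trans (ℕ.≤-reflexive (block i j)) (defect≥ i j)
  ; ε²       = refl
  ; ex-count = ex-count
  }
  where
  S : Fin m → Fin m → Bool
  S x y = does (samePair? a b x y)

  ex : Fin 5 → Fin m → Bool
  -- Inner edges of the blob of `a` avoid the apex `b`, and those of the blob of `b` avoid `a`.
  ex 0F z = does (z ≟ b)
  ex 1F z = does (z ≟ a)
  ex _  z = false

  a≢b : a ≢ b
  a≢b refl with trans (sym a∈0) b∈1
  ... | ()

  pair-sym : ∀ {x y} → SamePair a b x y → SamePair a b y x
  pair-sym (inj₁ (x≡a , y≡b)) = inj₂ (y≡b , x≡a)
  pair-sym (inj₂ (x≡b , y≡a)) = inj₁ (y≡a , x≡b)

  pair-blobs : ∀ {x y} → SamePair a b x y → (blob x ≡ 0F × blob y ≡ 1F) ⊎ (blob x ≡ 1F × blob y ≡ 0F)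
  pair-blobs (inj₁ (refl , refl)) = inj₁ (a∈0 , b∈1)
  pair-blobs (inj₂ (refl , refl)) = inj₂ (b∈1 , a∈0)

  pair-blue : ∀ {x y} → SamePair a b x y → recolour s (colour H x y) ≡ blue
  -- The blobs 0 and 1 are linked in red, so the flipped edge between them is blue.
  pair-blue {x} {y} h = FollowsBut.at-pair F x y red (red-link (pair-blobs h)) h
    where
    red-link : ∀ {i j} → (i ≡ 0F × j ≡ 1F) ⊎ (i ≡ 1F × j ≡ 0F) → linked red i j ≡ true
    red-link (inj₁ (refl , refl)) = refl
    red-link (inj₂ (refl , refl)) = refl

  pair-ex : ∀ {x y} → SamePair a b x y → ex (blob x) y ≡ true
  pair-ex (inj₁ (refl , refl)) = trans (cong (λ i → ex i b) a∈0) (dec-true (b ≟ b) refl)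
  pair-ex (inj₂ (refl , refl)) = trans (cong (λ i → ex i a) b∈1) (dec-true (a ≟ a) refl)

  split : ∀ x y → on (S x y) 1 ≡ on (does (x ≟ a)) (on (does (y ≟ b)) 1) + on (does (x ≟ b)) (on (does (y ≟ a)) 1)
  split x y with x ≟ a
  ... | no _ = on-∧ (does (x ≟ b)) (does (y ≟ a)) 1
  ... | yes refl rewrite dec-false (a ≟ b) a≢b | Bool.∨-identityʳ (does (y ≟ b)) = sym (ℕ.+-identityʳ _)

  row : ∀ x → (sum λ y → on (S x y) 1) ≡ on (does (x ≟ a)) 1 + on (does (x ≟ b)) 1
  row x = trans (sum-cong (split x)) (trans (sum-+ _ _) (cong₂ _+_
    (sum-on-δ (λ _ → does (x ≟ a)) b 1) (sum-on-δ (λ _ → does (x ≟ b)) a 1)))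

  at-most-one : ∀ x → on (does (x ≟ a)) 1 + on (does (x ≟ b)) 1 ≤ 1
  at-most-one x with x ≟ a
  ... | no _ = on-≤ (does (x ≟ b)) 1
  ... | yes refl rewrite dec-false (a ≟ b) a≢b = ℕ.≤-refl

  block-row : ∀ j x → (sum λ y → on (does (blob y ≟ j)) (on (S x y) 1)) ≡
    on (does (x ≟ a)) (on (does (1F ≟ j)) 1) + on (does (x ≟ b)) (on (does (0F ≟ j)) 1)
  block-row j x = trans (sum-cong λ y → trans (cong (on (does (blob y ≟ j))) (split x y)) (on-+ (does (blob y ≟ j)) _ _))
    (trans (sum-+ _ _) (cong₂ _+_ (part (does (x ≟ a)) b b∈1) (part (does (x ≟ b)) a a∈0)))
    where
    part : ∀ c w {i} → blob w ≡ i → (sum λ y → on (does (blob y ≟ j)) (on c (on (does (y ≟ w)) 1))) ≡ on c (on (does (i ≟ j)) 1)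
    part c w refl = trans (sum-cong λ y → on-swap (does (blob y ≟ j)) c _)
      (trans (sum-on c _) (cong (on c) (sum-on-δ (λ y → does (blob y ≟ j)) w 1)))

  block : ∀ i j → (sum λ x → on (does (blob x ≟ i)) (sum λ y → on (does (blob y ≟ j)) (on (S x y) 1))) ≡
    on (does (0F ≟ i)) (on (does (1F ≟ j)) 1) + on (does (1F ≟ i)) (on (does (0F ≟ j)) 1)
  block i j = trans (sum-cong λ x → trans (cong (on (does (blob x ≟ i))) (block-row j x)) (on-+ (does (blob x ≟ i)) _ _))
    (trans (sum-+ _ _) (cong₂ _+_ (part a a∈0) (part b b∈1)))
    where
    part : ∀ w {i′ k} → blob w ≡ i′ → (sum λ x → on (does (blob x ≟ i)) (on (does (x ≟ w)) k)) ≡ on (does (i′ ≟ i)) k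
    part w {k = k} refl = sum-on-δ (λ x → does (blob x ≟ i)) w k

  defect≥ : ∀ i j → on (does (0F ≟ i)) (on (does (1F ≟ j)) 1) + on (does (1F ≟ i)) (on (does (0F ≟ j)) 1) ≤ defect 1 i j
  defect≥ = from-yes (Fin.all? λ i → Fin.all? λ j →
    (on (does (0F ≟ i)) (on (does (1F ≟ j)) 1) + on (does (1F ≟ i)) (on (does (0F ≟ j)) 1)) ℕ.≤? defect 1 i j)

  ex-count : ∀ i j → (sum λ z → on (does (blob z ≟ j)) (on (not (ex i z)) 1)) ≡ (sum λ z → on (does (blob z ≟ j)) 1) ∸ defect 1 i j
  ex-count 0F j = trans (fibre-remove blob b j) (cong ((sum λ z → on (does (blob z ≟ j)) 1) ∸_)
    (trans (cong (λ i → on (does (i ≟ j)) 1) b∈1) (is-defect j)))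
    where
    is-defect : ∀ j → on (does (1F ≟ j)) 1 ≡ defect 1 0F j
    is-defect = from-yes (Fin.all? λ j → on (does (1F ≟ j)) 1 ℕ.≟ defect 1 0F j)
  ex-count 1F j = trans (fibre-remove blob a j) (cong ((sum λ z → on (does (blob z ≟ j)) 1) ∸_)
    (trans (cong (λ i → on (does (i ≟ j)) 1) a∈0) (is-defect j)))
    where
    is-defect : ∀ j → on (does (0F ≟ j)) 1 ≡ defect 1 1F j
    is-defect = from-yes (Fin.all? λ j → on (does (0F ≟ j)) 1 ℕ.≟ defect 1 1F j)
  ex-count 2F j = cong ((sum λ z → on (does (blob z ≟ j)) 1) ∸_) (sym (from-yes (Fin.all? λ j → defect 1 2F j ℕ.≟ 0) j))
  ex-count 3F j = cong ((sum λ z → on (does (blob z ≟ j)) 1) ∸_) (sym (from-yes (Fin.all? λ j → defect 1 3F j ℕ.≟ 0) j))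
  ex-count 4F j = cong ((sum λ z → on (does (blob z ≟ j)) 1) ∸_) (sym (from-yes (Fin.all? λ j → defect 1 4F j ℕ.≟ 0) j))

-- Reduction to the listed arrangements

Bounded : ℕ → Set
Bounded k = 2 ≤ k × k ≤ 5

bounded₁ : All (All Bounded) ℬ₁
bounded₁ = from-yes (All.all? (All.all? λ k → (2 ℕ.≤? k) ×-dec (k ℕ.≤? 5)) ℬ₁)

-- Needed when the flipped edge lies inside a blob: then `H` is itself a blow-up, with sizes from
-- `ℬ₂`, and has to be treated as a member of `𝒞₁`.
ℬ₂⊆ℬ₁ : All (_∈ ℬ₁) ℬ₂
ℬ₂⊆ℬ₁ = from-yes (All.all? (λ b → mem? (List.≡-dec ℕ._≟_) b ℬ₁) ℬ₂)

positive : ∀ {ℬ} → All (All Bounded) ℬ → All (All (1 ≤_)) ℬ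
positive = All.map (All.map λ (h , _) → ℕ.≤-trans (s≤s z≤n) h)

bounded₂ : All (All Bounded) ℬ₂
bounded₂ = All.map (All.lookup bounded₁) ℬ₂⊆ℬ₁

∀₂₋₅-true : ∀ f → ∀₂₋₅ f ≡ true → ∀ v → All Bounded (toList v) → f v ≡ true
∀₂₋₅-true f h (five a b c d e) (ha ∷ hb ∷ hc ∷ hd ∷ he ∷ []) =
  subst (λ v → f v ≡ true) (five-cong (back ha) (back hb) (back hc) (back hd) (back he)) h₅
  where
  low : ∀ {k} → Bounded k → k ∸ 2 ≤ 3
  low (_ , h) = ℕ.∸-monoˡ-≤ 2 h
  back : ∀ {k} → Bounded k → 2 + (k ∸ 2) ≡ k
  back (h , _) = ℕ.m+[n∸m]≡n h
  g₁ g₂ g₃ g₄ g₅ : ℕ → Bool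
  g₁ k = ∀≤ 3 λ b → ∀≤ 3 λ c → ∀≤ 3 λ d → ∀≤ 3 λ e → f (five (2 + k) (2 + b) (2 + c) (2 + d) (2 + e))
  g₂ k = ∀≤ 3 λ c → ∀≤ 3 λ d → ∀≤ 3 λ e → f (five (2 + (a ∸ 2)) (2 + k) (2 + c) (2 + d) (2 + e))
  g₃ k = ∀≤ 3 λ d → ∀≤ 3 λ e → f (five (2 + (a ∸ 2)) (2 + (b ∸ 2)) (2 + k) (2 + d) (2 + e))
  g₄ k = ∀≤ 3 λ e → f (five (2 + (a ∸ 2)) (2 + (b ∸ 2)) (2 + (c ∸ 2)) (2 + k) (2 + e))
  g₅ k = f (five (2 + (a ∸ 2)) (2 + (b ∸ 2)) (2 + (c ∸ 2)) (2 + (d ∸ 2)) (2 + k))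
  h₅ : g₅ (e ∸ 2) ≡ true
  h₅ = ∀≤-true 3 {g₅} (∀≤-true 3 {g₄} (∀≤-true 3 {g₃} (∀≤-true 3 {g₂} (∀≤-true 3 {g₁} h (low ha)) (low hb)) (low hc)) (low hd)) (low he)

∈ᵇ-bounded : ∀ {ℬ} → All (All Bounded) ℬ → ∀ v → v ∈ᵇ ℬ ≡ true → All Bounded (toList v)
∈ᵇ-bounded {ℬ} h v v∈ = All-resp-↭ (sort-↭ (toList v))
  (All.lookup h (does-true (mem? (List.≡-dec ℕ._≟_) (sort (toList v)) ℬ) v∈))

or-else : ∀ b c → not b ∨ c ≡ true → b ≡ true → c ≡ true
or-else true c h _ = h

arrangement₁ : ∀ v → v ∈ᵇ ℬ₁ ≡ true → ∃[ σ ] listed table₁ (arrange (from σ) v) ≡ true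
arrangement₁ v v∈ = map₂ proj₂ (any-true (λ σ → listed table₁ (arrange (from σ) v)) symmetries
  (or-else (v ∈ᵇ ℬ₁) _ (∀₂₋₅-true arranged₁ arranged₁-all v (∈ᵇ-bounded {ℬ₁} bounded₁ v v∈)) v∈))

arrangement₂ : ∀ v → v ∈ᵇ ℬ₂ ≡ true → ∀ i j → i ≢ j →
  ∃[ σ ] ((to σ i ≡ 0F × to σ j ≡ 1F) ⊎ (to σ j ≡ 0F × to σ i ≡ 1F)) × listed table₂ (arrange (from σ) v) ≡ true
arrangement₂ v v∈ i j i≢j = unpack (any-true (relocates v i j) symmetries (distinct
  (∀₅-true {relocatable v i} (∀₅-true {λ i → ∀₅ (relocatable v i)}
    (or-else (v ∈ᵇ ℬ₂) _ (∀₂₋₅-true arranged₂ arranged₂-all v (∈ᵇ-bounded {ℬ₂} bounded₂ v v∈)) v∈) i) j)))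
  where
  distinct : relocatable v i j ≡ true → any (relocates v i j) symmetries ≡ true
  distinct h = trans (sym (cong (_∨ any (relocates v i j) symmetries) (dec-false (i ≟ j) i≢j))) h
  moves : ∀ i j σ → movesTo01 i j σ ≡ true → to σ i ≡ 0F × to σ j ≡ 1F
  moves i j σ h = let (h₀ , h₁) = ∧-true {does (to σ i ≟ 0F)} h in does-true (to σ i ≟ 0F) h₀ , does-true (to σ j ≟ 1F) h₁
  unpack : ∃[ σ ] σ ∈ symmetries × relocates v i j σ ≡ true →
    ∃[ σ ] ((to σ i ≡ 0F × to σ j ≡ 1F) ⊎ (to σ j ≡ 0F × to σ i ≡ 1F)) × listed table₂ (arrange (from σ) v) ≡ true
  unpack (σ , _ , h) with ∧-true {movesTo01 i j σ ∨ movesTo01 j i σ} h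
  ... | h₀ , h₁ with ∨-true (movesTo01 i j σ) h₀
  ...   | inj₁ k = σ , inj₁ (moves i j σ k) , h₁
  ...   | inj₂ k = σ , inj₂ (moves j i σ k) , h₁

-- The cases of a blow-up and of a flipped blow-up

Goal : ∀ {m} → Colouring (suc m) → Set
Goal {m} G = (pack G > (+ (suc m * m)) / 4) ⊎ 𝒞 G

move : (σ : Symmetry) (blob : Fin m → Fin 5) → ∀ c x y → linked c (to σ (blob x)) (to σ (blob y)) ≡ true →
       linked (recolour (swaps σ) c) (blob x) (blob y) ≡ true
move σ blob c x y l = trans (sym (linked-to σ c (blob x) (blob y))) l

recolour-≡ : ∀ s {c d} → d ≡ recolour s c → recolour s d ≡ c
recolour-≡ s {c} refl = recolour² s c

move-follows : (σ : Symmetry) {H : Colouring m} {blob : Fin m → Fin 5} → Follows false H blob → Follows (swaps σ) H (to σ ∘ blob)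
move-follows σ {blob = blob} F x y c l = recolour-≡ (swaps σ) (F x y _ (move σ blob c x y l))

not-pair : ∀ (u v : Fin (suc m)) x y → ¬ SamePair u v (punchIn u x) (punchIn u y)
not-pair u v x y (inj₁ (e , _)) = punchInᵢ≢i u x e
not-pair u v x y (inj₂ (_ , e)) = punchInᵢ≢i u y e

pattern-case : ∀ {m} (G : Colouring (suc m)) u s (blob : Fin m → Fin 5) →
  Follows s (G ∖ u) blob → listed table₁ (sizesOf blob) ≡ true → Goal G
pattern-case {m} G u s blob F h =
  conclude (dichotomy G u s (plain (G ∖ u) s blob q F) (λ _ _ → refl) (λ _ → refl) table₁ table₁-OK h)
  where
  q : Fin m → Colour
  q x = recolour s (colour G u (punchIn u x))
  extended : ∀ {ℬ} j → increment j (sizesOf blob) ∈ᵇ ℬ ≡ true → sizesOf (extend u j blob) ∈ᵇ ℬ ≡ true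
  extended {ℬ} j = subst (λ v → v ∈ᵇ ℬ ≡ true) (sym (extend-sizes u j blob))
  flip-one : ∀ j → increment j (sizesOf blob) ∈ᵇ ℬ₂ ≡ true →
    (∃[ x ] misfit q j blob x ≡ true × (∀ y → y ≢ x → misfit q j blob y ≡ false)) → 𝒞₂ G
  flip-one j v∈ (x₁ , wrong , right) = u , punchIn u x₁ , (λ e → punchInᵢ≢i u x₁ (sym e)) ,
    follows⇒blowUp ℬ₂ (positive bounded₂) s (flip G u (punchIn u x₁)) (extend u j blob)
      (follows-extend s (flip G u (punchIn u x₁)) u j blob
        (λ x y c l → trans (cong (recolour s) (flip-off G (not-pair u (punchIn u x₁) x y))) (F x y c l))
        (λ x c l → at-u-fits x c l (x ≟ x₁)))
      (extended {ℬ₂} j v∈)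
    where
    at-u-fits : ∀ x c → linked c j (blob x) ≡ true → Dec (x ≡ x₁) →
                recolour s (colour (flip G u (punchIn u x₁)) u (punchIn u x)) ≡ c
    -- At a misfit the link has the colour opposite to `q`, so the flip repairs precisely this edge.
    at-u-fits x c l (yes refl) = trans (cong (recolour s) (flip-on G (inj₁ (refl , refl))))
          (trans (recolour-opposite s _) (linked-unique j (blob x) wrong l))
    at-u-fits x c l (no x≢x₁) = trans (cong (recolour s) (flip-off G other)) (misfit-false q j blob x c (right x x≢x₁) l)
      where
      other : ¬ SamePair u (punchIn u x₁) u (punchIn u x)
      other (inj₁ (_ , e)) = x≢x₁ (punchIn-injective u x x₁ e)
      other (inj₂ (_ , e)) = punchInᵢ≢i u x e
  conclude : pack G > (+ (suc m * m)) / 4 ⊎ ∃[ j ] Extends 0 (sizesOf blob) (redSizes q blob) (sizesOf blob ∖₅ redSizes q blob) j → Goal G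
  conclude (inj₁ large) = inj₁ large
  conclude (inj₂ (j , matches none v∈)) = inj₂ (inj₁ (follows⇒blowUp ℬ₁ (positive bounded₁) s G (extend u j blob)
    (follows-extend s G u j blob F λ x c l → misfit-false q j blob x c
      (none-true (misfit q j blob) (trans (sym (misfits-sum q blob j)) none) x) l)
    (extended {ℬ₁} j v∈)))
  conclude (inj₂ (j , one-flip one v∈)) =
    inj₂ (inj₂ (flip-one j v∈ (one-true (misfit q j blob) (trans (sym (misfits-sum q blob j)) one))))

plain-case : (G : Colouring (suc m)) (u : Fin (suc m)) (blob : Fin m → Fin 5) →
  Follows false (G ∖ u) blob → sizesOf blob ∈ᵇ ℬ₁ ≡ true → Goal G
plain-case G u blob F v∈ = move-to (arrangement₁ (sizesOf blob) v∈)
  where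
  move-to : ∃[ σ ] listed table₁ (arrange (from σ) (sizesOf blob)) ≡ true → Goal G
  move-to (σ , h) = pattern-case G u (swaps σ) (to σ ∘ blob) (move-follows σ {G ∖ u} {blob} F)
    (subst (λ v → listed table₁ v ≡ true) (sym (move-sizes σ blob)) h)

flipped-case : ∀ {m} (G : Colouring (suc m)) u s (blob : Fin m → Fin 5) a b → blob a ≡ 0F → blob b ≡ 1F →
  FollowsBut s (G ∖ u) blob a b → listed table₂ (sizesOf blob) ≡ true → Goal G
flipped-case {m} G u s blob a b a∈0 b∈1 F h =
  conclude (dichotomy G u s (flipped (G ∖ u) s blob q a b a∈0 b∈1 F) (λ _ _ → refl) (λ _ → refl) table₂ table₂-OK h)
  where
  q : Fin m → Colour
  q x = recolour s (colour G u (punchIn u x))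
  u′ = punchIn u a
  v′ = punchIn u b
  a≢b : a ≢ b
  a≢b refl with trans (sym a∈0) b∈1
  ... | ()
  flipped-follows : Follows s (flip G u′ v′ ∖ u) blob
  flipped-follows x y c l with samePair? a b x y
  ... | yes p = trans (cong (recolour s) (flip-on G (up p))) (trans (recolour-opposite s _)
                  (trans (cong opposite (FollowsBut.at-pair F x y c l p)) (opposite² c)))
    where
    up : SamePair a b x y → SamePair u′ v′ (punchIn u x) (punchIn u y)
    up (inj₁ (e , e′)) = inj₁ (cong (punchIn u) e , cong (punchIn u) e′)
    up (inj₂ (e , e′)) = inj₂ (cong (punchIn u) e , cong (punchIn u) e′)
  ... | no ¬p = trans (cong (recolour s) (flip-off G (¬p ∘ down))) (FollowsBut.elsewhere F x y c l ¬p)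
    where
    down : SamePair u′ v′ (punchIn u x) (punchIn u y) → SamePair a b x y
    down (inj₁ (e , e′)) = inj₁ (punchIn-injective u x a e , punchIn-injective u y b e′)
    down (inj₂ (e , e′)) = inj₂ (punchIn-injective u x b e , punchIn-injective u y a e′)
  not-at-u : ∀ x → ¬ SamePair u′ v′ u (punchIn u x)
  not-at-u x (inj₁ (e , _)) = punchInᵢ≢i u a (sym e)
  not-at-u x (inj₂ (e , _)) = punchInᵢ≢i u b (sym e)
  conclude : pack G > (+ (suc m * m)) / 4 ⊎ ∃[ j ] Extends 1 (sizesOf blob) (redSizes q blob) (sizesOf blob ∖₅ redSizes q blob) j → Goal G
  conclude (inj₁ large) = inj₁ large
  -- Since ε = 1, `matches` cannot occur, and `one-flip` leaves no misfit at `u`: the flipped edge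
  -- of `H` is the only flip in `G`.
  conclude (inj₂ (j , one-flip one v∈)) = inj₂ (inj₂ (u′ , v′ , (λ e → a≢b (punchIn-injective u a b e)) ,
    follows⇒blowUp ℬ₂ (positive bounded₂) s (flip G u′ v′) (extend u j blob)
      (follows-extend s (flip G u′ v′) u j blob flipped-follows λ x c l →
        trans (cong (recolour s) (flip-off G (not-at-u x))) (misfit-false q j blob x c
          (none-true (misfit q j blob) (trans (sym (misfits-sum q blob j)) (ℕ.suc-injective one)) x) l))
      (subst (λ v → v ∈ᵇ ℬ₂ ≡ true) (sym (extend-sizes u j blob)) v∈)))

-- A blow-up puts no condition on edges inside a blob, so such a flip leaves the pattern intact.
unflip : (G : Colouring (suc m)) (u : Fin (suc m)) (blob : Fin m → Fin 5) (a b : Fin m) → blob a ≡ blob b →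
         IsPentagonBlowUp (flip (G ∖ u) a b) blob → Follows false (G ∖ u) blob
unflip G u blob a b e P x y c l = trans (sym (flip-off (G ∖ u) not-ab)) (blowUp-follows P x y c l)
  where
  not-ab : ¬ SamePair a b x y
  not-ab (inj₁ (refl , refl)) = linked-irrefl c (blob x) (trans (cong (linked c (blob x)) e) l)
  not-ab (inj₂ (refl , refl)) = linked-irrefl c (blob y) (trans (cong (λ i → linked c i (blob y)) e) l)

move-followsBut : (σ : Symmetry) (H : Colouring m) (blob : Fin m → Fin 5) (a b : Fin m) →
  IsPentagonBlowUp (flip H a b) blob → FollowsBut (swaps σ) H (to σ ∘ blob) a b
move-followsBut σ H blob a b P = record
  { elsewhere = λ x y c l ¬p → recolour-≡ s (trans (sym (flip-off H ¬p)) (blowUp-follows P x y _ (move σ blob c x y l)))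
  ; at-pair   = λ x y c l p → recolour-≡ s (trans (sym (opposite² (colour H x y)))
      (trans (cong opposite (trans (sym (flip-on H p)) (blowUp-follows P x y _ (move σ blob c x y l)))) (sym (recolour-opposite s c))))
  }
  where s = swaps σ

followsBut-sym : ∀ {s} {H : Colouring m} {blob : Fin m → Fin 5} {a b} → FollowsBut s H blob a b → FollowsBut s H blob b a
followsBut-sym {a = a} {b} F = record
  { elsewhere = λ x y c l ¬p → FollowsBut.elsewhere F x y c l (¬p ∘ swap-pair)
  ; at-pair   = λ x y c l p → FollowsBut.at-pair F x y c l (swap-pair p) }
  where
  swap-pair : ∀ {a b x y} → SamePair a b x y → SamePair b a x y
  swap-pair (inj₁ p) = inj₂ p
  swap-pair (inj₂ p) = inj₁ p

flip-case : (G : Colouring (suc m)) (u : Fin (suc m)) (blob : Fin m → Fin 5) (a b : Fin m) →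
  IsPentagonBlowUp (flip (G ∖ u) a b) blob →
  (∃[ σ ] ((to σ (blob a) ≡ 0F × to σ (blob b) ≡ 1F) ⊎ (to σ (blob b) ≡ 0F × to σ (blob a) ≡ 1F)) ×
    listed table₂ (arrange (from σ) (sizesOf blob)) ≡ true) → Goal G
flip-case G u blob a b P (σ , moved , h) = place moved
  where
  F : FollowsBut (swaps σ) (G ∖ u) (to σ ∘ blob) a b
  F = move-followsBut σ (G ∖ u) blob a b P
  listed-moved : listed table₂ (sizesOf (to σ ∘ blob)) ≡ true
  listed-moved = subst (λ v → listed table₂ v ≡ true) (sym (move-sizes σ blob)) h
  place : (to σ (blob a) ≡ 0F × to σ (blob b) ≡ 1F) ⊎ (to σ (blob b) ≡ 0F × to σ (blob a) ≡ 1F) → Goal G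
  place (inj₁ (a∈0 , b∈1)) = flipped-case G u (swaps σ) (to σ ∘ blob) a b a∈0 b∈1 F listed-moved
  place (inj₂ (b∈0 , a∈1)) = flipped-case G u (swaps σ) (to σ ∘ blob) b a b∈0 a∈1 (followsBut-sym F) listed-moved

theorem7p1 : (m : ℕ) (G : Colouring (suc m)) (u : Fin (suc m)) → 𝒞 (G ∖ u) →
    (pack G > (+ (suc m * m)) / 4) ⊎ 𝒞 G
theorem7p1 m G u (inj₁ (blob , P , b , b∈ , sizes)) = plain-case G u blob (blowUp-follows P)
  (∈ᵇ-↭ ℬ₁ ℬ₁↗ b∈ (subst (_↭ b) (blobSizes≡ blob) sizes))
theorem7p1 m G u (inj₂ (a , b , a≢b , blob , P , β , β∈ , sizes)) = cases (blob a ≟ blob b)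
  where
  sizes≡ : toList (sizesOf blob) ↭ β
  sizes≡ = subst (_↭ β) (blobSizes≡ blob) sizes
  cases : Dec (blob a ≡ blob b) → Goal G
  cases (yes e) = plain-case G u blob (unflip G u blob a b e P) (∈ᵇ-↭ ℬ₁ ℬ₁↗ (All.lookup ℬ₂⊆ℬ₁ β∈) sizes≡)
  cases (no ≢) = flip-case G u blob a b P (arrangement₂ (sizesOf blob) (∈ᵇ-↭ ℬ₂ ℬ₂↗ β∈ sizes≡) (blob a) (blob b) ≢)
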